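{- Let $t$ be an indeterminate. As formal series in $z$ with coefficients in the $\mathbb{Q}(t)$-linear operators on $\Gamma_{\mathbb{Q}(t)}$, the modified operator is a conjugate of the classical neutral operator: $$\mathcal{Y}(z;t)=\rho_t\,\Phi(z)\,\rho_t^{ -1}.$$ Consequently, for every strict partition $\lambda$, $$\mathcal{Q}_\lambda(X;t)=\rho_t Q_\lambda(X)=Q_\lambda[X-tX].$$
   Context: $\Gamma=\mathbb{Q}[p_1,p_3,p_5,\ldots]$ is the polynomial ring in the odd power sums, graded by $\deg p_n=n$ (elements may be viewed as symmetric functions in an alphabet $X$), and $\Gamma_{\mathbb{Q}(t)}=\Gamma\otimes_{\mathbb{Q}}\mathbb{Q}(t)$. The element $\mathbf{1}\in\Gamma$ is the unit. For odd $n\ge1$, let $a_{ -n}$ be multiplication by $p_n$ and $a_n=\frac n2\frac{\partial}{\partial p_n}$. Classical neutral operator: $$\Phi(z)=\exp\Big(\sum_{n\ge1,\ n\text{ odd}}\tfrac2n a_{ -n}z^n\Big)\exp\Big(-\sum_{n\ge1,\ n\text{ odd}}\tfrac2n a_nz^{ -n}\Big).$$ Modified operator: $$\mathcal{Y}(z;t)=\exp\Big(\sum_{n\ge1,\ n\text{ odd}}\tfrac{2(1-t^n)}n a_{ -n}z^n\Big)\exp\Big(-\sum_{n\ge1,\ n\text{ odd}}\tfrac2{n(1-t^n)} a_nz^{ -n}\Big)=\sum_{m\in\mathbb{Z}}\mathcal{Y}_m(t)z^{ -m}.$$ $\rho_t:\Gamma_{\mathbb{Q}(t)}\to\Gamma_{\mathbb{Q}(t)}$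 is the graded $\mathbb{Q}(t)$-algebra automorphism with $\rho_t(p_n)=(1-t^n)p_n$ for $n$ odd. In plethystic notation, $f[X-tX]$ is the image of $f\in\Gamma$ under $p_n\mapsto p_n[X-tX]=(1-t^n)p_n$. A strict partition is a finite sequence $\lambda=(\lambda_1>\cdots>\lambda_\ell>0)$ of integers. For such $\lambda$, $$\mathcal{Q}_\lambda(X;t)=\mathcal{Y}_{ -\lambda_1}(t)\cdots\mathcal{Y}_{ -\lambda_\ell}(t)\mathbf{1}.$$ Schur $Q$-functions $Q_\lambda\in\Gamma$: the one-row functions $q_r=Q_{(r)}$ are given by $\sum_{r\ge0}q_rz^r=\exp\big(2\sum_{n\text{ odd}}\frac{p_n}{n}z^n\big)$ (so $q_0=1$, and $q_r=0$ for $r<0$); for $r\ge s\ge0$, $Q_{(r,s)}=q_rq_s+2\sum_{k=1}^s(-1)^kq_{r+k}q_{s-k}$ (with $Q_{(r,0)}=q_r$ and $Q_{(r,r)}=0$); and in general $Q_\lambda=\operatorname{Pf}\big(Q_{(\lambda_i,\lambda_j)}\big)$, the Pfaffian of the skew-symmetric matrix whose $(i,j)$ entry for $i<j$ is $Q_{(\lambda_i,\lambda_j)}$, where a zero part is appended to $\lambda$ if its length is odd (and $Q_\emptyset=1$). -}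

module Defs where

open import Algebra.Bundles using (CommutativeRing; RawRing)
open import Algebra.Definitions using (AlmostLeftCancellative)
open import Algebra.Module.Bundles.Raw using (RawLeftModule)
import Algebra.Definitions.RawSemiring as RawSemiringDefinitions
import Algebra.Module.Morphism.Structures as ModuleMorphisms
import Algebra.Morphism.Construct.Composition as Composition
import Algebra.Morphism.Construct.Identity as Identity
import Algebra.Morphism.Structures as Morphisms
import Algebra.Properties.AbelianGroup as AbelianGroupProperties
import Algebra.Properties.CommutativeSemigroup as CommutativeSemigroupProperties
import Algebra.Properties.Ring as RingProperties
import Algebra.Properties.Semiring.Exp as Exponentiation
import Algebra.Properties.CommutativeMonoid.Sum as Summation
import Algebra.Solver.Ring.NaturalCoefficients.Default as SemiringSolver
open import Data.Fin.Base using (Fin; toℕ)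
import Data.Fin.Base as Fin
import Data.Fin.Properties as Fin
open import Data.Integer.Base using (ℤ; +_; -[1+_])
import Data.Integer.Base as ℤ
open import Data.List.Base using (List; []; _∷_; _++_; map; foldr; concatMap; length; filter; allFin)
open import Data.List.Relation.Unary.All using (All)
open import Data.List.Relation.Unary.Linked using (Linked)
open import Data.Nat.Base using (ℕ; zero; suc; _∸_; _<_; _≤_; _>_; _⊔_; ⌈_/2⌉; _!; z≤n; s≤s)
import Data.Nat.Base as ℕ
import Data.Nat.Properties as ℕ
open import Data.Product.Base using (_×_; _,_; proj₁; proj₂)
open import Data.Rational.Base using (ℚ; 0ℚ; 1ℚ; _/_)
import Data.Rational.Base as ℚ
import Data.Rational.Properties as ℚ
open import Data.Vec.Base using (Vec; lookup; removeAt)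
import Data.Vec.Base as Vec
open import Function.Base using (id)
open import Level using (Level; 0ℓ)
import Level
open import Relation.Binary.Bundles using (Setoid)
open import Relation.Binary.Definitions using (Decidable; tri<; tri≈; tri>)
open import Relation.Binary.PropositionalEquality.Core using (_≡_; _≢_; subst)
import Relation.Binary.PropositionalEquality.Core as ≡
import Relation.Binary.Reasoning.Setoid as SetoidReasoning
open import Relation.Nullary.Decidable.Core using (yes; no)
open import Relation.Nullary.Negation.Core using (¬_; contradiction)

private
  variable
    c ℓ c′ ℓ′ : Level

-- The polynomial ring R[t] in one indeterminate, as coefficient lists
-- (constant coefficient first) up to trailing zeros.
module OneVariable (R : CommutativeRing c ℓ) where
  open CommutativeRing R
  open AbelianGroupProperties +-abelianGroup using () renaming (ε⁻¹≈ε to -0≈0)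
  open CommutativeSemigroupProperties (CommutativeRing.+-commutativeSemigroup R) using (interchange)
  open SetoidReasoning setoid

  coeff : List Carrier → ℕ → Carrier
  coeff []      _       = 0#
  coeff (a ∷ _) zero    = a
  coeff (_ ∷ f) (suc n) = coeff f n

  -- A record, so that the two polynomials can be inferred from a proof.
  infix 4 _≈ₚ_
  record _≈ₚ_ (f g : List Carrier) : Set ℓ where
    constructor mk
    field at : ∀ n → coeff f n ≈ coeff g n
  open _≈ₚ_ public

  infixl 6 _+ₚ_
  _+ₚ_ : List Carrier → List Carrier → List Carrier
  []      +ₚ g       = g
  (a ∷ f) +ₚ []      = a ∷ f
  (a ∷ f) +ₚ (b ∷ g) = (a + b) ∷ (f +ₚ g)

  infixr 7 _·ₚ_
  _·ₚ_ : Carrier → List Carrier → List Carrier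
  a ·ₚ f = map (a *_) f

  infixl 7 _*ₚ_
  _*ₚ_ : List Carrier → List Carrier → List Carrier
  []      *ₚ g = []
  (a ∷ f) *ₚ g = a ·ₚ g +ₚ (0# ∷ f *ₚ g)

  -ₚ_ : List Carrier → List Carrier
  -ₚ f = map -_ f

  coeff-+ : ∀ f g n → coeff (f +ₚ g) n ≈ coeff f n + coeff g n
  coeff-+ []      g       n       = sym (+-identityˡ _)
  coeff-+ (a ∷ f) []      n       = sym (+-identityʳ _)
  coeff-+ (a ∷ f) (b ∷ g) zero    = refl
  coeff-+ (a ∷ f) (b ∷ g) (suc n) = coeff-+ f g n

  coeff-· : ∀ a f n → coeff (a ·ₚ f) n ≈ a * coeff f n
  coeff-· a []      n       = sym (zeroʳ a)
  coeff-· a (b ∷ f) zero    = refl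
  coeff-· a (b ∷ f) (suc n) = coeff-· a f n

  coeff-neg : ∀ f n → coeff (-ₚ f) n ≈ - coeff f n
  coeff-neg []      n       = sym -0≈0
  coeff-neg (b ∷ f) zero    = refl
  coeff-neg (b ∷ f) (suc n) = coeff-neg f n

  private
    ≈ₚ-refl : ∀ {f} → f ≈ₚ f
    ≈ₚ-refl = mk λ _ → refl

    ≈ₚ-sym : ∀ {f g} → f ≈ₚ g → g ≈ₚ f
    ≈ₚ-sym e = mk λ n → sym (at e n)

    ≈ₚ-trans : ∀ {f g h} → f ≈ₚ g → g ≈ₚ h → f ≈ₚ h
    ≈ₚ-trans e e′ = mk λ n → trans (at e n) (at e′ n)

    ∷-cong : ∀ {a b f g} → a ≈ b → f ≈ₚ g → (a ∷ f) ≈ₚ (b ∷ g)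
    ∷-cong e e′ = mk λ { zero → e ; (suc n) → at e′ n }

    0∷[] : (0# ∷ []) ≈ₚ []
    0∷[] = mk λ { zero → refl ; (suc n) → refl }

    +ₚ-cong : ∀ {f f′ g g′} → f ≈ₚ f′ → g ≈ₚ g′ → f +ₚ g ≈ₚ f′ +ₚ g′
    +ₚ-cong {f} {f′} {g} {g′} e e′ = mk λ n →
      trans (coeff-+ f g n) (trans (+-cong (at e n) (at e′ n)) (sym (coeff-+ f′ g′ n)))

    +ₚ-assoc : ∀ f g h → (f +ₚ g) +ₚ h ≈ₚ f +ₚ (g +ₚ h)
    +ₚ-assoc f g h = mk λ n → begin
      coeff ((f +ₚ g) +ₚ h) n              ≈⟨ coeff-+ (f +ₚ g) h n ⟩
      coeff (f +ₚ g) n + coeff h n         ≈⟨ +-congʳ (coeff-+ f g n) ⟩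
      coeff f n + coeff g n + coeff h n    ≈⟨ +-assoc _ _ _ ⟩
      coeff f n + (coeff g n + coeff h n)  ≈⟨ +-congˡ (coeff-+ g h n) ⟨
      coeff f n + coeff (g +ₚ h) n         ≈⟨ coeff-+ f (g +ₚ h) n ⟨
      coeff (f +ₚ (g +ₚ h)) n              ∎

    +ₚ-comm : ∀ f g → f +ₚ g ≈ₚ g +ₚ f
    +ₚ-comm f g = mk λ n → trans (coeff-+ f g n) (trans (+-comm _ _) (sym (coeff-+ g f n)))

    +ₚ-identityʳ : ∀ f → f +ₚ [] ≈ₚ f
    +ₚ-identityʳ []      = ≈ₚ-refl
    +ₚ-identityʳ (a ∷ f) = ≈ₚ-refl

    -ₚ-inverseʳ : ∀ f → f +ₚ (-ₚ f) ≈ₚ []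
    -ₚ-inverseʳ f = mk λ n →
      trans (coeff-+ f (-ₚ f) n) (trans (+-congˡ (coeff-neg f n)) (-‿inverseʳ _))

    -ₚ-cong : ∀ {f g} → f ≈ₚ g → -ₚ f ≈ₚ -ₚ g
    -ₚ-cong {f} {g} e = mk λ n →
      trans (coeff-neg f n) (trans (-‿cong (at e n)) (sym (coeff-neg g n)))

    +ₚ-interchange : ∀ f g h k → (f +ₚ g) +ₚ (h +ₚ k) ≈ₚ (f +ₚ h) +ₚ (g +ₚ k)
    +ₚ-interchange f g h k = mk λ n → begin
      coeff ((f +ₚ g) +ₚ (h +ₚ k)) n                       ≈⟨ split f g h k n ⟩
      (coeff f n + coeff g n) + (coeff h n + coeff k n)    ≈⟨ interchange _ _ _ _ ⟩
      (coeff f n + coeff h n) + (coeff g n + coeff k n)    ≈⟨ split f h g k n ⟨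
      coeff ((f +ₚ h) +ₚ (g +ₚ k)) n                       ∎
      where
      split : ∀ f g h k n → coeff ((f +ₚ g) +ₚ (h +ₚ k)) n
                          ≈ (coeff f n + coeff g n) + (coeff h n + coeff k n)
      split f g h k n = trans (coeff-+ (f +ₚ g) (h +ₚ k) n) (+-cong (coeff-+ f g n) (coeff-+ h k n))

    ·ₚ-cong : ∀ {a b f g} → a ≈ b → f ≈ₚ g → a ·ₚ f ≈ₚ b ·ₚ g
    ·ₚ-cong {a} {b} {f} {g} e e′ = mk λ n →
      trans (coeff-· a f n) (trans (*-cong e (at e′ n)) (sym (coeff-· b g n)))

    ·ₚ-zero : ∀ f → 0# ·ₚ f ≈ₚ []
    ·ₚ-zero f = mk λ n → trans (coeff-· 0# f n) (zeroˡ _)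

    ·ₚ-identity : ∀ f → 1# ·ₚ f ≈ₚ f
    ·ₚ-identity f = mk λ n → trans (coeff-· 1# f n) (*-identityˡ _)

    ·ₚ-assoc : ∀ a b f → (a * b) ·ₚ f ≈ₚ a ·ₚ (b ·ₚ f)
    ·ₚ-assoc a b f = mk λ n → begin
      coeff ((a * b) ·ₚ f) n    ≈⟨ coeff-· (a * b) f n ⟩
      (a * b) * coeff f n       ≈⟨ *-assoc _ _ _ ⟩
      a * (b * coeff f n)       ≈⟨ *-congˡ (coeff-· b f n) ⟨
      a * coeff (b ·ₚ f) n      ≈⟨ coeff-· a (b ·ₚ f) n ⟨
      coeff (a ·ₚ (b ·ₚ f)) n   ∎

    ·ₚ-distribˡ : ∀ a f g → a ·ₚ (f +ₚ g) ≈ₚ a ·ₚ f +ₚ a ·ₚ g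
    ·ₚ-distribˡ a f g = mk λ n → begin
      coeff (a ·ₚ (f +ₚ g)) n                 ≈⟨ coeff-· a (f +ₚ g) n ⟩
      a * coeff (f +ₚ g) n                    ≈⟨ *-congˡ (coeff-+ f g n) ⟩
      a * (coeff f n + coeff g n)             ≈⟨ distribˡ _ _ _ ⟩
      a * coeff f n + a * coeff g n           ≈⟨ +-cong (coeff-· a f n) (coeff-· a g n) ⟨
      coeff (a ·ₚ f) n + coeff (a ·ₚ g) n     ≈⟨ coeff-+ (a ·ₚ f) (a ·ₚ g) n ⟨
      coeff (a ·ₚ f +ₚ a ·ₚ g) n              ∎

    ·ₚ-distribʳ : ∀ a b f → (a + b) ·ₚ f ≈ₚ a ·ₚ f +ₚ b ·ₚ f
    ·ₚ-distribʳ a b f = mk λ n → begin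
      coeff ((a + b) ·ₚ f) n                  ≈⟨ coeff-· (a + b) f n ⟩
      (a + b) * coeff f n                     ≈⟨ distribʳ _ _ _ ⟩
      a * coeff f n + b * coeff f n           ≈⟨ +-cong (coeff-· a f n) (coeff-· b f n) ⟨
      coeff (a ·ₚ f) n + coeff (b ·ₚ f) n     ≈⟨ coeff-+ (a ·ₚ f) (b ·ₚ f) n ⟨
      coeff (a ·ₚ f +ₚ b ·ₚ f) n              ∎

    ≈ₚ-setoid : Setoid c ℓ
    ≈ₚ-setoid = record
      { Carrier = List Carrier
      ; _≈_ = _≈ₚ_
      ; isEquivalence = record { refl = ≈ₚ-refl ; sym = ≈ₚ-sym ; trans = ≈ₚ-trans }
      }

    module P = SetoidReasoning ≈ₚ-setoid

    *ₚ-congˡ : ∀ f {g g′} → g ≈ₚ g′ → f *ₚ g ≈ₚ f *ₚ g′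
    *ₚ-congˡ []      e = ≈ₚ-refl
    *ₚ-congˡ (a ∷ f) e = +ₚ-cong (·ₚ-cong refl e) (∷-cong refl (*ₚ-congˡ f e))

    *ₚ-zeroʳ : ∀ f → f *ₚ [] ≈ₚ []
    *ₚ-zeroʳ []      = ≈ₚ-refl
    *ₚ-zeroʳ (a ∷ f) = ≈ₚ-trans (∷-cong refl (*ₚ-zeroʳ f)) 0∷[]

    *ₚ-∷ : ∀ f b g → f *ₚ (b ∷ g) ≈ₚ b ·ₚ f +ₚ (0# ∷ f *ₚ g)
    *ₚ-∷ []      b g = ≈ₚ-sym 0∷[]
    *ₚ-∷ (a ∷ f) b g = ∷-cong (+-congʳ (*-comm a b)) (P.begin
      a ·ₚ g +ₚ f *ₚ (b ∷ g)               P.≈⟨ +ₚ-cong ≈ₚ-refl (*ₚ-∷ f b g) ⟩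
      a ·ₚ g +ₚ (b ·ₚ f +ₚ (0# ∷ f *ₚ g))  P.≈⟨ +ₚ-assoc (a ·ₚ g) (b ·ₚ f) _ ⟨
      (a ·ₚ g +ₚ b ·ₚ f) +ₚ (0# ∷ f *ₚ g)  P.≈⟨ +ₚ-cong (+ₚ-comm (a ·ₚ g) (b ·ₚ f)) ≈ₚ-refl ⟩
      (b ·ₚ f +ₚ a ·ₚ g) +ₚ (0# ∷ f *ₚ g)  P.≈⟨ +ₚ-assoc (b ·ₚ f) (a ·ₚ g) _ ⟩
      b ·ₚ f +ₚ (a ·ₚ g +ₚ (0# ∷ f *ₚ g))  P.∎)

    *ₚ-comm : ∀ f g → f *ₚ g ≈ₚ g *ₚ f
    *ₚ-comm []      g = ≈ₚ-sym (*ₚ-zeroʳ g)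
    *ₚ-comm (a ∷ f) g = ≈ₚ-trans (+ₚ-cong ≈ₚ-refl (∷-cong refl (*ₚ-comm f g))) (≈ₚ-sym (*ₚ-∷ g a f))

    *ₚ-cong : ∀ {f f′ g g′} → f ≈ₚ f′ → g ≈ₚ g′ → f *ₚ g ≈ₚ f′ *ₚ g′
    *ₚ-cong {f} {f′} {g} {g′} e e′ = P.begin
      f  *ₚ g   P.≈⟨ *ₚ-congˡ f e′ ⟩
      f  *ₚ g′  P.≈⟨ *ₚ-comm f g′ ⟩
      g′ *ₚ f   P.≈⟨ *ₚ-congˡ g′ e ⟩
      g′ *ₚ f′  P.≈⟨ *ₚ-comm g′ f′ ⟩
      f′ *ₚ g′  P.∎

    *ₚ-distribʳ : ∀ h f g → (f +ₚ g) *ₚ h ≈ₚ f *ₚ h +ₚ g *ₚ h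
    *ₚ-distribʳ h []      g       = ≈ₚ-refl
    *ₚ-distribʳ h (a ∷ f) []      = ≈ₚ-sym (+ₚ-identityʳ _)
    *ₚ-distribʳ h (a ∷ f) (b ∷ g) = P.begin
      (a + b) ·ₚ h +ₚ (0# ∷ (f +ₚ g) *ₚ h)
        P.≈⟨ +ₚ-cong (·ₚ-distribʳ a b h) (∷-cong (sym (+-identityˡ 0#)) (*ₚ-distribʳ h f g)) ⟩
      (a ·ₚ h +ₚ b ·ₚ h) +ₚ ((0# ∷ f *ₚ h) +ₚ (0# ∷ g *ₚ h))
        P.≈⟨ +ₚ-interchange (a ·ₚ h) (b ·ₚ h) (0# ∷ f *ₚ h) (0# ∷ g *ₚ h) ⟩
      (a ·ₚ h +ₚ (0# ∷ f *ₚ h)) +ₚ (b ·ₚ h +ₚ (0# ∷ g *ₚ h))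
        P.∎

    *ₚ-distribˡ : ∀ h f g → h *ₚ (f +ₚ g) ≈ₚ h *ₚ f +ₚ h *ₚ g
    *ₚ-distribˡ h f g = P.begin
      h *ₚ (f +ₚ g)       P.≈⟨ *ₚ-comm h (f +ₚ g) ⟩
      (f +ₚ g) *ₚ h       P.≈⟨ *ₚ-distribʳ h f g ⟩
      f *ₚ h +ₚ g *ₚ h    P.≈⟨ +ₚ-cong (*ₚ-comm f h) (*ₚ-comm g h) ⟩
      h *ₚ f +ₚ h *ₚ g    P.∎

    ·ₚ-*ₚ : ∀ a f g → (a ·ₚ f) *ₚ g ≈ₚ a ·ₚ (f *ₚ g)
    ·ₚ-*ₚ a []      g = ≈ₚ-refl
    ·ₚ-*ₚ a (b ∷ f) g = P.begin
      (a * b) ·ₚ g +ₚ (0# ∷ (a ·ₚ f) *ₚ g)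
        P.≈⟨ +ₚ-cong (·ₚ-assoc a b g) (∷-cong (sym (zeroʳ a)) (·ₚ-*ₚ a f g)) ⟩
      a ·ₚ (b ·ₚ g) +ₚ a ·ₚ (0# ∷ f *ₚ g)
        P.≈⟨ ·ₚ-distribˡ a (b ·ₚ g) (0# ∷ f *ₚ g) ⟨
      a ·ₚ (b ·ₚ g +ₚ (0# ∷ f *ₚ g))
        P.∎

    0∷-*ₚ : ∀ f g → (0# ∷ f) *ₚ g ≈ₚ (0# ∷ f *ₚ g)
    0∷-*ₚ f g = +ₚ-cong (·ₚ-zero g) ≈ₚ-refl

    *ₚ-assoc : ∀ f g h → (f *ₚ g) *ₚ h ≈ₚ f *ₚ (g *ₚ h)
    *ₚ-assoc []      g h = ≈ₚ-refl
    *ₚ-assoc (a ∷ f) g h = P.begin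
      (a ·ₚ g +ₚ (0# ∷ f *ₚ g)) *ₚ h
        P.≈⟨ *ₚ-distribʳ h (a ·ₚ g) (0# ∷ f *ₚ g) ⟩
      (a ·ₚ g) *ₚ h +ₚ (0# ∷ f *ₚ g) *ₚ h
        P.≈⟨ +ₚ-cong (·ₚ-*ₚ a g h) (≈ₚ-trans (0∷-*ₚ (f *ₚ g) h) (∷-cong refl (*ₚ-assoc f g h))) ⟩
      a ·ₚ (g *ₚ h) +ₚ (0# ∷ f *ₚ (g *ₚ h))
        P.∎

    *ₚ-identityˡ : ∀ f → (1# ∷ []) *ₚ f ≈ₚ f
    *ₚ-identityˡ f = ≈ₚ-trans (+ₚ-cong (·ₚ-identity f) 0∷[]) (+ₚ-identityʳ f)

  polynomialRing : CommutativeRing c ℓ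
  polynomialRing = record
    { Carrier = List Carrier
    ; _≈_ = _≈ₚ_
    ; _+_ = _+ₚ_
    ; _*_ = _*ₚ_
    ; -_ = -ₚ_
    ; 0# = []
    ; 1# = 1# ∷ []
    ; isCommutativeRing = record
      { isRing = record
        { +-isAbelianGroup = record
          { isGroup = record
            { isMonoid = record
              { isSemigroup = record
                { isMagma = record
                  { isEquivalence = record { refl = ≈ₚ-refl ; sym = ≈ₚ-sym ; trans = ≈ₚ-trans }
                  ; ∙-cong = +ₚ-cong
                  }
                ; assoc = +ₚ-assoc
                }
              ; identity = (λ _ → ≈ₚ-refl) , +ₚ-identityʳ
              }
            ; inverse = (λ f → ≈ₚ-trans (+ₚ-comm (-ₚ f) f) (-ₚ-inverseʳ f)) , -ₚ-inverseʳ
            ; ⁻¹-cong = -ₚ-cong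
            }
          ; comm = +ₚ-comm
          }
        ; *-cong = *ₚ-cong
        ; *-assoc = *ₚ-assoc
        ; *-identity = *ₚ-identityˡ , λ f → ≈ₚ-trans (*ₚ-comm f _) (*ₚ-identityˡ f)
        ; distrib = *ₚ-distribˡ , *ₚ-distribʳ
        }
      ; *-comm = *ₚ-comm
      }
    }

  module 𝒫 = CommutativeRing polynomialRing
  open Exponentiation 𝒫.semiring using (_^_)

  constant : Carrier → List Carrier
  constant a = a ∷ []

  constant-isRingHomomorphism : Morphisms.RingMorphisms.IsRingHomomorphism rawRing 𝒫.rawRing constant
  constant-isRingHomomorphism = record
    { isSemiringHomomorphism = record
      { isNearSemiringHomomorphism = record
        { +-isMonoidHomomorphism = record
          { isMagmaHomomorphism = record
            { isRelHomomorphism = record { cong = λ e → ∷-cong e ≈ₚ-refl }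
            ; homo = λ _ _ → ≈ₚ-refl
            }
          ; ε-homo = 0∷[]
          }
        ; *-homo = λ a b → ∷-cong (sym (+-identityʳ _)) ≈ₚ-refl
        }
      ; 1#-homo = ≈ₚ-refl
      }
    ; -‿homo = λ _ → ≈ₚ-refl
    }

  t : List Carrier
  t = 0# ∷ 1# ∷ []

  1-t^_ : ℕ → List Carrier
  1-t^ n = 𝒫.1# 𝒫.- t ^ n

  coeff₀-* : ∀ f g → coeff (f *ₚ g) 0 ≈ coeff f 0 * coeff g 0
  coeff₀-* []      g = sym (zeroˡ _)
  coeff₀-* (a ∷ f) g = begin
    coeff (a ·ₚ g +ₚ (0# ∷ f *ₚ g)) 0  ≈⟨ coeff-+ (a ·ₚ g) (0# ∷ f *ₚ g) 0 ⟩
    coeff (a ·ₚ g) 0 + 0#              ≈⟨ +-identityʳ _ ⟩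
    coeff (a ·ₚ g) 0                   ≈⟨ coeff-· a g 0 ⟩
    a * coeff g 0                      ∎

  1-t^n≉0 : 1# ≉ 0# → ∀ n .{{_ : ℕ.NonZero n}} → 1-t^ n 𝒫.≉ 𝒫.0#
  1-t^n≉0 1≉0 n@(suc m) e = 1≉0 (begin
    1#                                  ≈⟨ +-identityʳ 1# ⟨
    1# + 0#                             ≈⟨ +-congˡ -0≈0 ⟨
    1# + - 0#                           ≈⟨ +-congˡ (-‿cong (zeroˡ _)) ⟨
    1# + - (0# * coeff (t ^ m) 0)       ≈⟨ +-congˡ (-‿cong (coeff₀-* t (t ^ m))) ⟨
    1# + - coeff (t ^ n) 0              ≈⟨ +-congˡ (coeff-neg (t ^ n) 0) ⟨
    1# + coeff (-ₚ (t ^ n)) 0           ≈⟨ coeff-+ (1# ∷ []) (-ₚ (t ^ n)) 0 ⟨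
    coeff (1-t^ n) 0                    ≈⟨ at e 0 ⟩
    0#                                  ∎)

  module _ (_≟_ : Decidable _≈_) (cancel : AlmostLeftCancellative _≈_ 0# _*_) where

    private
      noZeroDivisors : ∀ f g → ¬ f ≈ₚ [] → f *ₚ g ≈ₚ [] → g ≈ₚ []
      noZeroDivisors []      g  f≉0 e = contradiction ≈ₚ-refl f≉0
      noZeroDivisors (a ∷ f) g₀ f≉0 e₀ with a ≟ 0#
      ... | yes a≈0 = noZeroDivisors f g₀ (λ f≈0 → f≉0 (≈ₚ-trans (∷-cong a≈0 f≈0) 0∷[]))
                        (mk λ n → at fg≈0 (suc n))
        where
        fg≈0 : (0# ∷ f *ₚ g₀) ≈ₚ []
        fg≈0 = P.begin
          (0# ∷ f *ₚ g₀)   P.≈⟨ 0∷-*ₚ f g₀ ⟨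
          (0# ∷ f) *ₚ g₀   P.≈⟨ *ₚ-cong (∷-cong a≈0 (≈ₚ-refl {f})) (≈ₚ-refl {g₀}) ⟨
          (a ∷ f) *ₚ g₀    P.≈⟨ e₀ ⟩
          []               P.∎
      ... | no a≉0 = go g₀ e₀
        where
        go : ∀ g → (a ∷ f) *ₚ g ≈ₚ [] → g ≈ₚ []
        go []      e = ≈ₚ-refl
        go (b ∷ g) e = ≈ₚ-trans (∷-cong b≈0 (go g (mk λ n → at tail≈0 (suc n)))) 0∷[]
          where
          b≈0 : b ≈ 0#
          b≈0 = cancel a b 0# a≉0 (trans (trans (sym (coeff₀-* (a ∷ f) (b ∷ g))) (at e 0)) (sym (zeroʳ a)))

          tail≈0 : (0# ∷ (a ∷ f) *ₚ g) ≈ₚ []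
          tail≈0 = P.begin
            (0# ∷ (a ∷ f) *ₚ g)                    P.≈⟨ +ₚ-cong (·ₚ-zero (a ∷ f)) (≈ₚ-refl {0# ∷ (a ∷ f) *ₚ g}) ⟨
            0# ·ₚ (a ∷ f) +ₚ (0# ∷ (a ∷ f) *ₚ g)   P.≈⟨ +ₚ-cong (·ₚ-cong {f = a ∷ f} b≈0 ≈ₚ-refl) (≈ₚ-refl {0# ∷ (a ∷ f) *ₚ g}) ⟨
            b ·ₚ (a ∷ f) +ₚ (0# ∷ (a ∷ f) *ₚ g)    P.≈⟨ *ₚ-∷ (a ∷ f) b g ⟨
            (a ∷ f) *ₚ (b ∷ g)                     P.≈⟨ e ⟩
            []                                     P.∎

    *ₚ-cancelˡ : AlmostLeftCancellative _≈ₚ_ [] _*ₚ_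
    *ₚ-cancelˡ f g h f≉0 e = 𝒫.trans (𝒫.sym (𝒫.+-identityʳ g)) (𝒫.trans (𝒫.+-congˡ (𝒫.sym (𝒫.-‿inverseˡ h)))
      (𝒫.trans (𝒫.sym (𝒫.+-assoc g (-ₚ h) h)) (𝒫.+-congʳ (noZeroDivisors f (g 𝒫.- h) f≉0 f*[g-h]≈0))))
      where
      open RingProperties 𝒫.ring using (-‿distribʳ-*)
      f*[g-h]≈0 : f *ₚ (g 𝒫.- h) ≈ₚ []
      f*[g-h]≈0 = P.begin
        f *ₚ (g 𝒫.- h)              P.≈⟨ *ₚ-distribˡ f g (-ₚ h) ⟩
        f *ₚ g +ₚ f *ₚ (-ₚ h)       P.≈⟨ +ₚ-cong e (𝒫.sym (-‿distribʳ-* f h)) ⟩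
        f *ₚ h +ₚ (-ₚ (f *ₚ h))     P.≈⟨ -ₚ-inverseʳ (f *ₚ h) ⟩
        []                          P.∎

module Fractions
  (D : CommutativeRing c ℓ)
  (cancel : AlmostLeftCancellative (CommutativeRing._≈_ D) (CommutativeRing.0# D) (CommutativeRing._*_ D))
  (1≉0 : ¬ CommutativeRing._≈_ D (CommutativeRing.1# D) (CommutativeRing.0# D))
  where

  open CommutativeRing D
  open SetoidReasoning setoid
  open RingProperties ring using (-‿distribˡ-*)
  open SemiringSolver commutativeSemiring using (solve; _:+_; _:*_; _:=_; con)

  record Fraction : Set (c Level.⊔ ℓ) where
    constructor frac
    field
      num den : Carrier
      den≉0   : den ≉ 0#
  open Fraction

  infix 4 _≈ꟳ_
  record _≈ꟳ_ (x y : Fraction) : Set ℓ where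
    constructor mk
    field cross : num x * den y ≈ num y * den x
  open _≈ꟳ_

  *-≉0 : ∀ {x y} → x ≉ 0# → y ≉ 0# → x * y ≉ 0#
  *-≉0 {x} {y} x≉0 y≉0 xy≈0 = y≉0 (cancel x y 0# x≉0 (trans xy≈0 (sym (zeroʳ x))))

  _+ꟳ_ _*ꟳ_ : Fraction → Fraction → Fraction
  x +ꟳ y = frac (num x * den y + num y * den x) (den x * den y) (*-≉0 (den≉0 x) (den≉0 y))
  x *ꟳ y = frac (num x * num y) (den x * den y) (*-≉0 (den≉0 x) (den≉0 y))

  -ꟳ_ : Fraction → Fraction
  -ꟳ x = frac (- num x) (den x) (den≉0 x)

  embed : Carrier → Fraction
  embed a = frac a 1# 1≉0

  private
    ≈ꟳ-trans : ∀ {x y z} → x ≈ꟳ y → y ≈ꟳ z → x ≈ꟳ z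
    ≈ꟳ-trans {frac a b b≉0} {frac p q q≉0} {frac r s s≉0} (mk e) (mk e′) = mk (cancel q _ _ q≉0 (begin
      q * (a * s)   ≈⟨ solve 3 (λ q a s → q :* (a :* s) := (a :* q) :* s) refl q a s ⟩
      (a * q) * s   ≈⟨ *-congʳ e ⟩
      (p * b) * s   ≈⟨ solve 3 (λ p b s → (p :* b) :* s := b :* (p :* s)) refl p b s ⟩
      b * (p * s)   ≈⟨ *-congˡ e′ ⟩
      b * (r * q)   ≈⟨ solve 3 (λ b r q → b :* (r :* q) := q :* (r :* b)) refl b r q ⟩
      q * (r * b)   ∎))

    +ꟳ-cong : ∀ {x x′ y y′} → x ≈ꟳ x′ → y ≈ꟳ y′ → (x +ꟳ y) ≈ꟳ (x′ +ꟳ y′)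
    +ꟳ-cong {frac a b _} {frac a′ b′ _} {frac p q _} {frac p′ q′ _} (mk e) (mk e′) = mk (begin
      (a * q + p * b) * (b′ * q′)
        ≈⟨ solve 6 (λ a b p q b′ q′ → (a :* q :+ p :* b) :* (b′ :* q′)
             := (a :* b′) :* (q :* q′) :+ (p :* q′) :* (b :* b′)) refl a b p q b′ q′ ⟩
      (a * b′) * (q * q′) + (p * q′) * (b * b′)
        ≈⟨ +-cong (*-congʳ e) (*-congʳ e′) ⟩
      (a′ * b) * (q * q′) + (p′ * q) * (b * b′)
        ≈⟨ solve 6 (λ a′ b p′ q b′ q′ → (a′ :* b) :* (q :* q′) :+ (p′ :* q) :* (b :* b′)
             := (a′ :* q′ :+ p′ :* b′) :* (b :* q)) refl a′ b p′ q b′ q′ ⟩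
      (a′ * q′ + p′ * b′) * (b * q) ∎)

    *ꟳ-cong : ∀ {x x′ y y′} → x ≈ꟳ x′ → y ≈ꟳ y′ → (x *ꟳ y) ≈ꟳ (x′ *ꟳ y′)
    *ꟳ-cong {frac a b _} {frac a′ b′ _} {frac p q _} {frac p′ q′ _} (mk e) (mk e′) = mk (begin
      (a * p) * (b′ * q′)  ≈⟨ solve 4 (λ a p b′ q′ → (a :* p) :* (b′ :* q′) := (a :* b′) :* (p :* q′)) refl a p b′ q′ ⟩
      (a * b′) * (p * q′)  ≈⟨ *-cong e e′ ⟩
      (a′ * b) * (p′ * q)  ≈⟨ solve 4 (λ a p b′ q′ → (a :* b′) :* (p :* q′) := (a :* p) :* (b′ :* q′)) refl a′ p′ b q ⟩
      (a′ * p′) * (b * q)  ∎)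

    -ꟳ-cong : ∀ {x x′} → x ≈ꟳ x′ → (-ꟳ x) ≈ꟳ (-ꟳ x′)
    -ꟳ-cong {frac a b _} {frac a′ b′ _} (mk e) =
      mk (trans (sym (-‿distribˡ-* a b′)) (trans (-‿cong e) (-‿distribˡ-* a′ b)))

    +ꟳ-comm : ∀ x y → (x +ꟳ y) ≈ꟳ (y +ꟳ x)
    +ꟳ-comm (frac a b _) (frac p q _) = mk
      (solve 4 (λ a b p q → (a :* q :+ p :* b) :* (q :* b) := (p :* b :+ a :* q) :* (b :* q)) refl a b p q)

    *ꟳ-comm : ∀ x y → (x *ꟳ y) ≈ꟳ (y *ꟳ x)
    *ꟳ-comm (frac a b _) (frac p q _) = mk
      (solve 4 (λ a b p q → (a :* p) :* (q :* b) := (p :* a) :* (b :* q)) refl a b p q)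

    +ꟳ-identityˡ : ∀ x → (embed 0# +ꟳ x) ≈ꟳ x
    +ꟳ-identityˡ (frac a b _) = mk
      (solve 2 (λ a b → (con 0 :* b :+ a :* con 1) :* b := a :* (con 1 :* b)) refl a b)

    *ꟳ-identityˡ : ∀ x → (embed 1# *ꟳ x) ≈ꟳ x
    *ꟳ-identityˡ (frac a b _) = mk
      (trans (*-congʳ (*-identityˡ a)) (*-congˡ (sym (*-identityˡ b))))

    -ꟳ-inverseʳ : ∀ x → (x +ꟳ (-ꟳ x)) ≈ꟳ embed 0#
    -ꟳ-inverseʳ (frac a b _) = mk (begin
      (a * b + - a * b) * 1#   ≈⟨ *-congʳ (+-congˡ (-‿distribˡ-* a b)) ⟨
      (a * b + - (a * b)) * 1# ≈⟨ *-congʳ (-‿inverseʳ _) ⟩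
      0# * 1#                  ≈⟨ zeroˡ _ ⟩
      0#                       ≈⟨ zeroˡ _ ⟨
      0# * (b * b)             ∎)

    *ꟳ-distribʳ : ∀ z x y → ((x +ꟳ y) *ꟳ z) ≈ꟳ ((x *ꟳ z) +ꟳ (y *ꟳ z))
    *ꟳ-distribʳ (frac u v _) (frac a b _) (frac p q _) = mk
      (solve 6 (λ u v a b p q → ((a :* q :+ p :* b) :* u) :* ((b :* v) :* (q :* v))
          := ((a :* u) :* (q :* v) :+ (p :* u) :* (b :* v)) :* ((b :* q) :* v)) refl u v a b p q)

    *ꟳ-distribˡ : ∀ z x y → (z *ꟳ (x +ꟳ y)) ≈ꟳ ((z *ꟳ x) +ꟳ (z *ꟳ y))
    *ꟳ-distribˡ (frac u v _) (frac a b _) (frac p q _) = mk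
      (solve 6 (λ u v a b p q → (u :* (a :* q :+ p :* b)) :* ((v :* b) :* (v :* q))
          := ((u :* a) :* (v :* q) :+ (u :* p) :* (v :* b)) :* (v :* (b :* q))) refl u v a b p q)

    +ꟳ-assoc : ∀ x y z → ((x +ꟳ y) +ꟳ z) ≈ꟳ (x +ꟳ (y +ꟳ z))
    +ꟳ-assoc (frac a b _) (frac p q _) (frac u v _) = mk
      (solve 6 (λ a b p q u v → ((a :* q :+ p :* b) :* v :+ u :* (b :* q)) :* (b :* (q :* v))
          := (a :* (q :* v) :+ (p :* v :+ u :* q) :* b) :* ((b :* q) :* v)) refl a b p q u v)

    *ꟳ-assoc : ∀ x y z → ((x *ꟳ y) *ꟳ z) ≈ꟳ (x *ꟳ (y *ꟳ z))
    *ꟳ-assoc (frac a b _) (frac p q _) (frac u v _) = mk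
      (solve 6 (λ a b p q u v → ((a :* p) :* u) :* (b :* (q :* v))
          := (a :* (p :* u)) :* ((b :* q) :* v)) refl a b p q u v)

  fractionField : CommutativeRing (c Level.⊔ ℓ) ℓ
  fractionField = record
    { Carrier = Fraction
    ; _≈_ = _≈ꟳ_
    ; _+_ = _+ꟳ_
    ; _*_ = _*ꟳ_
    ; -_ = -ꟳ_
    ; 0# = embed 0#
    ; 1# = embed 1#
    ; isCommutativeRing = record
      { isRing = record
        { +-isAbelianGroup = record
          { isGroup = record
            { isMonoid = record
              { isSemigroup = record
                { isMagma = record
                  { isEquivalence = record
                    { refl = mk refl ; sym = λ e → mk (sym (cross e)) ; trans = ≈ꟳ-trans }
                  ; ∙-cong = +ꟳ-cong
                  }
                ; assoc = +ꟳ-assoc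
                }
              ; identity = +ꟳ-identityˡ , λ x → ≈ꟳ-trans (+ꟳ-comm x (embed 0#)) (+ꟳ-identityˡ x)
              }
            ; inverse = (λ x → ≈ꟳ-trans (+ꟳ-comm (-ꟳ x) x) (-ꟳ-inverseʳ x)) , -ꟳ-inverseʳ
            ; ⁻¹-cong = -ꟳ-cong
            }
          ; comm = +ꟳ-comm
          }
        ; *-cong = *ꟳ-cong
        ; *-assoc = *ꟳ-assoc
        ; *-identity = *ꟳ-identityˡ , λ x → ≈ꟳ-trans (*ꟳ-comm x (embed 1#)) (*ꟳ-identityˡ x)
        ; distrib = *ꟳ-distribˡ , *ꟳ-distribʳ
        }
      ; *-comm = *ꟳ-comm
      }
    }

  embed-isRingHomomorphism :
    Morphisms.RingMorphisms.IsRingHomomorphism rawRing (CommutativeRing.rawRing fractionField) embed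
  embed-isRingHomomorphism = record
    { isSemiringHomomorphism = record
      { isNearSemiringHomomorphism = record
        { +-isMonoidHomomorphism = record
          { isMagmaHomomorphism = record
            { isRelHomomorphism = record { cong = λ e → mk (*-congʳ e) }
            ; homo = λ a b → mk
                (solve 2 (λ a b → (a :+ b) :* (con 1 :* con 1) := (a :* con 1 :+ b :* con 1) :* con 1) refl a b)
            }
          ; ε-homo = mk refl
          }
        ; *-homo = λ a b → mk (*-congˡ (*-identityˡ 1#))
        }
      ; 1#-homo = mk refl
      }
    ; -‿homo = λ _ → mk refl
    }

  reciprocal : (a : Carrier) → a ≉ 0# → Fraction
  reciprocal a a≉0 = frac 1# a a≉0

  reciprocal-inverse : ∀ a (a≉0 : a ≉ 0#) → (embed a *ꟳ reciprocal a a≉0) ≈ꟳ embed 1#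
  reciprocal-inverse a a≉0 = mk (solve 1 (λ a → (a :* con 1) :* con 1 := con 1 :* (con 1 :* a)) refl a)

odd : ℕ → ℕ
odd k = suc (2 ℕ.* k)

-- Terms of the free commutative K-algebra on the variables; the generator
-- p k stands for p_{2k+1} = p_{odd k}.
data Γ (C : Set c) : Set c where
  con     : C → Γ C
  p       : ℕ → Γ C
  _⊕_ _⊗_ : Γ C → Γ C → Γ C

infixl 6 _⊕_
infixl 7 _⊗_

-- Upper bound for the degree, where p k has degree odd k.
deg : {C : Set c} → Γ C → ℕ
deg (con a) = 0
deg (p k)   = odd k
deg (f ⊕ g) = deg f ⊔ deg g
deg (f ⊗ g) = deg f ℕ.+ deg g

substitute : {C : Set c} {C′ : Set c′} → (C → C′) → (ℕ → Γ C′) → Γ C → Γ C′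
substitute h v (con a) = con (h a)
substitute h v (p k)   = v k
substitute h v (f ⊕ g) = substitute h v f ⊕ substitute h v g
substitute h v (f ⊗ g) = substitute h v f ⊗ substitute h v g

module Polynomials (K : CommutativeRing c ℓ) where
  open CommutativeRing K using (0#; 1#; -_)
  private module K = CommutativeRing K

  -- The polynomial ring is Γ K.Carrier modulo the laws of commutative
  -- K-algebras.
  infix 4 _≈_
  data _≈_ : Γ K.Carrier → Γ K.Carrier → Set (c Level.⊔ ℓ) where
    refl  : ∀ {f} → f ≈ f
    sym   : ∀ {f g} → f ≈ g → g ≈ f
    trans : ∀ {f g h} → f ≈ g → g ≈ h → f ≈ h

    ⊕-cong : ∀ {f f′ g g′} → f ≈ f′ → g ≈ g′ → f ⊕ g ≈ f′ ⊕ g′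
    ⊗-cong : ∀ {f f′ g g′} → f ≈ f′ → g ≈ g′ → f ⊗ g ≈ f′ ⊗ g′

    con-cong : ∀ {a b} → a K.≈ b → con a ≈ con b
    con-+    : ∀ a b → con (a K.+ b) ≈ con a ⊕ con b
    con-*    : ∀ a b → con (a K.* b) ≈ con a ⊗ con b

    ⊕-assoc     : ∀ f g h → (f ⊕ g) ⊕ h ≈ f ⊕ (g ⊕ h)
    ⊕-comm      : ∀ f g → f ⊕ g ≈ g ⊕ f
    ⊕-identityʳ : ∀ f → f ⊕ con 0# ≈ f
    ⊕-inverseʳ  : ∀ f → f ⊕ con (- 1#) ⊗ f ≈ con 0#

    ⊗-assoc     : ∀ f g h → (f ⊗ g) ⊗ h ≈ f ⊗ (g ⊗ h)
    ⊗-comm      : ∀ f g → f ⊗ g ≈ g ⊗ f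
    ⊗-identityˡ : ∀ f → con 1# ⊗ f ≈ f
    ⊗-distribˡ  : ∀ f g h → f ⊗ (g ⊕ h) ≈ f ⊗ g ⊕ f ⊗ h

  ring : CommutativeRing c (c Level.⊔ ℓ)
  ring = record
    { Carrier = Γ K.Carrier
    ; _≈_ = _≈_
    ; _+_ = _⊕_
    ; _*_ = _⊗_
    ; -_ = con (- 1#) ⊗_
    ; 0# = con 0#
    ; 1# = con 1#
    ; isCommutativeRing = record
      { isRing = record
        { +-isAbelianGroup = record
          { isGroup = record
            { isMonoid = record
              { isSemigroup = record
                { isMagma = record
                  { isEquivalence = record { refl = refl ; sym = sym ; trans = trans }
                  ; ∙-cong = ⊕-cong
                  }
                ; assoc = ⊕-assoc
                }
              ; identity = (λ f → trans (⊕-comm _ f) (⊕-identityʳ f)) , ⊕-identityʳ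
              }
            ; inverse = (λ f → trans (⊕-comm _ f) (⊕-inverseʳ f)) , ⊕-inverseʳ
            ; ⁻¹-cong = ⊗-cong refl
            }
          ; comm = ⊕-comm
          }
        ; *-cong = ⊗-cong
        ; *-assoc = ⊗-assoc
        ; *-identity = ⊗-identityˡ , λ f → trans (⊗-comm f _) (⊗-identityˡ f)
        ; distrib = ⊗-distribˡ , λ h f g →
            trans (⊗-comm _ h) (trans (⊗-distribˡ h f g) (⊕-cong (⊗-comm h f) (⊗-comm h g)))
        }
      ; *-comm = ⊗-comm
      }
    }

  rawModule : RawLeftModule K.Carrier c (c Level.⊔ ℓ)
  rawModule = record
    { Carrierᴹ = Γ K.Carrier
    ; _≈ᴹ_ = _≈_
    ; _+ᴹ_ = _⊕_
    ; _*ₗ_ = λ a f → con a ⊗ f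
    ; 0ᴹ = con 0#
    ; -ᴹ_ = con (- 1#) ⊗_
    }

-- Well-definedness of the algebra homomorphism p k ↦ v k extending a
-- homomorphism of coefficient rings.
module _ (K : CommutativeRing c ℓ) (L : CommutativeRing c′ ℓ′) where
  private
    module K = CommutativeRing K
    module L = CommutativeRing L
    module ΓK = Polynomials K
    module ΓL = Polynomials L
  open Morphisms.RingMorphisms K.rawRing L.rawRing using (IsRingHomomorphism)

  module _ {h : K.Carrier → L.Carrier} (isHom : IsRingHomomorphism h) (v : ℕ → Γ L.Carrier) where
    private module h = IsRingHomomorphism isHom

    substitute-cong : ∀ {f g} → f ΓK.≈ g → substitute h v f ΓL.≈ substitute h v g
    substitute-cong ΓK.refl = ΓL.refl
    substitute-cong (ΓK.sym e) = ΓL.sym (substitute-cong e)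
    substitute-cong (ΓK.trans e e′) = ΓL.trans (substitute-cong e) (substitute-cong e′)
    substitute-cong (ΓK.⊕-cong e e′) = ΓL.⊕-cong (substitute-cong e) (substitute-cong e′)
    substitute-cong (ΓK.⊗-cong e e′) = ΓL.⊗-cong (substitute-cong e) (substitute-cong e′)
    substitute-cong (ΓK.con-cong e) = ΓL.con-cong (h.⟦⟧-cong e)
    substitute-cong (ΓK.con-+ a b) = ΓL.trans (ΓL.con-cong (h.+-homo a b)) (ΓL.con-+ _ _)
    substitute-cong (ΓK.con-* a b) = ΓL.trans (ΓL.con-cong (h.*-homo a b)) (ΓL.con-* _ _)
    substitute-cong (ΓK.⊕-assoc _ _ _) = ΓL.⊕-assoc _ _ _
    substitute-cong (ΓK.⊕-comm _ _) = ΓL.⊕-comm _ _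
    substitute-cong (ΓK.⊕-identityʳ _) =
      ΓL.trans (ΓL.⊕-cong ΓL.refl (ΓL.con-cong h.0#-homo)) (ΓL.⊕-identityʳ _)
    substitute-cong (ΓK.⊕-inverseʳ _) =
      ΓL.trans
        (ΓL.⊕-cong ΓL.refl (ΓL.⊗-cong
          (ΓL.con-cong (L.trans (h.-‿homo K.1#) (L.-‿cong h.1#-homo))) ΓL.refl))
        (ΓL.trans (ΓL.⊕-inverseʳ _) (ΓL.con-cong (L.sym h.0#-homo)))
    substitute-cong (ΓK.⊗-assoc _ _ _) = ΓL.⊗-assoc _ _ _
    substitute-cong (ΓK.⊗-comm _ _) = ΓL.⊗-comm _ _
    substitute-cong (ΓK.⊗-identityˡ _) =
      ΓL.trans (ΓL.⊗-cong (ΓL.con-cong h.1#-homo) ΓL.refl) (ΓL.⊗-identityˡ _)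
    substitute-cong (ΓK.⊗-distribˡ _ _ _) = ΓL.⊗-distribˡ _ _ _

module PowerSeries (A : RawRing c ℓ) (ι : ℚ → RawRing.Carrier A) where
  open RawRing A
  open RawSemiringDefinitions rawSemiring using (sum)

  Series : Set c
  Series = ℕ → Carrier

  _⊛_ : Series → Series → Series
  (f ⊛ g) n = sum {suc n} λ i → f (toℕ i) * g (n ∸ toℕ i)

  1ₛ : Series
  1ₛ zero    = 1#
  1ₛ (suc _) = 0#

  power : Series → ℕ → Series
  power f zero    = 1ₛ
  power f (suc k) = f ⊛ power f k

  1/_! : ℕ → ℚ
  1/ k ! = _/_ (+ 1) (k !) {{k ℕ.!≢0}}

  -- Only meant for series without constant term: f^k then does not
  -- contribute to the coefficient of zⁿ for k > n.
  exp : Series → Series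
  exp f n = sum {suc n} λ k → ι (1/ toℕ k !) * power f (toℕ k) n

  -- ∑_{k ≥ 0} g k · z^{odd k}
  oddSeries : (ℕ → Carrier) → Series
  oddSeries g zero          = 0#
  oddSeries g (suc zero)    = g 0
  oddSeries g (suc (suc n)) = oddSeries (λ k → g (suc k)) n

module Operators (K : CommutativeRing c ℓ) where
  open CommutativeRing K using (0#; 1#; -_)
  private module K = CommutativeRing K
  open Polynomials K
  private module R = CommutativeRing ring
  open R using (zeroˡ; zeroʳ)
  open CommutativeSemigroupProperties R.+-commutativeSemigroup using (interchange)
  open CommutativeSemigroupProperties R.*-commutativeSemigroup using (x∙yz≈y∙xz)
  open Summation R.+-commutativeMonoid using (sum; sum-syntax; sum⁺-syntax; sum-cong-≋; ∑-distrib-+)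
  open ModuleMorphisms.LeftModuleMorphisms rawModule rawModule using (IsLeftModuleHomomorphism)

  record Operator : Set (c Level.⊔ ℓ) where
    no-eta-equality
    field
      apply    : Γ K.Carrier → Γ K.Carrier
      isLinear : IsLeftModuleHomomorphism apply
    open IsLeftModuleHomomorphism isLinear public
  open Operator public using (apply)

  Linear : (Γ K.Carrier → Γ K.Carrier) → Set (c Level.⊔ ℓ)
  Linear = IsLeftModuleHomomorphism

  linear : {L : Γ K.Carrier → Γ K.Carrier} →
           (∀ {f g} → f ≈ g → L f ≈ L g) →
           (∀ f g → L (f ⊕ g) ≈ L f ⊕ L g) →
           (∀ a f → L (con a ⊗ f) ≈ con a ⊗ L f) →
           Linear L
  linear cong add scale = record
    { +ᴹ-isGroupHomomorphism = record
      { isMonoidHomomorphism = record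
        { isMagmaHomomorphism = record { isRelHomomorphism = record { cong = cong } ; homo = add }
        ; ε-homo = trans (cong (sym (zeroˡ (con 0#)))) (trans (scale 0# (con 0#)) (zeroˡ _))
        }
      ; ⁻¹-homo = scale (- 1#)
      }
    ; *ₗ-homo = scale
    }

  infix 4 _≐_
  _≐_ : Operator → Operator → Set (c Level.⊔ ℓ)
  S ≐ T = ∀ f → apply S f ≈ apply T f

  -- The linearity proofs are abstract to keep operators small under
  -- normalisation.
  abstract
    ∘-linear : ∀ S T → Linear (λ f → apply S (apply T f))
    ∘-linear S T = linear
      (λ e → S.⟦⟧-cong (T.⟦⟧-cong e))
      (λ f g → trans (S.⟦⟧-cong (T.+ᴹ-homo f g)) (S.+ᴹ-homo _ _))
      (λ a f → trans (S.⟦⟧-cong (T.*ₗ-homo a f)) (S.*ₗ-homo a _))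
      where
      module S = Operator S
      module T = Operator T

    +-linear : ∀ S T → Linear (λ f → apply S f ⊕ apply T f)
    +-linear S T = linear
      (λ e → ⊕-cong (S.⟦⟧-cong e) (T.⟦⟧-cong e))
      (λ f g → trans (⊕-cong (S.+ᴹ-homo f g) (T.+ᴹ-homo f g)) (interchange _ _ _ _))
      (λ a f → trans (⊕-cong (S.*ₗ-homo a f) (T.*ₗ-homo a f)) (sym (⊗-distribˡ _ _ _)))
      where
      module S = Operator S
      module T = Operator T

    ⊗-linear : ∀ g → Linear (g ⊗_)
    ⊗-linear g = linear (⊗-cong refl) (⊗-distribˡ g) (λ a f → x∙yz≈y∙xz g (con a) f)

  infixr 9 _∘_
  _∘_ : Operator → Operator → Operator
  S ∘ T = record { apply = λ f → apply S (apply T f) ; isLinear = ∘-linear S T }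

  _+ₒ_ : Operator → Operator → Operator
  S +ₒ T = record { apply = λ f → apply S f ⊕ apply T f ; isLinear = +-linear S T }

  multiplyBy : Γ K.Carrier → Operator
  multiplyBy g = record { apply = g ⊗_ ; isLinear = ⊗-linear g }

  scalar : K.Carrier → Operator
  scalar a = multiplyBy (con a)

  operatorRing : RawRing (c Level.⊔ ℓ) (c Level.⊔ ℓ)
  operatorRing = record
    { Carrier = Operator
    ; _≈_ = _≐_
    ; _+_ = _+ₒ_
    ; _*_ = _∘_
    ; -_ = scalar (- 1#) ∘_
    ; 0# = scalar 0#
    ; 1# = scalar 1#
    }

  derivative : ℕ → Γ K.Carrier → Γ K.Carrier
  derivative k (con a) = con 0#
  derivative k (p j) with k ℕ.≟ j
  ... | yes _ = con 1#
  ... | no  _ = con 0#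
  derivative k (f ⊕ g) = derivative k f ⊕ derivative k g
  derivative k (f ⊗ g) = derivative k f ⊗ g ⊕ f ⊗ derivative k g

  abstract
    derivative-linear : ∀ k → Linear (derivative k)
    derivative-linear k = linear D-cong (λ _ _ → refl) D-con
      where
      D : Γ K.Carrier → Γ K.Carrier
      D = derivative k

      open SetoidReasoning R.setoid

      D-con : ∀ a f → con 0# ⊗ f ⊕ con a ⊗ D f ≈ con a ⊗ D f
      D-con a f = trans (⊕-cong (zeroˡ _) refl) (R.+-identityˡ _)

      D-cong : ∀ {f g} → f ≈ g → D f ≈ D g
      D-cong refl = refl
      D-cong (sym e) = sym (D-cong e)
      D-cong (trans e e′) = trans (D-cong e) (D-cong e′)
      D-cong (⊕-cong e e′) = ⊕-cong (D-cong e) (D-cong e′)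
      D-cong (⊗-cong e e′) = ⊕-cong (⊗-cong (D-cong e) e′) (⊗-cong e (D-cong e′))
      D-cong (con-cong _) = refl
      D-cong (con-+ a b) = sym (⊕-identityʳ _)
      D-cong (con-* a b) = sym (trans (D-con a (con b)) (zeroʳ _))
      D-cong (⊕-assoc _ _ _) = ⊕-assoc _ _ _
      D-cong (⊕-comm _ _) = ⊕-comm _ _
      D-cong (⊕-identityʳ _) = ⊕-identityʳ _
      D-cong (⊕-inverseʳ f) = trans (⊕-cong refl (D-con (- 1#) f)) (⊕-inverseʳ _)
      D-cong (⊗-assoc f g h) = begin
        (D f ⊗ g ⊕ f ⊗ D g) ⊗ h ⊕ (f ⊗ g) ⊗ D h
          ≈⟨ ⊕-cong (R.distribʳ h (D f ⊗ g) (f ⊗ D g)) refl ⟩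
        ((D f ⊗ g) ⊗ h ⊕ (f ⊗ D g) ⊗ h) ⊕ (f ⊗ g) ⊗ D h
          ≈⟨ ⊕-assoc _ _ _ ⟩
        (D f ⊗ g) ⊗ h ⊕ ((f ⊗ D g) ⊗ h ⊕ (f ⊗ g) ⊗ D h)
          ≈⟨ ⊕-cong (⊗-assoc _ _ _) (⊕-cong (⊗-assoc _ _ _) (⊗-assoc _ _ _)) ⟩
        D f ⊗ (g ⊗ h) ⊕ (f ⊗ (D g ⊗ h) ⊕ f ⊗ (g ⊗ D h))
          ≈⟨ ⊕-cong refl (⊗-distribˡ f (D g ⊗ h) (g ⊗ D h)) ⟨
        D f ⊗ (g ⊗ h) ⊕ f ⊗ (D g ⊗ h ⊕ g ⊗ D h) ∎
      D-cong (⊗-comm f g) = trans (⊕-comm _ _) (⊕-cong (⊗-comm _ _) (⊗-comm _ _))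
      D-cong (⊗-identityˡ f) = trans (D-con 1# f) (⊗-identityˡ _)
      D-cong (⊗-distribˡ f g h) =
        trans (⊕-cong (⊗-distribˡ (D f) g h) (⊗-distribˡ f (D g) (D h))) (interchange _ _ _ _)

  ∂ : ℕ → Operator
  ∂ k = record { apply = derivative k ; isLinear = derivative-linear k }

  -- deg< d f: the polynomial f has degree less than d.
  data deg< : ℕ → Γ K.Carrier → Set (c Level.⊔ ℓ) where
    zero     : ∀ {d} → deg< d (con 0#)
    constant : ∀ {d} a → 0 < d → deg< d (con a)
    var      : ∀ {d} k → odd k < d → deg< d (p k)
    add      : ∀ {d f g} → deg< d f → deg< d g → deg< d (f ⊕ g)
    mul      : ∀ {d e f g} → deg< (suc d) f → deg< (suc e) g → deg< (suc (d ℕ.+ e)) (f ⊗ g)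
    resp     : ∀ {d f g} → f ≈ g → deg< d f → deg< d g

  deg<-weaken : ∀ {d e f} → d ≤ e → deg< d f → deg< e f
  deg<-weaken d≤e zero = zero
  deg<-weaken d≤e (constant a 0<d) = constant a (ℕ.≤-trans 0<d d≤e)
  deg<-weaken d≤e (var k k<d) = var k (ℕ.≤-trans k<d d≤e)
  deg<-weaken d≤e (add x y) = add (deg<-weaken d≤e x) (deg<-weaken d≤e y)
  deg<-weaken {e = suc m} (s≤s d≤m) (mul {d} {e} x y) = subst (λ n → deg< (suc n) _)
    (ℕ.m∸n+n≡m (ℕ.≤-trans (ℕ.m≤n+m e d) d≤m))
    (mul (deg<-weaken (s≤s (ℕ.≤-trans (ℕ.≤-reflexive (≡.sym (ℕ.m+n∸n≡m d e))) (ℕ.∸-monoˡ-≤ e d≤m))) x) y)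
  deg<-weaken d≤e (resp eq x) = resp eq (deg<-weaken d≤e x)

  deg<-deg : ∀ f → deg< (suc (deg f)) f
  deg<-deg (con a) = constant a (s≤s z≤n)
  deg<-deg (p k)   = var k ℕ.≤-refl
  deg<-deg (f ⊕ g) = add (deg<-weaken (s≤s (ℕ.m≤m⊔n (deg f) (deg g))) (deg<-deg f))
                         (deg<-weaken (s≤s (ℕ.m≤n⊔m (deg f) (deg g))) (deg<-deg g))
  deg<-deg (f ⊗ g) = mul (deg<-deg f) (deg<-deg g)

  deg<0⇒≈0 : ∀ {d f} → d ≡ 0 → deg< d f → f ≈ con 0#
  deg<0⇒≈0 d≡0 zero = refl
  deg<0⇒≈0 ≡.refl (constant a ())
  deg<0⇒≈0 ≡.refl (var k ())
  deg<0⇒≈0 d≡0 (add x y) = trans (⊕-cong (deg<0⇒≈0 d≡0 x) (deg<0⇒≈0 d≡0 y)) (⊕-identityʳ _)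
  deg<0⇒≈0 () (mul x y)
  deg<0⇒≈0 d≡0 (resp eq x) = trans (sym eq) (deg<0⇒≈0 d≡0 x)

  deg<-mul : ∀ {d e f g} → deg< d f → deg< (suc e) g → deg< (d ℕ.+ e) (f ⊗ g)
  deg<-mul {zero}  x y = resp (sym (trans (⊗-cong (deg<0⇒≈0 ≡.refl x) refl) (zeroˡ _))) zero
  deg<-mul {suc d} x y = mul x y

  -- A record, so that n and T can be inferred from a proof.
  record Lowers (n : ℕ) (T : Operator) : Set (c Level.⊔ ℓ) where
    constructor mk
    field lower : ∀ {d f} → deg< d f → deg< (d ∸ n) (apply T f)
  open Lowers public

  derivative-lowers : ∀ k {d f} → deg< d f → deg< (d ∸ odd k) (derivative k f)
  derivative-lowers k zero = zero
  derivative-lowers k (constant a _) = zero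
  derivative-lowers k (var j j<d) with k ℕ.≟ j
  ... | yes ≡.refl = constant 1# (ℕ.m<n⇒0<n∸m j<d)
  ... | no  _ = zero
  derivative-lowers k (add x y) = add (derivative-lowers k x) (derivative-lowers k y)
  derivative-lowers k (mul {d} {e} {f} {g} x y) = add
    (half x y)
    (resp (⊗-comm _ f) (subst (λ m → deg< (suc m ∸ odd k) (derivative k g ⊗ f)) (ℕ.+-comm e d) (half y x)))
    where
    half : ∀ {d e f g} → deg< (suc d) f → deg< (suc e) g →
           deg< (suc (d ℕ.+ e) ∸ odd k) (derivative k f ⊗ g)
    half {d} {e} {f} {g} x y with odd k ℕ.≤? suc d
    ... | yes n≤d = subst (λ m → deg< m (derivative k f ⊗ g)) (≡.sym (ℕ.+-∸-comm e n≤d))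
                      (deg<-mul (derivative-lowers k x) y)
    ... | no  n≰d = resp (sym (trans (⊗-cong ∂f≈0 refl) (zeroˡ g))) zero
      where
      ∂f≈0 : derivative k f ≈ con 0#
      ∂f≈0 = deg<0⇒≈0 (ℕ.m≤n⇒m∸n≡0 (ℕ.<⇒≤ (ℕ.≰⇒> n≰d))) (derivative-lowers k x)
  derivative-lowers k (resp eq x) = resp (Operator.⟦⟧-cong (∂ k) eq) (derivative-lowers k x)

  ∂-lowers : ∀ k → Lowers (odd k) (∂ k)
  ∂-lowers k = mk (derivative-lowers k)

  scalar-lowers : ∀ a → Lowers 0 (scalar a)
  scalar-lowers a = mk go
    where
    go : ∀ {d f} → deg< d f → deg< d (con a ⊗ f)
    go {zero}  x = resp (sym (trans (⊗-cong refl (deg<0⇒≈0 ≡.refl x)) (zeroʳ _))) zero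
    go {suc d} x = mul (constant a (s≤s z≤n)) x

  zero-lowers : ∀ n → Lowers n (scalar 0#)
  zero-lowers n = mk λ {_} {f} _ → resp (sym (zeroˡ f)) zero

  +ₒ-lowers : ∀ {n S T} → Lowers n S → Lowers n T → Lowers n (S +ₒ T)
  +ₒ-lowers s t = mk λ x → add (lower s x) (lower t x)

  ∘-lowers : ∀ {m n S T} → Lowers m S → Lowers n T → Lowers (m ℕ.+ n) (S ∘ T)
  ∘-lowers {m} {n} {S} {T} s t = mk λ {d} {f} x →
    subst (λ e → deg< e (apply S (apply T f)))
      (≡.trans (ℕ.∸-+-assoc d n m) (≡.cong (d ∸_) (ℕ.+-comm n m)))
      (lower s (lower t x))

  module _ (ι : ℚ → K.Carrier) where
    open PowerSeries operatorRing (λ r → scalar (ι r))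
    open RawSemiringDefinitions (RawRing.rawSemiring operatorRing) using () renaming (sum to sumₒ)

    sum-lowers : ∀ {m n} {T : Fin n → Operator} → (∀ i → Lowers m (T i)) → Lowers m (sumₒ T)
    sum-lowers {n = zero}  l = zero-lowers _
    sum-lowers {n = suc n} l = +ₒ-lowers (l Fin.zero) (sum-lowers λ i → l (Fin.suc i))

    ⊛-lowers : ∀ {S T} → (∀ n → Lowers n (S n)) → (∀ n → Lowers n (T n)) → ∀ n → Lowers n ((S ⊛ T) n)
    ⊛-lowers {S} {T} s t n = sum-lowers {n = suc n} λ i →
      subst (λ m → Lowers m (S (toℕ i) ∘ T (n ∸ toℕ i)))
        (ℕ.m+[n∸m]≡n (Fin.toℕ≤pred[n] i)) (∘-lowers (s (toℕ i)) (t (n ∸ toℕ i)))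

    power-lowers : ∀ {S} → (∀ n → Lowers n (S n)) → ∀ k n → Lowers n (power S k n)
    power-lowers s zero    zero    = scalar-lowers 1#
    power-lowers s zero    (suc n) = zero-lowers (suc n)
    power-lowers s (suc k) n       = ⊛-lowers s (power-lowers s k) n

    exp-lowers : ∀ {S} → (∀ n → Lowers n (S n)) → ∀ n → Lowers n (exp S n)
    exp-lowers {S} s n = sum-lowers {n = suc n} {λ k → scalar (ι (1/ toℕ k !)) ∘ power S (toℕ k) n} λ k →
      ∘-lowers (scalar-lowers (ι (1/ toℕ k !))) (power-lowers s (toℕ k) n)

    oddSeries-lowers : ∀ m {T} → (∀ k → Lowers (m ℕ.+ odd k) (T k)) →
                       ∀ n → Lowers (m ℕ.+ n) (oddSeries T n)
    oddSeries-lowers m     l zero          = zero-lowers (m ℕ.+ 0)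
    oddSeries-lowers m     l (suc zero)    = l 0
    oddSeries-lowers m {T} l (suc (suc n)) =
      subst (λ e → Lowers e (oddSeries (λ k → T (suc k)) n)) (ℕ.+-assoc m 2 n)
        (oddSeries-lowers (m ℕ.+ 2) (λ k → subst (λ e → Lowers e (T (suc k))) (shift k) (l (suc k))) n)
      where
      shift : ∀ k → m ℕ.+ odd (suc k) ≡ m ℕ.+ 2 ℕ.+ odd k
      shift k = ≡.trans (≡.cong (λ x → m ℕ.+ suc x) (ℕ.*-suc 2 k)) (≡.sym (ℕ.+-assoc m 2 (odd k)))

  -- A formal series in z and z⁻¹, given by its coefficients of z^m.
  FormalSeries : Set (c Level.⊔ ℓ)
  FormalSeries = ℤ → Operator

  infix 4 _≋_
  _≋_ : FormalSeries → FormalSeries → Set (c Level.⊔ ℓ)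
  S ≋ T = ∀ m → S m ≐ T m

  -- S = ∑_m S_m z^{-m}
  mode : FormalSeries → ℤ → Operator
  mode S m = S (ℤ.- m)

  LocallyFinite : (ℕ → Operator) → Set (c Level.⊔ ℓ)
  LocallyFinite D = ∀ f j → deg f < j → apply (D j) f ≈ con 0#

  lowers⇒locallyFinite : ∀ D → (∀ n → Lowers n (D n)) → LocallyFinite D
  lowers⇒locallyFinite D l f j f<j = deg<0⇒≈0 (ℕ.m≤n⇒m∸n≡0 f<j) (lower (l j) (deg<-deg f))

  infix 10 _⟨_⟩
  _⟨_⟩ : (ℕ → Operator) → ℤ → Operator
  E ⟨ + n ⟩      = E n
  E ⟨ -[1+ n ] ⟩ = scalar 0#

  private
    sum-zero : ∀ n (g : ℕ → Γ K.Carrier) → (∀ j → g j ≈ con 0#) → ∑[ i < n ] g (toℕ i) ≈ con 0#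
    sum-zero zero    g e = refl
    sum-zero (suc n) g e =
      trans (⊕-cong (e 0) (sum-zero n (λ j → g (suc j)) (λ j → e (suc j)))) (⊕-identityʳ _)

    sum-extend : ∀ {m n} (g : ℕ → Γ K.Carrier) → m ≤ n → (∀ j → m ≤ j → g j ≈ con 0#) →
                 ∑[ i < m ] g (toℕ i) ≈ ∑[ i < n ] g (toℕ i)
    sum-extend {n = n} g z≤n e = sym (sum-zero n g λ j → e j z≤n)
    sum-extend g (s≤s m≤n) e =
      ⊕-cong refl (sum-extend (λ j → g (suc j)) m≤n λ j m≤j → e (suc j) (s≤s m≤j))

    sum-scale : ∀ n a (g : Fin n → Γ K.Carrier) → ∑[ i < n ] (a ⊗ g i) ≈ a ⊗ (∑[ i < n ] g i)
    sum-scale zero    a g = sym (zeroʳ a)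
    sum-scale (suc n) a g =
      trans (⊕-cong refl (sum-scale n a λ i → g (Fin.suc i))) (sym (⊗-distribˡ a _ _))

  productTerm : (E D : ℕ → Operator) → ℤ → Γ K.Carrier → ℕ → Γ K.Carrier
  productTerm E D m f j = apply (E ⟨ m ℤ.+ + j ⟩) (apply (D j) f)

  abstract
    product-linear : ∀ E D (finite : LocallyFinite D) m →
                     Linear (λ f → ∑[ j ≤ deg f ] productTerm E D m f (toℕ j))
    product-linear E D finite m = linear respects additive homogeneous
      where
      module T j = Operator (E ⟨ m ℤ.+ + j ⟩ ∘ D j)

      extend : ∀ {n} f → deg f ≤ n → ∑[ j ≤ deg f ] productTerm E D m f (toℕ j) ≈ ∑[ j ≤ n ] productTerm E D m f (toℕ j)
      extend f f≤n = sum-extend (productTerm E D m f) (s≤s f≤n) λ j f<j →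
        trans (E.⟦⟧-cong j (finite f j f<j)) (E.0ᴹ-homo j)
        where module E j = Operator (E ⟨ m ℤ.+ + j ⟩)

      respects : ∀ {f g} → f ≈ g → ∑[ j ≤ deg f ] productTerm E D m f (toℕ j) ≈ ∑[ j ≤ deg g ] productTerm E D m g (toℕ j)
      respects {f} {g} e = trans (extend f (ℕ.m≤m⊔n (deg f) (deg g)))
        (trans (sum-cong-≋ {suc (deg f ⊔ deg g)} (λ j → T.⟦⟧-cong (toℕ j) e))
        (sym (extend g (ℕ.m≤n⊔m (deg f) (deg g)))))

      additive : ∀ f g → ∑[ j ≤ deg f ⊔ deg g ] productTerm E D m (f ⊕ g) (toℕ j)
                  ≈ ∑[ j ≤ deg f ] productTerm E D m f (toℕ j) ⊕ ∑[ j ≤ deg g ] productTerm E D m g (toℕ j)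
      additive f g = trans (sum-cong-≋ {suc (deg f ⊔ deg g)} λ j → T.+ᴹ-homo (toℕ j) f g)
        (trans (∑-distrib-+ {suc (deg f ⊔ deg g)} (λ j → productTerm E D m f (toℕ j)) (λ j → productTerm E D m g (toℕ j)))
        (sym (⊕-cong (extend f (ℕ.m≤m⊔n (deg f) (deg g))) (extend g (ℕ.m≤n⊔m (deg f) (deg g))))))

      homogeneous : ∀ a f → ∑[ j ≤ deg f ] productTerm E D m (con a ⊗ f) (toℕ j) ≈ con a ⊗ (∑[ j ≤ deg f ] productTerm E D m f (toℕ j))
      homogeneous a f = trans (sum-cong-≋ {suc (deg f)} λ j → T.*ₗ-homo (toℕ j) a f)
        (sum-scale (suc (deg f)) (con a) (λ j → productTerm E D m f (toℕ j)))

  -- The product (∑_i E_i z^i)(∑_j D_j z^{-j}). The coefficient of z^m is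
  -- the sum over all j ≥ 0 of E_{m+j} D_j; the terms with j > deg f vanish
  -- on f.
  product : (E D : ℕ → Operator) → LocallyFinite D → FormalSeries
  product E D finite m = record
    { apply    = λ f → ∑[ j ≤ deg f ] productTerm E D m f (toℕ j)
    ; isLinear = product-linear E D finite m
    }

module VertexOperators (K : CommutativeRing c ℓ) (ι : ℚ → CommutativeRing.Carrier K) where
  open CommutativeRing K using () renaming (Carrier to C)
  open Operators K
  open RawRing operatorRing using (-_)
  open PowerSeries operatorRing (λ r → scalar (ι r)) using (exp; oddSeries)

  -- a₋ k and a₊ k stand for a_{-n} and a_n with n = odd k.
  a₋ a₊ : ℕ → Operator
  a₋ k = multiplyBy (p k)
  a₊ k = scalar (ι (+ odd k / 2)) ∘ ∂ k

  a₊-lowers : ∀ k → Lowers (odd k) (a₊ k)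
  a₊-lowers k = ∘-lowers (scalar-lowers _) (∂-lowers k)

  creation annihilation : (ℕ → C) → ℕ → Operator
  creation     b = exp (oddSeries λ k → scalar (b k) ∘ a₋ k)
  annihilation b = exp (oddSeries λ k → - (scalar (b k) ∘ a₊ k))

  annihilation-locallyFinite : ∀ b → LocallyFinite (annihilation b)
  annihilation-locallyFinite b = lowers⇒locallyFinite (annihilation b)
    (exp-lowers ι {oddSeries T} (oddSeries-lowers ι 0 {T} λ k →
      ∘-lowers (scalar-lowers _) (∘-lowers (scalar-lowers (b k)) (a₊-lowers k))))
    where
    T : ℕ → Operator
    T k = - (scalar (b k) ∘ a₊ k)

  -- exp(∑ b_n a_{-n} z^n) exp(-∑ b′_n a_n z^{-n}), sums over odd n = odd k
  vertexOperator : (b b′ : ℕ → C) → FormalSeries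
  vertexOperator b b′ = product (creation b) (annihilation b′) (annihilation-locallyFinite b′)

module Pfaffian (R : CommutativeRing c ℓ) where
  open CommutativeRing R
  open Exponentiation semiring using (_^_)

  -- The perfect matchings of the entries of a vector, each listed as pairs
  -- (i₁ , j₁), (i₂ , j₂), … such that i_k precedes j_k in the vector and i_k
  -- precedes i_{k+1}.
  matchings : {A : Set} (n : ℕ) → Vec A (n ℕ.* 2) → List (List (A × A))
  matchings zero    _            = [] ∷ []
  matchings (suc n) (x Vec.∷ xs) =
    concatMap (λ i → map ((x , lookup xs i) ∷_) (matchings n (removeAt xs i))) (allFin (suc (n ℕ.* 2)))

  inversions : ∀ {m} → List (Fin m) → ℕ
  inversions []       = 0
  inversions (i ∷ is) = length (filter (Fin._<? i) is) ℕ.+ inversions is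

  Matrix : ℕ → Set c
  Matrix m = Fin m → Fin m → Carrier

  -- ∑ sgn(i₁ j₁ … i_n j_n) ∏ a_{i_k j_k} over the perfect matchings
  -- {i₁,j₁}, …, {i_n,j_n} with i_k < j_k
  Pf : ∀ n → Matrix (n ℕ.* 2) → Carrier
  Pf n a = foldr _+_ 0# (map weight (matchings n (Vec.allFin (n ℕ.* 2))))
    where
    weight : List (Fin (n ℕ.* 2) × Fin (n ℕ.* 2)) → Carrier
    weight m = (- 1#) ^ inversions (concatMap (λ (i , j) → i ∷ j ∷ []) m)
             * foldr _*_ 1# (map (λ (i , j) → a i j) m)

  -- The skew-symmetric matrix with the given entries above the diagonal.
  skew : ∀ {m} → Matrix m → Matrix m
  skew a i j with Fin.<-cmp i j
  ... | tri< _ _ _ = a i j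
  ... | tri≈ _ _ _ = 0#
  ... | tri> _ _ _ = - a j i

record StrictPartition : Set where
  field
    parts    : List ℕ
    strict   : Linked _>_ parts
    positive : All (_> 0) parts
open StrictPartition public

Γℚ : CommutativeRing 0ℓ 0ℓ
Γℚ = Polynomials.ring ℚ.+-*-commutativeRing

module SchurQ where
  open CommutativeRing Γℚ
  open Exponentiation semiring using (_^_)
  open Summation +-commutativeMonoid using (sum-syntax)
  open PowerSeries rawRing con using (exp; oddSeries)
  open Pfaffian Γℚ

  q : ℕ → Carrier
  q = exp (oddSeries λ k → con (+ 2 / odd k) * p k)

  -- Q_{(r,s)} for r ≥ s ≥ 0, (r,s) ≠ (0,0)
  Q₂ : ℕ → ℕ → Carrier
  Q₂ r s = q r * q s + con (+ 2 / 1) *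
    (∑[ i < s ] (let k = suc (toℕ i) in (- 1#) ^ k * q (r ℕ.+ k) * q (s ∸ k)))

  part : List ℕ → ℕ → ℕ
  part []      _       = 0
  part (r ∷ _) zero    = r
  part (_ ∷ l) (suc i) = part l i

  -- The matrix size 2⌈ℓ/2⌉ amounts to appending a zero part when the
  -- length ℓ is odd.
  Q : StrictPartition → Carrier
  Q μ = Pf ⌈ length (parts μ) /2⌉ (skew λ i j → Q₂ (part (parts μ) (toℕ i)) (part (parts μ) (toℕ j)))

private
  ℚ-cancelˡ : AlmostLeftCancellative _≡_ 0ℚ ℚ._*_
  ℚ-cancelˡ x y z x≢0 e = ≡.trans (undo y) (≡.trans (≡.cong (ℚ._*_ (ℚ.1/ x)) e) (≡.sym (undo z)))
    where
    instance
      x-nonZero : ℚ.NonZero x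
      x-nonZero = ℚ.≢-nonZero x≢0

    undo : ∀ w → w ≡ ℚ.1/ x ℚ.* (x ℚ.* w)
    undo w = ≡.trans (≡.sym (ℚ.*-identityˡ w))
      (≡.trans (≡.cong (ℚ._* w) (≡.sym (ℚ.*-inverseˡ x))) (ℚ.*-assoc (ℚ.1/ x) x w))

module ℚ[t] = OneVariable ℚ.+-*-commutativeRing
module Frac = Fractions ℚ[t].polynomialRing (ℚ[t].*ₚ-cancelˡ ℚ._≟_ ℚ-cancelˡ)
  (λ e → ℚ.1≢0 (ℚ[t].at e 0))

ℚ⟨t⟩ : CommutativeRing 0ℓ 0ℓ
ℚ⟨t⟩ = Frac.fractionField

module ℚ⟨t⟩ = CommutativeRing ℚ⟨t⟩

ι : ℚ → ℚ⟨t⟩.Carrier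
ι r = Frac.embed (ℚ[t].constant r)

ι-isRingHomomorphism : Morphisms.RingMorphisms.IsRingHomomorphism ℚ.+-*-rawRing ℚ⟨t⟩.rawRing ι
ι-isRingHomomorphism = Composition.isRingHomomorphism ℚ⟨t⟩.trans
  ℚ[t].constant-isRingHomomorphism Frac.embed-isRingHomomorphism

1-t^_ [1-t^_]⁻¹ : (n : ℕ) .{{_ : ℕ.NonZero n}} → ℚ⟨t⟩.Carrier
1-t^ n      = Frac.embed (ℚ[t].1-t^ n)
[1-t^ n ]⁻¹ = Frac.reciprocal (ℚ[t].1-t^ n) (ℚ[t].1-t^n≉0 ℚ.1≢0 n)

1-t^-inverse : ∀ n .{{_ : ℕ.NonZero n}} → 1-t^ n ℚ⟨t⟩.* [1-t^ n ]⁻¹ ℚ⟨t⟩.≈ ℚ⟨t⟩.1#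
1-t^-inverse n = Frac.reciprocal-inverse (ℚ[t].1-t^ n) (ℚ[t].1-t^n≉0 ℚ.1≢0 n)

Γℚ⟨t⟩ : CommutativeRing 0ℓ 0ℓ
Γℚ⟨t⟩ = Polynomials.ring ℚ⟨t⟩

module Γℚ⟨t⟩ = CommutativeRing Γℚ⟨t⟩

open Operators ℚ⟨t⟩ public using (Operator; apply; FormalSeries; _≋_; _∘_; mode)
open VertexOperators ℚ⟨t⟩ ι public using (vertexOperator)

extendScalars : CommutativeRing.Carrier Γℚ → Γℚ⟨t⟩.Carrier
extendScalars = substitute ι p

infix 20 _[X-tX]
_[X-tX] : CommutativeRing.Carrier Γℚ → Γℚ⟨t⟩.Carrier
f [X-tX] = substitute ι (λ k → con (1-t^ odd k) ⊗ p k) f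

private
  rescale : (ℕ → ℚ⟨t⟩.Carrier) → Γℚ⟨t⟩.Carrier → Γℚ⟨t⟩.Carrier
  rescale u = substitute id (λ k → con (u k) ⊗ p k)

  open Polynomials ℚ⟨t⟩ using (refl; trans; sym; ⊕-cong; ⊗-cong; con-*; con-cong; ⊗-identityˡ)

  rescale-cong : ∀ u {f g} → f Γℚ⟨t⟩.≈ g → rescale u f Γℚ⟨t⟩.≈ rescale u g
  rescale-cong u = substitute-cong ℚ⟨t⟩ ℚ⟨t⟩ (Identity.isRingHomomorphism ℚ⟨t⟩.rawRing ℚ⟨t⟩.refl) _

  rescale-inverse : ∀ u v → (∀ k → u k ℚ⟨t⟩.* v k ℚ⟨t⟩.≈ ℚ⟨t⟩.1#) →
                    ∀ f → rescale u (rescale v f) Γℚ⟨t⟩.≈ f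
  rescale-inverse u v uv (con a) = refl
  rescale-inverse u v uv (p k) = begin
    con (v k) ⊗ (con (u k) ⊗ p k)   ≈⟨ Γℚ⟨t⟩.*-assoc (con (v k)) (con (u k)) (p k) ⟨
    con (v k) ⊗ con (u k) ⊗ p k     ≈⟨ ⊗-cong (con-* (v k) (u k)) refl ⟨
    con (v k ℚ⟨t⟩.* u k) ⊗ p k      ≈⟨ ⊗-cong (con-cong (ℚ⟨t⟩.trans (ℚ⟨t⟩.*-comm (v k) (u k)) (uv k))) refl ⟩
    con ℚ⟨t⟩.1# ⊗ p k               ≈⟨ ⊗-identityˡ (p k) ⟩
    p k                             ∎
    where open SetoidReasoning Γℚ⟨t⟩.setoid
  rescale-inverse u v uv (f ⊕ g) = ⊕-cong (rescale-inverse u v uv f) (rescale-inverse u v uv g)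
  rescale-inverse u v uv (f ⊗ g) = ⊗-cong (rescale-inverse u v uv f) (rescale-inverse u v uv g)

abstract
  rescale-linear : ∀ u → Operators.Linear ℚ⟨t⟩ (rescale u)
  rescale-linear u = Operators.linear ℚ⟨t⟩ (rescale-cong u) (λ _ _ → refl) (λ _ _ → refl)

ρ ρ⁻¹ : Operator
ρ   = record
  { apply    = substitute id (λ k → con (1-t^ odd k) ⊗ p k)
  ; isLinear = rescale-linear λ k → 1-t^ odd k
  }
ρ⁻¹ = record
  { apply    = substitute id (λ k → con ([1-t^ odd k ]⁻¹) ⊗ p k)
  ; isLinear = rescale-linear λ k → [1-t^ odd k ]⁻¹
  }

ρ-ρ⁻¹ : ∀ f → apply ρ (apply ρ⁻¹ f) Γℚ⟨t⟩.≈ f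
ρ-ρ⁻¹ = rescale-inverse _ _ λ k → 1-t^-inverse (odd k)

ρ⁻¹-ρ : ∀ f → apply ρ⁻¹ (apply ρ f) Γℚ⟨t⟩.≈ f
ρ⁻¹-ρ = rescale-inverse _ _ λ k →
  ℚ⟨t⟩.trans (ℚ⟨t⟩.*-comm [1-t^ odd k ]⁻¹ (1-t^ odd k)) (1-t^-inverse (odd k))

ρ-isRingIsomorphism :
  Morphisms.RingMorphisms.IsRingIsomorphism Γℚ⟨t⟩.rawRing Γℚ⟨t⟩.rawRing (apply ρ)
ρ-isRingIsomorphism = record
  { isRingMonomorphism = record
    { isRingHomomorphism = record
      { isSemiringHomomorphism = record
        { isNearSemiringHomomorphism = record
          { +-isMonoidHomomorphism = record
            { isMagmaHomomorphism = record
              { isRelHomomorphism = record { cong = Operator.⟦⟧-cong ρ }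
              ; homo = λ _ _ → refl
              }
            ; ε-homo = refl
            }
          ; *-homo = λ _ _ → refl
          }
        ; 1#-homo = refl
        }
      ; -‿homo = λ _ → refl
      }
    ; injective = λ {f} {g} e →
        trans (sym (ρ⁻¹-ρ f)) (trans (Operator.⟦⟧-cong ρ⁻¹ e) (ρ⁻¹-ρ g))
    }
  ; surjective = λ f → apply ρ⁻¹ f , λ e → trans (Operator.⟦⟧-cong ρ e) (ρ-ρ⁻¹ f)
  }

Φ : FormalSeries
Φ = vertexOperator (λ k → ι (+ 2 / odd k)) (λ k → ι (+ 2 / odd k))

𝒴 : FormalSeries
𝒴 = vertexOperator (λ k → ι (+ 2 / odd k) ℚ⟨t⟩.* 1-t^ odd k) (λ k → ι (+ 2 / odd k) ℚ⟨t⟩.* [1-t^ odd k ]⁻¹)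

𝒬 : StrictPartition → Γℚ⟨t⟩.Carrier
𝒬 μ = foldr (λ r → apply (mode 𝒴 (ℤ.- (+ r)))) Γℚ⟨t⟩.1# (parts μ)

{-# OPTIONS --safe #-}
module Submission where

-- The automorphism ρ conjugates multiplication by p_n to multiplication by
-- (1 - t^n) p_n and ∂/∂p_n to (1 - t^n)⁻¹ ∂/∂p_n. Exponentials of series of
-- operators are built from sums and composites, which conjugation respects,
-- so ρ Φ(z) ρ⁻¹ = 𝒴(z;t); this is conjugate-vertexOperator. By
-- conjugate-iterate, 𝒬_λ is then ρ applied to X(λ) = Φ_{λ₁} ⋯ Φ_{λ_ℓ} 1, and
-- it remains to identify X(λ) with Schur's Pfaffian Q_λ.
--
-- Write Φ(z) = Q(z) T(z), where Q(z) = ∑ q_r z^r acts by multiplication and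
-- T(z) = exp(-∑ z^(-n) ∂/∂p_n) = ∑ T_k z^(-k) is a translation. The exponentials
-- satisfy first-order differential equations (d-exp), and with the uniqueness
-- of the solution these give
--   (z + w) T(z) Q(w) = (z - w) Q(w) T(z)
-- (Translation.T-q), hence the same exchange relation for Φ(z) with Q(w)
-- (Φ-q) and for T(z) with Φ(w) (T-Φ).
--
-- Schur's Pfaffian identity takes the following form. For a sequence l of
-- integers let alt h l be the alternating sum of h(s, l without s) over the
-- entries s of l. Then, with κ_k(s) the coefficient of z^(-k) w^s in
-- (z - w)/(z + w) Q(w),
--   alt(q_s X(l′)) = X(l) if l has odd length, and 0 otherwise,
--   T_k X(l) = alt(κ_k(s) X(l′)), plus X(l) if k = 0 and l has even length.
-- Both are proved together by induction on the length of l. The first follows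
-- for the sequence r, l from the two statements for l and for l with one entry
-- removed, because a double alternating sum is antisymmetric. The second then
-- follows by induction on k from the exchange relations.
--
-- For l of odd length, summing q_{r+k} T_k X(l) over k turns the second
-- statement into X(r, l) = alt(X(r, s) X(l′)), which is the expansion of a
-- Pfaffian along its first row (X-expansion, subPf-expansion). As X(r, s) is
-- Q_{(r,s)} (pair) and Φ₀ 1 = 1 accounts for the zero part appended in odd
-- length, X(λ) = Q_λ follows by induction on the length (extendScalars-Q).

open import Defs hiding
  ( Operator; apply; FormalSeries; _≋_; _∘_; mode; vertexOperator
  ; ι; ι-isRingHomomorphism; 1-t^_; extendScalars; Φ; ρ; ρ⁻¹)
import Defs
open import Algebra.Bundles using (CommutativeRing; RawRing; Ring)
import Algebra.Definitions.RawSemiring as RawSemiringDefinitions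
import Algebra.Morphism.Structures as Morphisms
import Algebra.Properties.AbelianGroup as AbelianGroupProperties
import Algebra.Properties.CommutativeMonoid.Mult as Mult
import Algebra.Properties.CommutativeMonoid.Sum as Summation
import Algebra.Properties.CommutativeSemigroup as CommutativeSemigroupProperties
import Algebra.Properties.Group as GroupProperties
import Algebra.Properties.Semiring.Exp as Exponentiation
import Algebra.Properties.Semiring.Mult as SemiringMult
import Algebra.Properties.Semiring.Sum as SemiringSum
import Algebra.Solver.Ring as RingSolver
open import Algebra.Solver.Ring.AlmostCommutativeRing using
  (_-Raw-AlmostCommutative⟶_; fromCommutativeRing)
open import Data.Bool.Base using (true; false)
open import Data.Fin.Base using (Fin; toℕ)
import Data.Fin.Base as Fin
import Data.Fin.Properties as Fin
open import Data.Integer.Base using (ℤ; +_; -[1+_])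
import Data.Integer.Base as ℤ
import Data.Integer.Properties as ℤ
import Data.Integer.Solver as IntegerSolver
open import Data.List.Base using
  (List; []; _∷_; _++_; foldr; length; map; filter; concatMap; allFin; tabulate)
import Data.List.Properties as List
open import Data.List.Relation.Binary.Permutation.Propositional using (_↭_; prep; swap; ↭-sym; ↭-trans; ↭-refl)
import Data.List.Relation.Binary.Permutation.Propositional as Permutation
open import Data.List.Relation.Binary.Permutation.Propositional.Properties using (All-resp-↭)
open import Data.List.Relation.Unary.All using (All; []; _∷_)
import Data.List.Relation.Unary.All as All
import Data.List.Relation.Unary.All.Properties as All
open import Data.List.Relation.Unary.AllPairs using (AllPairs; []; _∷_)
import Data.List.Relation.Unary.AllPairs.Properties as AllPairs
open import Data.Maybe.Base using (Maybe; just; nothing)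
open import Data.Nat.Base using (ℕ; zero; suc; _∸_; _<_; _≤_; _!; z≤n; s≤s)
import Data.Nat.Base as ℕ
import Data.Nat.Properties as ℕ
open import Data.Product.Base using (_,_; proj₁; proj₂)
import Data.Product.Base as Product
open import Data.Rational.Base using (ℚ; 1ℚ; _/_)
import Data.Rational.Base as ℚ
import Data.Rational.Properties as ℚ
import Data.Rational.Unnormalised.Base as ℚᵘ
import Data.Rational.Unnormalised.Properties as ℚᵘ
open import Data.Vec.Base using (Vec; lookup; removeAt; toList)
import Data.Vec.Base as Vec
import Data.Vec.Properties as Vec
open import Function.Base using (id)
open import Level using (Level)
import Level
open import Relation.Binary.Definitions using (tri<; tri≈; tri>)
open import Relation.Binary.PropositionalEquality using (_≡_; _≢_; subst)
import Relation.Binary.PropositionalEquality as ≡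
import Relation.Binary.Reasoning.Setoid as SetoidReasoning
open import Relation.Nullary.Decidable.Core using (yes; no)
open import Relation.Nullary.Negation.Core using (contradiction)

private
  module ℤS = IntegerSolver.+-*-Solver

  variable
    c ℓ c′ ℓ′ : Level

-- Rational coefficients and exponentials of power series

module Rational where
  open ≡ using (cong; sym; trans)

  private
    fromℚᵘ-* : ∀ x y → ℚ.fromℚᵘ x ℚ.* ℚ.fromℚᵘ y ≡ ℚ.fromℚᵘ (x ℚᵘ.* y)
    fromℚᵘ-* x y = ℚ.toℚᵘ-injective (ℚᵘ.≃-trans (ℚ.toℚᵘ-homo-* (ℚ.fromℚᵘ x) (ℚ.fromℚᵘ y))
      (ℚᵘ.≃-trans (ℚᵘ.*-cong (ℚ.toℚᵘ-fromℚᵘ x) (ℚ.toℚᵘ-fromℚᵘ y)) (ℚᵘ.≃-sym (ℚ.toℚᵘ-fromℚᵘ (x ℚᵘ.* y)))))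

    fromℚᵘ-+ : ∀ x y → ℚ.fromℚᵘ x ℚ.+ ℚ.fromℚᵘ y ≡ ℚ.fromℚᵘ (x ℚᵘ.+ y)
    fromℚᵘ-+ x y = ℚ.toℚᵘ-injective (ℚᵘ.≃-trans (ℚ.toℚᵘ-homo-+ (ℚ.fromℚᵘ x) (ℚ.fromℚᵘ y))
      (ℚᵘ.≃-trans (ℚᵘ.+-cong (ℚ.toℚᵘ-fromℚᵘ x) (ℚ.toℚᵘ-fromℚᵘ y)) (ℚᵘ.≃-sym (ℚ.toℚᵘ-fromℚᵘ (x ℚᵘ.+ y)))))

  -- Cross multiplication for fractions not in lowest terms.
  /-* : ∀ a b c d e f .{{_ : ℕ.NonZero b}} .{{_ : ℕ.NonZero d}} .{{_ : ℕ.NonZero f}} →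
        a ℕ.* c ℕ.* f ≡ e ℕ.* (b ℕ.* d) → (+ a / b) ℚ.* (+ c / d) ≡ + e / f
  /-* a (suc b) c (suc d) e (suc f) eq =
    trans (fromℚᵘ-* (ℚᵘ.mkℚᵘ (+ a) b) (ℚᵘ.mkℚᵘ (+ c) d))
      (ℚ.fromℚᵘ-cong {ℚᵘ.mkℚᵘ (+ a) b ℚᵘ.* ℚᵘ.mkℚᵘ (+ c) d} {ℚᵘ.mkℚᵘ (+ e) f} (ℚᵘ.*≡* (begin
        (+ a ℤ.* + c) ℤ.* + suc f          ≡⟨ cong (ℤ._* + suc f) (ℤ.pos-* a c) ⟨
        + (a ℕ.* c) ℤ.* + suc f            ≡⟨ ℤ.pos-* (a ℕ.* c) (suc f) ⟨
        + (a ℕ.* c ℕ.* suc f)              ≡⟨ cong +_ eq ⟩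
        + (e ℕ.* (suc b ℕ.* suc d))        ≡⟨ ℤ.pos-* e (suc b ℕ.* suc d) ⟩
        + e ℤ.* + (suc b ℕ.* suc d)        ∎)))
    where open ≡.≡-Reasoning

  suc/1 : ∀ n → 1ℚ ℚ.+ (+ n / 1) ≡ + suc n / 1
  suc/1 n = trans (fromℚᵘ-+ (ℚᵘ.mkℚᵘ (+ 1) 0) (ℚᵘ.mkℚᵘ (+ n) 0))
    (cong (λ m → ℚ.fromℚᵘ (ℚᵘ.mkℚᵘ m 0)) (cong (λ m → + 1 ℤ.+ m) (ℤ.*-identityʳ (+ n))))

  1/[1+k]! : ∀ k → (_/_ (+ 1) (suc k !) {{suc k ℕ.!≢0}}) ℚ.* (+ suc k / 1) ≡ _/_ (+ 1) (k !) {{k ℕ.!≢0}}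
  1/[1+k]! k = /-* 1 (suc k !) (suc k) 1 1 (k !) {{suc k ℕ.!≢0}} {{_}} {{k ℕ.!≢0}}
    (trans (cong (ℕ._* k !) (ℕ.*-identityˡ (suc k)))
      (sym (trans (ℕ.*-identityˡ _) (ℕ.*-identityʳ (suc k !)))))

-- Convolution and exponentials of series over a possibly noncommutative
-- ring A, with rational coefficients acting through ι. Centrality of ι is
-- assumed where it is needed.
module ExpSeries (A : Ring c ℓ) (ι : ℚ → Ring.Carrier A) where
  open Ring A
  open PowerSeries rawRing ι public
  open SemiringSum semiring using (sum-syntax; sum-cong-≋; *-distribˡ-sum; ∑-distrib-+)
  open CommutativeSemigroupProperties (Ring.+-commutativeSemigroup A) using (interchange)
  open SetoidReasoning setoid

  infix 4 _≈ₛ_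
  _≈ₛ_ : Series → Series → Set ℓ
  u ≈ₛ v = ∀ n → u n ≈ v n

  ∑-cong : ∀ N (u v : Series) → u ≈ₛ v → ∑[ i < N ] u (toℕ i) ≈ ∑[ i < N ] v (toℕ i)
  ∑-cong N u v e = sum-cong-≋ {N} {λ i → u (toℕ i)} {λ i → v (toℕ i)} λ i → e (toℕ i)

  ∑-zero : ∀ N (u : Series) → (∀ k → u k ≈ 0#) → ∑[ i < N ] u (toℕ i) ≈ 0#
  ∑-zero zero    u e = refl
  ∑-zero (suc N) u e = trans (+-cong (e 0) (∑-zero N (λ k → u (suc k)) (λ k → e (suc k)))) (+-identityʳ _)

  ∑-extend : ∀ {M N} (u : Series) → M ≤ N → (∀ k → M ≤ k → u k ≈ 0#) →
             ∑[ i < M ] u (toℕ i) ≈ ∑[ i < N ] u (toℕ i)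
  ∑-extend {N = N} u z≤n e = sym (∑-zero N u λ k → e k z≤n)
  ∑-extend u (s≤s M≤N) e = +-congˡ (∑-extend (λ k → u (suc k)) M≤N λ k M≤k → e (suc k) (s≤s M≤k))

  tail : Series → Series
  tail u n = u (suc n)

  ⊛-cong : ∀ {u u′ v v′} → u ≈ₛ u′ → v ≈ₛ v′ → u ⊛ v ≈ₛ u′ ⊛ v′
  ⊛-cong {u} {u′} {v} {v′} e e′ n =
    ∑-cong (suc n) (λ i → u i * v (n ∸ i)) (λ i → u′ i * v′ (n ∸ i)) λ i → *-cong (e i) (e′ (n ∸ i))

  ⊛-congʳ-≤ : ∀ u {v v′} n → (∀ m → m ≤ n → v m ≈ v′ m) → (u ⊛ v) n ≈ (u ⊛ v′) n
  ⊛-congʳ-≤ u {v} {v′} n e =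
    ∑-cong (suc n) (λ i → u i * v (n ∸ i)) (λ i → u i * v′ (n ∸ i)) λ i → *-congˡ (e (n ∸ i) (ℕ.m∸n≤m n i))

  ⊛-distribʳ : ∀ u u′ v n → ((λ i → u i + u′ i) ⊛ v) n ≈ (u ⊛ v) n + (u′ ⊛ v) n
  ⊛-distribʳ u u′ v zero = begin
    (u 0 + u′ 0) * v 0 + 0#                    ≈⟨ +-identityʳ _ ⟩
    (u 0 + u′ 0) * v 0                         ≈⟨ distribʳ _ _ _ ⟩
    u 0 * v 0 + u′ 0 * v 0                     ≈⟨ +-cong (+-identityʳ _) (+-identityʳ _) ⟨
    (u 0 * v 0 + 0#) + (u′ 0 * v 0 + 0#)       ∎
  ⊛-distribʳ u u′ v (suc n) = begin
    (u 0 + u′ 0) * v (suc n) + ((λ i → tail u i + tail u′ i) ⊛ v) n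
      ≈⟨ +-cong (distribʳ _ _ _) (⊛-distribʳ (tail u) (tail u′) v n) ⟩
    (u 0 * v (suc n) + u′ 0 * v (suc n)) + ((tail u ⊛ v) n + (tail u′ ⊛ v) n)
      ≈⟨ interchange _ _ _ _ ⟩
    (u ⊛ v) (suc n) + (u′ ⊛ v) (suc n) ∎

  ⊛-scaleˡ : ∀ x u v n → ((λ i → x * u i) ⊛ v) n ≈ x * (u ⊛ v) n
  ⊛-scaleˡ x u v n = begin
    ∑[ i < suc n ] (x * u (toℕ i) * v (n ∸ toℕ i))
      ≈⟨ ∑-cong (suc n) (λ i → x * u i * v (n ∸ i)) (λ i → x * (u i * v (n ∸ i))) (λ i → *-assoc x _ _) ⟩
    ∑[ i < suc n ] (x * (u (toℕ i) * v (n ∸ toℕ i)))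
      ≈⟨ *-distribˡ-sum {suc n} x (λ i → u (toℕ i) * v (n ∸ toℕ i)) ⟨
    x * (u ⊛ v) n                                     ∎

  ⊛-assoc : ∀ u v w → (u ⊛ v) ⊛ w ≈ₛ u ⊛ (v ⊛ w)
  ⊛-assoc u v w zero = begin
    (u 0 * v 0 + 0#) * w 0 + 0#    ≈⟨ +-congʳ (*-congʳ (+-identityʳ _)) ⟩
    u 0 * v 0 * w 0 + 0#           ≈⟨ +-congʳ (*-assoc _ _ _) ⟩
    u 0 * (v 0 * w 0) + 0#         ≈⟨ +-congʳ (*-congˡ (+-identityʳ _)) ⟨
    u 0 * (v 0 * w 0 + 0#) + 0#    ∎
  ⊛-assoc u v w (suc n) = begin
    (u 0 * v 0 + 0#) * w (suc n) + (tail (u ⊛ v) ⊛ w) n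
      ≈⟨ +-cong (trans (*-congʳ (+-identityʳ _)) (*-assoc _ _ _)) rest ⟩
    u 0 * (v 0 * w (suc n)) + (u 0 * (tail v ⊛ w) n + (tail u ⊛ (v ⊛ w)) n)
      ≈⟨ +-assoc _ _ _ ⟨
    (u 0 * (v 0 * w (suc n)) + u 0 * (tail v ⊛ w) n) + (tail u ⊛ (v ⊛ w)) n
      ≈⟨ +-congʳ (distribˡ _ _ _) ⟨
    u 0 * (v ⊛ w) (suc n) + (tail u ⊛ (v ⊛ w)) n ∎
    where
    rest : (tail (u ⊛ v) ⊛ w) n ≈ u 0 * (tail v ⊛ w) n + (tail u ⊛ (v ⊛ w)) n
    rest = trans (⊛-distribʳ (λ i → u 0 * tail v i) (tail u ⊛ v) w n)
      (+-cong (⊛-scaleˡ (u 0) (tail v) w n) (⊛-assoc (tail u) v w n))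

  -- The convolution sum, split at its last instead of its first term.
  ⊛-last : ∀ u v n → (u ⊛ v) (suc n) ≈ u (suc n) * v 0 + (u ⊛ tail v) n
  ⊛-last u v zero = begin
    u 0 * v 1 + (u 1 * v 0 + 0#)    ≈⟨ +-cong (sym (+-identityʳ _)) (+-identityʳ _) ⟩
    (u 0 * v 1 + 0#) + u 1 * v 0    ≈⟨ +-comm _ _ ⟩
    u 1 * v 0 + (u 0 * v 1 + 0#)    ∎
  ⊛-last u v (suc n) = begin
    u 0 * v (2 ℕ.+ n) + (tail u ⊛ v) (suc n)
      ≈⟨ +-congˡ (⊛-last (tail u) v n) ⟩
    u 0 * v (2 ℕ.+ n) + (u (2 ℕ.+ n) * v 0 + (tail u ⊛ tail v) n)
      ≈⟨ x∙yz≈y∙xz _ _ _ ⟩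
    u (2 ℕ.+ n) * v 0 + (u ⊛ tail v) (suc n) ∎
    where open CommutativeSemigroupProperties (Ring.+-commutativeSemigroup A) using (x∙yz≈y∙xz)

  -- Entrywise commutation.
  Commute : Series → Series → Set ℓ
  Commute u v = ∀ i j → u i * v j ≈ v j * u i

  ⊛-comm : ∀ u v → Commute u v → u ⊛ v ≈ₛ v ⊛ u
  ⊛-comm u v uv zero    = +-congʳ (uv 0 0)
  ⊛-comm u v uv (suc n) = begin
    u 0 * v (suc n) + (tail u ⊛ v) n    ≈⟨ +-cong (uv 0 (suc n)) (⊛-comm (tail u) v (λ i → uv (suc i)) n) ⟩
    v (suc n) * u 0 + (v ⊛ tail u) n    ≈⟨ ⊛-last v u n ⟨
    (v ⊛ u) (suc n)                     ∎

  ⊛-exchange : ∀ u v w → Commute u v → u ⊛ (v ⊛ w) ≈ₛ v ⊛ (u ⊛ w)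
  ⊛-exchange u v w uv n = begin
    (u ⊛ (v ⊛ w)) n    ≈⟨ ⊛-assoc u v w n ⟨
    ((u ⊛ v) ⊛ w) n    ≈⟨ ⊛-cong {v = w} (⊛-comm u v uv) (λ _ → refl) n ⟩
    ((v ⊛ u) ⊛ w) n    ≈⟨ ⊛-assoc v u w n ⟩
    (v ⊛ (u ⊛ w)) n    ∎

  ⊛-scaleʳ : (∀ r x → ι r * x ≈ x * ι r) → ∀ r u v n → (u ⊛ (λ i → ι r * v i)) n ≈ ι r * (u ⊛ v) n
  ⊛-scaleʳ central r u v n = begin
    (u ⊛ (λ i → ι r * v i)) n
      ≈⟨ ∑-cong (suc n) (λ i → u i * (ι r * v (n ∸ i))) (λ i → ι r * u i * v (n ∸ i))
           (λ i → trans (sym (*-assoc _ _ _)) (*-congʳ (sym (central r (u i))))) ⟩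
    ((λ i → ι r * u i) ⊛ v) n    ≈⟨ ⊛-scaleˡ (ι r) u v n ⟩
    ι r * (u ⊛ v) n              ∎

  ⊛-∑ʳ : (∀ r x → ι r * x ≈ x * ι r) → ∀ u N (a : ℕ → ℚ) (v : ℕ → Series) n →
         (u ⊛ (λ m → ∑[ k < N ] (ι (a (toℕ k)) * v (toℕ k) m))) n
       ≈ ∑[ k < N ] (ι (a (toℕ k)) * (u ⊛ v (toℕ k)) n)
  ⊛-∑ʳ central u zero    a v n = ∑-zero (suc n) (λ i → u i * 0#) (λ i → zeroʳ _)
  ⊛-∑ʳ central u (suc N) a v n = begin
    (u ⊛ (λ m → ι (a 0) * v 0 m + w m)) n
      ≈⟨ ∑-cong (suc n) (λ i → u i * (ι (a 0) * v 0 (n ∸ i) + w (n ∸ i)))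
           (λ i → u i * (ι (a 0) * v 0 (n ∸ i)) + u i * w (n ∸ i)) (λ i → distribˡ _ _ _) ⟩
    ∑[ i < suc n ] (u (toℕ i) * (ι (a 0) * v 0 (n ∸ toℕ i)) + u (toℕ i) * w (n ∸ toℕ i))
      ≈⟨ ∑-distrib-+ {suc n} (λ i → u (toℕ i) * (ι (a 0) * v 0 (n ∸ toℕ i))) (λ i → u (toℕ i) * w (n ∸ toℕ i)) ⟩
    (u ⊛ (λ m → ι (a 0) * v 0 m)) n + (u ⊛ w) n
      ≈⟨ +-cong (⊛-scaleʳ central (a 0) u (v 0) n) (⊛-∑ʳ central u N (λ k → a (suc k)) (λ k → v (suc k)) n) ⟩
    ∑[ k < suc N ] (ι (a (toℕ k)) * (u ⊛ v (toℕ k)) n) ∎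
    where
    w : Series
    w m = ∑[ k < N ] (ι (a (suc (toℕ k))) * v (suc (toℕ k)) m)

  oddSeries-cong : ∀ {g h} → (∀ k → g k ≈ h k) → oddSeries g ≈ₛ oddSeries h
  oddSeries-cong e zero          = refl
  oddSeries-cong e (suc zero)    = e 0
  oddSeries-cong e (suc (suc n)) = oddSeries-cong (λ k → e (suc k)) n

  oddSeries-elim : ∀ {p} (P : Carrier → Set p) → P 0# → ∀ {g} → (∀ k → P (g k)) → ∀ n → P (oddSeries g n)
  oddSeries-elim P P0 Pg zero          = P0
  oddSeries-elim P P0 Pg (suc zero)    = Pg 0
  oddSeries-elim P P0 Pg (suc (suc n)) = oddSeries-elim P P0 (λ k → Pg (suc k)) n

  power-cong : ∀ {u v} → u ≈ₛ v → ∀ k → power u k ≈ₛ power v k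
  power-cong e zero    n = refl
  power-cong e (suc k) n = ⊛-cong e (power-cong e k) n

  exp-cong : ∀ {u v} → u ≈ₛ v → exp u ≈ₛ exp v
  exp-cong {u} {v} e n = ∑-cong (suc n) (λ k → ι (1/ k !) * power u k n) (λ k → ι (1/ k !) * power v k n)
    λ k → *-congˡ (power-cong e k n)

  power-vanishes : ∀ {u} → u 0 ≈ 0# → ∀ k n → n < k → power u k n ≈ 0#
  power-vanishes {u} u₀ (suc k) zero    n<k = trans (+-identityʳ _) (trans (*-congʳ u₀) (zeroˡ _))
  power-vanishes {u} u₀ (suc k) (suc n) (s≤s n<k) = begin
    u 0 * power u k (suc n) + (tail u ⊛ power u k) n
      ≈⟨ +-cong (trans (*-congʳ u₀) (zeroˡ _))
           (⊛-congʳ-≤ (tail u) n λ m m≤n → power-vanishes u₀ k m (ℕ.≤-<-trans m≤n n<k)) ⟩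
    0# + (tail u ⊛ (λ _ → 0#)) n    ≈⟨ +-identityˡ _ ⟩
    (tail u ⊛ (λ _ → 0#)) n         ≈⟨ ∑-zero (suc n) (λ i → tail u i * 0#) (λ i → zeroʳ _) ⟩
    0#                              ∎

  -- The sum of the first N terms of the exponential.
  partialExp : ℕ → Series → Series
  partialExp N u n = ∑[ k < N ] (ι (1/ toℕ k !) * power u (toℕ k) n)

  exp≈partialExp : ∀ {u} → u 0 ≈ 0# → ∀ {N n} → n < N → exp u n ≈ partialExp N u n
  exp≈partialExp {u} u₀ {N} {n} n<N = ∑-extend (λ k → ι (1/ k !) * power u k n) n<N λ k n<k →
    trans (*-congˡ (power-vanishes u₀ k n n<k)) (zeroʳ _)

  module _ (ι-isRingHomomorphism : Morphisms.RingMorphisms.IsRingHomomorphism ℚ.+-*-rawRing rawRing ι)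
           (ι-central : ∀ r x → ι r * x ≈ x * ι r) where
    private module ι = Morphisms.RingMorphisms.IsRingHomomorphism ι-isRingHomomorphism
    open SemiringMult semiring using (_×_; ×-congʳ; ×-comm-*; ×-assoc-*; ×-homo-+)
    open Mult +-commutativeMonoid using (×-distrib-+)

    ι-× : ∀ n x → ι (+ n / 1) * x ≈ n × x
    ι-× zero    x = trans (*-congʳ ι.0#-homo) (zeroˡ x)
    ι-× (suc n) x = begin
      ι (+ suc n / 1) * x           ≈⟨ *-congʳ (ι.⟦⟧-cong (Rational.suc/1 n)) ⟨
      ι (1ℚ ℚ.+ (+ n / 1)) * x      ≈⟨ *-congʳ (ι.+-homo 1ℚ (+ n / 1)) ⟩
      (ι 1ℚ + ι (+ n / 1)) * x      ≈⟨ distribʳ _ _ _ ⟩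
      ι 1ℚ * x + ι (+ n / 1) * x    ≈⟨ +-cong (trans (*-congʳ ι.1#-homo) (*-identityˡ x)) (ι-× n x) ⟩
      x + n × x                     ∎

    ι-scale : ∀ {r s t} → r ℚ.* s ≡ t → ∀ x → ι r * (ι s * x) ≈ ι t * x
    ι-scale {r} {s} {t} e x = begin
      ι r * (ι s * x)    ≈⟨ *-assoc _ _ _ ⟨
      ι r * ι s * x      ≈⟨ *-congʳ (ι.*-homo r s) ⟨
      ι (r ℚ.* s) * x    ≈⟨ *-congʳ (ι.⟦⟧-cong e) ⟩
      ι t * x            ∎

    -- A family of additive maps, d n acting on coefficients of degree n,
    -- that makes u ↦ (n ↦ d n (u n)) a ℚ-linear derivation of series.
    record GradedDerivation : Set (c Level.⊔ ℓ) where
      field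
        d       : ℕ → Carrier → Carrier
        d-cong  : ∀ n {x y} → x ≈ y → d n x ≈ d n y
        d-0     : ∀ n → d n 0# ≈ 0#
        d-+     : ∀ n x y → d n (x + y) ≈ d n x + d n y
        d-ι     : ∀ n r x → d n (ι r * x) ≈ ι r * d n x
        d-1     : d 0 1# ≈ 0#
        leibniz : ∀ m n x y → d (m ℕ.+ n) (x * y) ≈ d m x * y + x * d n y

      ⟪_⟫ : Series → Series
      ⟪ u ⟫ n = d n (u n)

      -- With the degrees of u shifted by m, for the induction.
      ⊛-leibniz : ∀ m u v n → d (m ℕ.+ n) ((u ⊛ v) n) ≈ ((λ i → d (m ℕ.+ i) (u i)) ⊛ v) n + (u ⊛ ⟪ v ⟫) n
      ⊛-leibniz m u v zero = begin
        d (m ℕ.+ 0) (u 0 * v 0 + 0#)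
          ≈⟨ d-cong _ (+-identityʳ _) ⟩
        d (m ℕ.+ 0) (u 0 * v 0)
          ≡⟨ ≡.cong (λ k → d k (u 0 * v 0)) (ℕ.+-identityʳ (m ℕ.+ 0)) ⟨
        d (m ℕ.+ 0 ℕ.+ 0) (u 0 * v 0)
          ≈⟨ leibniz (m ℕ.+ 0) 0 (u 0) (v 0) ⟩
        d (m ℕ.+ 0) (u 0) * v 0 + u 0 * d 0 (v 0)
          ≈⟨ +-cong (+-identityʳ _) (+-identityʳ _) ⟨
        (d (m ℕ.+ 0) (u 0) * v 0 + 0#) + (u 0 * d 0 (v 0) + 0#) ∎
      ⊛-leibniz m u v (suc n) = begin
        d (m ℕ.+ suc n) (u 0 * v (suc n) + (tail u ⊛ v) n)
          ≈⟨ d-+ _ _ _ ⟩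
        d (m ℕ.+ suc n) (u 0 * v (suc n)) + d (m ℕ.+ suc n) ((tail u ⊛ v) n)
          ≈⟨ +-cong first rest ⟩
        (d (m ℕ.+ 0) (u 0) * v (suc n) + u 0 * d (suc n) (v (suc n)))
          + (((λ i → d (m ℕ.+ suc i) (u (suc i))) ⊛ v) n + (tail u ⊛ ⟪ v ⟫) n)
          ≈⟨ interchange _ _ _ _ ⟩
        ((λ i → d (m ℕ.+ i) (u i)) ⊛ v) (suc n) + (u ⊛ ⟪ v ⟫) (suc n) ∎
        where
        first : d (m ℕ.+ suc n) (u 0 * v (suc n)) ≈ d (m ℕ.+ 0) (u 0) * v (suc n) + u 0 * d (suc n) (v (suc n))
        first = trans (reflexive (≡.cong (λ k → d (k ℕ.+ suc n) (u 0 * v (suc n))) (≡.sym (ℕ.+-identityʳ m))))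
          (leibniz (m ℕ.+ 0) (suc n) (u 0) (v (suc n)))

        rest : d (m ℕ.+ suc n) ((tail u ⊛ v) n)
             ≈ ((λ i → d (m ℕ.+ suc i) (u (suc i))) ⊛ v) n + (tail u ⊛ ⟪ v ⟫) n
        rest = begin
          d (m ℕ.+ suc n) ((tail u ⊛ v) n)
            ≡⟨ ≡.cong (λ k → d k ((tail u ⊛ v) n)) (ℕ.+-suc m n) ⟩
          d (suc m ℕ.+ n) ((tail u ⊛ v) n)
            ≈⟨ ⊛-leibniz (suc m) (tail u) v n ⟩
          ((λ i → d (suc m ℕ.+ i) (tail u i)) ⊛ v) n + (tail u ⊛ ⟪ v ⟫) n
            ≈⟨ +-congʳ (⊛-cong {v = v} (λ i → reflexive (≡.cong (λ k → d k (tail u i)) (≡.sym (ℕ.+-suc m i))))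
                 (λ _ → refl) n) ⟩
          ((λ i → d (m ℕ.+ suc i) (tail u i)) ⊛ v) n + (tail u ⊛ ⟪ v ⟫) n ∎

      ⟪1⟫ : ∀ n → ⟪ 1ₛ ⟫ n ≈ 0#
      ⟪1⟫ zero    = d-1
      ⟪1⟫ (suc n) = d-0 (suc n)

      d-sum : ∀ n N (a : ℕ → ℚ) (v : ℕ → Series) →
              d n (∑[ k < N ] (ι (a (toℕ k)) * v (toℕ k) n)) ≈ ∑[ k < N ] (ι (a (toℕ k)) * d n (v (toℕ k) n))
      d-sum n zero    a v = d-0 n
      d-sum n (suc N) a v = trans (d-+ n _ _)
        (+-cong (d-ι n (a 0) (v 0 n)) (d-sum n N (λ k → a (suc k)) (λ k → v (suc k))))

      module _ (u : Series) (comm : Commute u ⟪ u ⟫) where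

        -- d(u^{k+1}) = (k + 1) du u^k.
        d-power : ∀ k n → d n (power u (suc k) n) ≈ suc k × (⟪ u ⟫ ⊛ power u k) n
        d-power zero n = begin
          d n ((u ⊛ 1ₛ) n)                              ≈⟨ ⊛-leibniz 0 u 1ₛ n ⟩
          (⟪ u ⟫ ⊛ 1ₛ) n + (u ⊛ ⟪ 1ₛ ⟫) n               ≈⟨ +-congˡ (∑-zero (suc n) (λ i → u i * ⟪ 1ₛ ⟫ (n ∸ i))
                                                              λ i → trans (*-congˡ (⟪1⟫ (n ∸ i))) (zeroʳ _)) ⟩
          (⟪ u ⟫ ⊛ 1ₛ) n + 0#                           ∎
        d-power (suc k) n = begin
          d n ((u ⊛ power u (suc k)) n)
            ≈⟨ ⊛-leibniz 0 u (power u (suc k)) n ⟩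
          (⟪ u ⟫ ⊛ power u (suc k)) n + (u ⊛ ⟪ power u (suc k) ⟫) n
            ≈⟨ +-congˡ (⊛-cong {u} (λ _ → refl) (d-power k) n) ⟩
          (⟪ u ⟫ ⊛ power u (suc k)) n + (u ⊛ (λ m → suc k × (⟪ u ⟫ ⊛ power u k) m)) n
            ≈⟨ +-congˡ (⊛-×ʳ (suc k) (⟪ u ⟫ ⊛ power u k)) ⟩
          (⟪ u ⟫ ⊛ power u (suc k)) n + suc k × (u ⊛ (⟪ u ⟫ ⊛ power u k)) n
            ≈⟨ +-congˡ (×-congʳ (suc k) (⊛-exchange u ⟪ u ⟫ (power u k) comm n)) ⟩
          (⟪ u ⟫ ⊛ power u (suc k)) n + suc k × (⟪ u ⟫ ⊛ power u (suc k)) n ∎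
          where
          ⊛-×ʳ : ∀ j w → (u ⊛ (λ m → j × w m)) n ≈ j × (u ⊛ w) n
          ⊛-×ʳ j w = begin
            (u ⊛ (λ m → j × w m)) n
              ≈⟨ ⊛-cong {u} (λ _ → refl) (λ m → sym (ι-× j (w m))) n ⟩
            (u ⊛ (λ m → ι (+ j / 1) * w m)) n
              ≈⟨ ⊛-scaleʳ ι-central (+ j / 1) u w n ⟩
            ι (+ j / 1) * (u ⊛ w) n
              ≈⟨ ι-× j _ ⟩
            j × (u ⊛ w) n ∎

        -- The differential equation d(exp u) = du · exp u.
        d-exp : u 0 ≈ 0# → ∀ n → d n (exp u n) ≈ (⟪ u ⟫ ⊛ exp u) n
        d-exp u₀ n = begin
          d n (exp u n)
            ≈⟨ d-sum n (suc n) 1/_! (power u) ⟩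
          ι (1/ 0 !) * d n (1ₛ n) + (∑[ k < n ] (ι (1/ suc (toℕ k) !) * d n (power u (suc (toℕ k)) n)))
            ≈⟨ +-cong (trans (*-congˡ (⟪1⟫ n)) (zeroʳ _)) (∑-cong n _ _ coefficient) ⟩
          0# + (∑[ k < n ] (ι (1/ toℕ k !) * (⟪ u ⟫ ⊛ power u (toℕ k)) n))
            ≈⟨ +-identityˡ _ ⟩
          ∑[ k < n ] (ι (1/ toℕ k !) * (⟪ u ⟫ ⊛ power u (toℕ k)) n)
            ≈⟨ ⊛-∑ʳ ι-central ⟪ u ⟫ n 1/_! (power u) n ⟨
          (⟪ u ⟫ ⊛ partialExp n u) n
            ≈⟨ truncate n ⟩
          (⟪ u ⟫ ⊛ exp u) n ∎
          where
          coefficient : ∀ k → ι (1/ suc k !) * d n (power u (suc k) n) ≈ ι (1/ k !) * (⟪ u ⟫ ⊛ power u k) n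
          coefficient k = begin
            ι (1/ suc k !) * d n (power u (suc k) n)                       ≈⟨ *-congˡ (d-power k n) ⟩
            ι (1/ suc k !) * (suc k × (⟪ u ⟫ ⊛ power u k) n)               ≈⟨ *-congˡ (ι-× (suc k) _) ⟨
            ι (1/ suc k !) * (ι (+ suc k / 1) * (⟪ u ⟫ ⊛ power u k) n)     ≈⟨ ι-scale (Rational.1/[1+k]! k) _ ⟩
            ι (1/ k !) * (⟪ u ⟫ ⊛ power u k) n                             ∎

          ⟪u⟫₀ : ⟪ u ⟫ 0 ≈ 0#
          ⟪u⟫₀ = trans (d-cong 0 u₀) (d-0 0)

          -- The coefficient of degree n of exp u is multiplied by zero.
          truncate : ∀ n → (⟪ u ⟫ ⊛ partialExp n u) n ≈ (⟪ u ⟫ ⊛ exp u) n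
          truncate zero    = +-congʳ (trans (trans (*-congʳ ⟪u⟫₀) (zeroˡ _)) (sym (trans (*-congʳ ⟪u⟫₀) (zeroˡ _))))
          truncate (suc n) = +-cong
            (trans (trans (*-congʳ ⟪u⟫₀) (zeroˡ _)) (sym (trans (*-congʳ ⟪u⟫₀) (zeroˡ _))))
            (⊛-congʳ-≤ (tail ⟪ u ⟫) {partialExp (suc n) u} {exp u} n
              λ m m≤n → sym (exp≈partialExp {u} u₀ (s≤s m≤n)))

    -- The Euler derivation z d/dz.
    euler : GradedDerivation
    euler = record
      { d       = _×_
      ; d-cong  = ×-congʳ
      ; d-0     = ×-zero
      ; d-+     = λ n x y → ×-distrib-+ x y n
      ; d-ι     = λ n r x → sym (×-comm-* n (ι r) x)
      ; d-1     = refl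
      ; leibniz = λ m n x y → begin
          (m ℕ.+ n) × (x * y)              ≈⟨ ×-homo-+ (x * y) m n ⟩
          m × (x * y) + n × (x * y)        ≈⟨ +-cong (×-assoc-* m x y) (×-comm-* n x y) ⟨
          (m × x) * y + x * (n × y)        ∎
      }
      where
      ×-zero : ∀ n → n × 0# ≈ 0#
      ×-zero zero    = refl
      ×-zero (suc n) = trans (+-identityˡ _) (×-zero n)

    -- The offset m makes the induction go through.
    euler-oddSeries : ∀ m g n → (m ℕ.+ n) × oddSeries g n ≈ oddSeries (λ k → (m ℕ.+ odd k) × g k) n
    euler-oddSeries m g zero          = GradedDerivation.d-0 euler (m ℕ.+ 0)
    euler-oddSeries m g (suc zero)    = refl
    euler-oddSeries m g (suc (suc n)) = begin
      (m ℕ.+ (2 ℕ.+ n)) × oddSeries g′ n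
        ≡⟨ ≡.cong (_× oddSeries g′ n) (ℕ.+-assoc m 2 n) ⟨
      (m ℕ.+ 2 ℕ.+ n) × oddSeries g′ n
        ≈⟨ euler-oddSeries (m ℕ.+ 2) g′ n ⟩
      oddSeries (λ k → (m ℕ.+ 2 ℕ.+ odd k) × g′ k) n
        ≈⟨ oddSeries-cong (λ k → reflexive (≡.cong (_× g′ k) (shift k))) n ⟩
      oddSeries (λ k → (m ℕ.+ odd (suc k)) × g′ k) n ∎
      where
      g′ : ℕ → Carrier
      g′ k = g (suc k)

      shift : ∀ k → m ℕ.+ 2 ℕ.+ odd k ≡ m ℕ.+ odd (suc k)
      shift k = ≡.trans (ℕ.+-assoc m 2 (odd k)) (≡.cong (λ j → m ℕ.+ suc j) (≡.sym (ℕ.*-suc 2 k)))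

    -- z d/dz exp(u) = (z du/dz) exp(u) for u with commuting coefficients.
    euler-exp : ∀ u → Commute u u → u 0 ≈ 0# → ∀ n → n × exp u n ≈ ((λ m → m × u m) ⊛ exp u) n
    euler-exp u uu = GradedDerivation.d-exp euler u λ i j → begin
      u i * (j × u j)      ≈⟨ ×-comm-* j (u i) (u j) ⟩
      j × (u i * u j)      ≈⟨ ×-congʳ j (uu i j) ⟩
      j × (u j * u i)      ≈⟨ ×-assoc-* j (u j) (u i) ⟨
      (j × u j) * u i      ∎

    -- An element commuting with all coefficients of u commutes with those of
    -- exp u.
    commute-exp : ∀ a u → (∀ n → a * u n ≈ u n * a) → ∀ n → a * exp u n ≈ exp u n * a
    commute-exp a u au n = commute-∑ (suc n) (λ k → ι (1/ k !) * power u k n) λ k →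
      commute-* (trans (sym (ι-central _ a)) refl) (commute-power k n)
      where
      commute-* : ∀ {x y} → a * x ≈ x * a → a * y ≈ y * a → a * (x * y) ≈ x * y * a
      commute-* {x} {y} ax ay = begin
        a * (x * y)    ≈⟨ *-assoc a x y ⟨
        a * x * y      ≈⟨ *-congʳ ax ⟩
        x * a * y      ≈⟨ *-assoc x a y ⟩
        x * (a * y)    ≈⟨ *-congˡ ay ⟩
        x * (y * a)    ≈⟨ *-assoc x y a ⟨
        x * y * a      ∎

      commute-0 : a * 0# ≈ 0# * a
      commute-0 = trans (zeroʳ a) (sym (zeroˡ a))

      commute-∑ : ∀ N (v : Series) → (∀ k → a * v k ≈ v k * a) →
                  a * (∑[ k < N ] v (toℕ k)) ≈ (∑[ k < N ] v (toℕ k)) * a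
      commute-∑ zero    v e = commute-0
      commute-∑ (suc N) v e = trans (distribˡ _ _ _)
        (trans (+-cong (e 0) (commute-∑ N (tail v) (λ k → e (suc k)))) (sym (distribʳ _ _ _)))

      commute-power : ∀ k n → a * power u k n ≈ power u k n * a
      commute-power zero    zero    = trans (*-identityʳ a) (sym (*-identityˡ a))
      commute-power zero    (suc n) = commute-0
      commute-power (suc k) n = commute-∑ (suc n) (λ i → u i * power u k (n ∸ i))
        λ i → commute-* (au i) (commute-power k (n ∸ i))

  -- A map that respects the operations of a raw ring and the images of ℚ
  -- commutes with exponentials.
  module _ (B : RawRing c′ ℓ′) (ι′ : ℚ → RawRing.Carrier B) (h : RawRing.Carrier B → Carrier)
           (h-+ : ∀ x y → h (RawRing._+_ B x y) ≈ h x + h y)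
           (h-* : ∀ x y → h (RawRing._*_ B x y) ≈ h x * h y)
           (h-0 : h (RawRing.0# B) ≈ 0#) (h-1 : h (RawRing.1# B) ≈ 1#) (h-ι : ∀ r → h (ι′ r) ≈ ι r) where
    private
      module B = RawRing B
      module B-series = PowerSeries B ι′
      open RawSemiringDefinitions B.rawSemiring using () renaming (sum to sumᴮ)

    hom-∑ : ∀ N (v : ℕ → B.Carrier) → h (sumᴮ {N} λ k → v (toℕ k)) ≈ ∑[ k < N ] h (v (toℕ k))
    hom-∑ zero    v = h-0
    hom-∑ (suc N) v = trans (h-+ _ _) (+-congˡ (hom-∑ N (λ k → v (suc k))))

    hom-power : ∀ u k n → h (B-series.power u k n) ≈ power (λ m → h (u m)) k n
    hom-power u zero    zero    = h-1
    hom-power u zero    (suc n) = h-0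
    hom-power u (suc k) n = trans (hom-∑ (suc n) (λ i → u i B.* B-series.power u k (n ∸ i)))
      (∑-cong (suc n) _ (λ i → h (u i) * power (λ m → h (u m)) k (n ∸ i))
        λ i → trans (h-* _ _) (*-congˡ (hom-power u k (n ∸ i))))

    hom-exp : ∀ u n → h (B-series.exp u n) ≈ exp (λ m → h (u m)) n
    hom-exp u n = trans (hom-∑ (suc n) (λ k → ι′ (1/ k !) B.* B-series.power u k n))
      (∑-cong (suc n) _ (λ k → ι (1/ k !) * power (λ m → h (u m)) k n)
        λ k → trans (h-* _ _) (*-cong (h-ι _) (hom-power u k n)))

    hom-oddSeries : ∀ g n → h (B-series.oddSeries g n) ≈ oddSeries (λ k → h (g k)) n
    hom-oddSeries g zero          = h-0
    hom-oddSeries g (suc zero)    = refl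
    hom-oddSeries g (suc (suc n)) = hom-oddSeries (λ k → g (suc k)) n

-- The factors of the vertex operator

-- The ring of K-linear operators on Γ.
module OperatorRing (K : CommutativeRing c ℓ) where
  open Operators K
  open Polynomials K
  private
    module R = CommutativeRing ring

  operators : Ring (c Level.⊔ ℓ) (c Level.⊔ ℓ)
  operators = record
    { RawRing operatorRing
    ; isRing = record
      { +-isAbelianGroup = record
        { isGroup = record
          { isMonoid = record
            { isSemigroup = record
              { isMagma = record
                { isEquivalence = record
                  { refl  = λ _ → refl
                  ; sym   = λ e f → sym (e f)
                  ; trans = λ e e′ f → trans (e f) (e′ f)
                  }
                ; ∙-cong = λ e e′ f → ⊕-cong (e f) (e′ f)
                }
              ; assoc = λ _ _ _ _ → ⊕-assoc _ _ _
              }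
            ; identity = (λ S f → trans (⊕-cong (R.zeroˡ f) refl) (R.+-identityˡ _))
                       , (λ S f → trans (⊕-cong refl (R.zeroˡ f)) (⊕-identityʳ _))
            }
          ; inverse = (λ S f → trans (R.-‿inverseˡ (apply S f)) (sym (R.zeroˡ f)))
                    , (λ S f → trans (⊕-inverseʳ (apply S f)) (sym (R.zeroˡ f)))
          ; ⁻¹-cong = λ e f → ⊗-cong refl (e f)
          }
        ; comm = λ _ _ _ → ⊕-comm _ _
        }
      ; *-cong = λ {S} {S′} {T} {T′} e e′ f → trans (Operator.⟦⟧-cong S (e′ f)) (e (apply T′ f))
      ; *-assoc = λ _ _ _ _ → refl
      ; *-identity = (λ S f → ⊗-identityˡ (apply S f))
                   , (λ S f → Operator.⟦⟧-cong S (⊗-identityˡ f))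
      ; distrib = (λ S T U f → Operator.+ᴹ-homo S (apply T f) (apply U f))
                , (λ _ _ _ _ → refl)
      }
    }

-- The creation and annihilation parts of Φ, over any coefficient ring K
-- with a homomorphism ι from ℚ.
module Vertex (K : CommutativeRing c ℓ) (ι : ℚ → CommutativeRing.Carrier K)
              (ι-isRingHomomorphism : Morphisms.RingMorphisms.IsRingHomomorphism
                 ℚ.+-*-rawRing (CommutativeRing.rawRing K) ι) where
  private
    module K = CommutativeRing K
    module ι = Morphisms.RingMorphisms.IsRingHomomorphism ι-isRingHomomorphism
  open Operators K
  open Polynomials K
  open OperatorRing K
  open VertexOperators K ι
  module R = CommutativeRing ring
  module O = Ring operators
  module EΓ = ExpSeries R.ring (λ r → con (ι r))
  module EO = ExpSeries operators (λ r → scalar (ι r))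
  open SetoidReasoning R.setoid
  open Mult R.+-commutativeMonoid using (_×_; ×-congʳ; ×-distrib-+)
  open SemiringMult R.semiring using (×-comm-*)

  con-isRingHomomorphism : Morphisms.RingMorphisms.IsRingHomomorphism ℚ.+-*-rawRing R.rawRing (λ r → con (ι r))
  con-isRingHomomorphism = record
    { isSemiringHomomorphism = record
      { isNearSemiringHomomorphism = record
        { +-isMonoidHomomorphism = record
          { isMagmaHomomorphism = record
            { isRelHomomorphism = record { cong = λ e → con-cong (ι.⟦⟧-cong e) }
            ; homo = λ r s → trans (con-cong (ι.+-homo r s)) (con-+ _ _)
            }
          ; ε-homo = con-cong ι.0#-homo
          }
        ; *-homo = λ r s → trans (con-cong (ι.*-homo r s)) (con-* _ _)
        }
      ; 1#-homo = con-cong ι.1#-homo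
      }
    ; -‿homo = con-neg
    }
    where
    con-neg : ∀ r → con (ι (ℚ.- r)) ≈ con (K.- K.1#) ⊗ con (ι r)
    con-neg r = begin
      con (ι (ℚ.- r))                   ≈⟨ con-cong (ι.⟦⟧-cong (≡.trans (≡.cong ℚ.-_ (≡.sym (ℚ.*-identityˡ r))) (ℚ.neg-distribˡ-* 1ℚ r))) ⟩
      con (ι (ℚ.- 1ℚ ℚ.* r))            ≈⟨ con-cong (ι.*-homo (ℚ.- 1ℚ) r) ⟩
      con (ι (ℚ.- 1ℚ) K.* ι r)          ≈⟨ con-* _ _ ⟩
      con (ι (ℚ.- 1ℚ)) ⊗ con (ι r)      ≈⟨ ⊗-cong (con-cong (K.trans (ι.-‿homo 1ℚ) (K.-‿cong ι.1#-homo))) refl ⟩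
      con (K.- K.1#) ⊗ con (ι r)        ∎

  private
    coefficient≟ : ∀ r s → Maybe (con (ι r) ≈ con (ι s))
    coefficient≟ r s with r ℚ.≟ s
    ... | yes ≡.refl = just refl
    ... | no _       = nothing

  private
    coefficients : ℚ.+-*-rawRing -Raw-AlmostCommutative⟶ fromCommutativeRing ring
    coefficients = record
      { ⟦_⟧    = λ r → con (ι r)
      ; +-homo = C.+-homo
      ; *-homo = C.*-homo
      ; -‿homo = C.-‿homo
      ; 0-homo = C.0#-homo
      ; 1-homo = C.1#-homo
      }
      where module C = Morphisms.RingMorphisms.IsRingHomomorphism con-isRingHomomorphism

  -- Polynomial identities in Γ with rational coefficients.
  module Solver = RingSolver ℚ.+-*-rawRing (fromCommutativeRing ring) coefficients coefficient≟
  open Solver using (solve; _:+_; _:*_; _:-_; :-_; _:=_) renaming (con to :con)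

  private
    ι-centralΓ : ∀ r f → con (ι r) ⊗ f ≈ f ⊗ con (ι r)
    ι-centralΓ r f = ⊗-comm _ _

    ι-centralO : ∀ r S → scalar (ι r) ∘ S ≐ S ∘ scalar (ι r)
    ι-centralO r S f = sym (Operator.*ₗ-homo S (ι r) f)

  scalar-isRingHomomorphism : Morphisms.RingMorphisms.IsRingHomomorphism
    ℚ.+-*-rawRing operatorRing (λ r → scalar (ι r))
  scalar-isRingHomomorphism = record
    { isSemiringHomomorphism = record
      { isNearSemiringHomomorphism = record
        { +-isMonoidHomomorphism = record
          { isMagmaHomomorphism = record
            { isRelHomomorphism = record { cong = λ e f → ⊗-cong (con-cong (ι.⟦⟧-cong e)) refl }
            ; homo = λ r s f → trans (⊗-cong (C.+-homo r s) refl) (R.distribʳ _ _ _)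
            }
          ; ε-homo = λ f → ⊗-cong C.0#-homo refl
          }
        ; *-homo = λ r s f → trans (⊗-cong (C.*-homo r s) refl) (⊗-assoc _ _ _)
        }
      ; 1#-homo = λ f → ⊗-cong C.1#-homo refl
      }
    ; -‿homo = λ r f → trans (⊗-cong (C.-‿homo r) refl) (⊗-assoc _ _ _)
    }
    where module C = Morphisms.RingMorphisms.IsRingHomomorphism con-isRingHomomorphism

  ι-× : ∀ n f → con (ι (+ n / 1)) ⊗ f ≈ n × f
  ι-× = EΓ.ι-× con-isRingHomomorphism ι-centralΓ

  ι-scale : ∀ {r s t} → r ℚ.* s ≡ t → ∀ f → con (ι r) ⊗ (con (ι s) ⊗ f) ≈ con (ι t) ⊗ f
  ι-scale = EΓ.ι-scale con-isRingHomomorphism ι-centralΓ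

  ×-cancel : ∀ n f → suc n × f ≈ con K.0# → f ≈ con K.0#
  ×-cancel n f e = begin
    f
      ≈⟨ trans (⊗-cong (con-cong ι.1#-homo) refl) (⊗-identityˡ f) ⟨
    con (ι 1ℚ) ⊗ f
      ≈⟨ ι-scale {+ 1 / suc n} {+ suc n / 1} (Rational./-* 1 (suc n) (suc n) 1 1 1 (ℕ.*-assoc 1 (suc n) 1)) f ⟨
    con (ι (+ 1 / suc n)) ⊗ (con (ι (+ suc n / 1)) ⊗ f)
      ≈⟨ ⊗-cong refl (trans (ι-× (suc n) f) e) ⟩
    con (ι (+ 1 / suc n)) ⊗ con K.0#
      ≈⟨ R.zeroʳ _ ⟩
    con K.0# ∎

  -- The coefficient 2 / n for n = odd k.
  β : ℕ → K.Carrier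
  β k = ι (+ 2 / odd k)

  -- The coefficients of Q(z) = exp(2 ∑ p_n z^n / n), over K.
  q : ℕ → Γ K.Carrier
  q = EΓ.exp (EΓ.oddSeries λ k → con (β k) ⊗ p k)

  extendScalars : Γ ℚ → Γ K.Carrier
  extendScalars = substitute ι p

  module Γℚ = CommutativeRing Γℚ
  extendScalars-cong : ∀ {f g} → f Γℚ.≈ g → extendScalars f ≈ extendScalars g
  extendScalars-cong = substitute-cong ℚ.+-*-commutativeRing K ι-isRingHomomorphism p

  extendScalars-q : ∀ n → extendScalars (SchurQ.q n) ≈ q n
  extendScalars-q n = trans
    (EΓ.hom-exp Γℚ.rawRing con extendScalars (λ _ _ → refl) (λ _ _ → refl)
      (con-cong ι.0#-homo) (con-cong ι.1#-homo) (λ _ → refl) _ n)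
    (EΓ.exp-cong {v = EΓ.oddSeries λ k → con (β k) ⊗ p k}
      (EΓ.hom-oddSeries Γℚ.rawRing con extendScalars (λ _ _ → refl) (λ _ _ → refl)
        (con-cong ι.0#-homo) (con-cong ι.1#-homo) (λ _ → refl) _) n)

  -- Multiplication is a homomorphism from Γ to operators, so it commutes with
  -- exponentials.
  creation≐q : ∀ n f → apply (creation β n) f ≈ q n ⊗ f
  creation≐q n f = sym (trans
    (EO.hom-exp R.rawRing (λ r → con (ι r)) multiplyBy (λ _ _ _ → R.distribʳ _ _ _) (λ _ _ _ → ⊗-assoc _ _ _)
      (λ _ → refl) (λ _ → refl) (λ _ _ → refl) (EΓ.oddSeries λ k → con (β k) ⊗ p k) n f)
    (EO.exp-cong {v = EO.oddSeries λ k → scalar (β k) ∘ a₋ k}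
      (λ m g → trans
        (EO.hom-oddSeries R.rawRing (λ r → con (ι r)) multiplyBy (λ _ _ _ → R.distribʳ _ _ _)
          (λ _ _ _ → ⊗-assoc _ _ _) (λ _ → refl) (λ _ → refl) (λ _ _ → refl) (λ k → con (β k) ⊗ p k) m g)
        (EO.oddSeries-cong {λ k → multiplyBy (con (β k) ⊗ p k)} {λ k → scalar (β k) ∘ a₋ k}
          (λ k f → ⊗-assoc _ _ _) m g)) n f))

  -- The coefficients of z^(-k) in the translation p_n ↦ p_n - z^(-n).
  T : ℕ → Operator
  T = annihilation β

  -- The operator n ∂/∂p_n, for n = odd k.
  L : ℕ → Operator
  L k = scalar (ι (+ odd k / 1)) ∘ ∂ k

  ∂-comm : ∀ j k f → apply (∂ j) (apply (∂ k) f) ≈ apply (∂ k) (apply (∂ j) f)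
  ∂-comm j k (con a) = refl
  ∂-comm j k (p i) with j ℕ.≟ i | k ℕ.≟ i
  ... | yes _ | yes _ = refl
  ... | yes _ | no _  = refl
  ... | no _  | yes _ = refl
  ... | no _  | no _  = refl
  ∂-comm j k (f ⊕ g) = ⊕-cong (∂-comm j k f) (∂-comm j k g)
  ∂-comm j k (f ⊗ g) = begin
    (derivative j (derivative k f) ⊗ g ⊕ derivative k f ⊗ derivative j g)
      ⊕ (derivative j f ⊗ derivative k g ⊕ f ⊗ derivative j (derivative k g))
      ≈⟨ ⊕-cong (⊕-comm _ _) (⊕-comm _ _) ⟩
    (derivative k f ⊗ derivative j g ⊕ derivative j (derivative k f) ⊗ g)
      ⊕ (f ⊗ derivative j (derivative k g) ⊕ derivative j f ⊗ derivative k g)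
      ≈⟨ interchange _ _ _ _ ⟩
    (derivative k f ⊗ derivative j g ⊕ f ⊗ derivative j (derivative k g))
      ⊕ (derivative j (derivative k f) ⊗ g ⊕ derivative j f ⊗ derivative k g)
      ≈⟨ ⊕-cong (⊕-cong refl (⊗-cong refl (∂-comm j k g))) (⊕-cong (⊗-cong (∂-comm j k f) refl) refl) ⟩
    (derivative k f ⊗ derivative j g ⊕ f ⊗ derivative k (derivative j g))
      ⊕ (derivative k (derivative j f) ⊗ g ⊕ derivative j f ⊗ derivative k g)
      ≈⟨ ⊕-comm _ _ ⟩
    (derivative k (derivative j f) ⊗ g ⊕ derivative j f ⊗ derivative k g)
      ⊕ (derivative k f ⊗ derivative j g ⊕ f ⊗ derivative k (derivative j g)) ∎
    where open CommutativeSemigroupProperties R.+-commutativeSemigroup using (interchange)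

  private
    -- The exponent of the translation.
    exponent : ℕ → Operator
    exponent = EO.oddSeries λ k → O.- (scalar (β k) ∘ a₊ k)

    -- A record, so that the two operators can be inferred from a proof.
    record Commuting (S U : Operator) : Set (c Level.⊔ ℓ) where
      constructor mk
      field at : S ∘ U ≐ U ∘ S
    open Commuting

    scalar-commuting : ∀ a S → Commuting (scalar a) S
    scalar-commuting a S = mk λ f → sym (Operator.*ₗ-homo S a f)

    ∘-commuting : ∀ {S U V} → Commuting S V → Commuting U V → Commuting (S ∘ U) V
    ∘-commuting {S} {U} {V} sv uv = mk λ f → trans (Operator.⟦⟧-cong S (at uv f)) (at sv (apply U f))

    commuting-sym : ∀ {S U} → Commuting S U → Commuting U S
    commuting-sym e = mk λ f → sym (at e f)

    oddSeries-commuting : ∀ {g V} → (∀ k → Commuting (g k) V) → ∀ n → Commuting (EO.oddSeries g n) V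
    oddSeries-commuting {V = V} e = EO.oddSeries-elim (λ S → Commuting S V) (scalar-commuting _ V) e

    term-commuting : ∀ k {V} → Commuting (∂ k) V → Commuting (O.- (scalar (β k) ∘ a₊ k)) V
    term-commuting k {V} e = ∘-commuting (scalar-commuting _ V)
      (∘-commuting (scalar-commuting _ V) (∘-commuting (scalar-commuting _ V) e))

    exponent-commuting : ∀ {V} → (∀ k → Commuting (∂ k) V) → ∀ n → Commuting (exponent n) V
    exponent-commuting e = oddSeries-commuting λ k → term-commuting k (e k)

    exponents-commute : ∀ m n → Commuting (exponent m) (exponent n)
    exponents-commute m n = exponent-commuting
      (λ j → commuting-sym (exponent-commuting (λ k → mk (∂-comm k j)) n)) m

    T-commuting : ∀ n {V} → (∀ i → Commuting (exponent i) V) → Commuting (T n) V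
    T-commuting n {V} e = commuting-sym (mk
      (EO.commute-exp scalar-isRingHomomorphism ι-centralO V exponent (λ i → at (commuting-sym (e i))) n))

  T-comm : ∀ m n f → apply (T m) (apply (T n) f) ≈ apply (T n) (apply (T m) f)
  T-comm m n = at (T-commuting m λ i → commuting-sym (T-commuting n λ j → exponents-commute j i))

  -- The coefficient of x^n in (∑_k A_k x^{odd k})(∑_m u_m x^m).
  oddAction : (ℕ → Operator) → (ℕ → Γ K.Carrier) → ℕ → Γ K.Carrier
  oddAction A u zero          = con K.0#
  oddAction A u (suc zero)    = apply (A 0) (u 0)
  oddAction A u (suc (suc n)) = apply (A 0) (u (suc n)) ⊕ oddAction (λ k → A (suc k)) u n

  oddAction-⊛ : ∀ A V f n → apply ((EO.oddSeries A EO.⊛ V) n) f ≈ oddAction A (λ m → apply (V m) f) n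
  oddAction-⊛ A V f zero          = trans (⊕-cong (R.zeroˡ _) (R.zeroˡ _)) (⊕-identityʳ _)
  oddAction-⊛ A V f (suc zero)    = trans (⊕-cong (R.zeroˡ _) (trans (⊕-cong refl (R.zeroˡ _)) (⊕-identityʳ _)))
    (R.+-identityˡ _)
  oddAction-⊛ A V f (suc (suc n)) = trans (⊕-cong (R.zeroˡ _) (⊕-cong refl (oddAction-⊛ (λ k → A (suc k)) V f n)))
    (R.+-identityˡ _)

  oddAction-congˡ : ∀ {A B} → (∀ k → A k ≐ B k) → ∀ u n → oddAction A u n ≈ oddAction B u n
  oddAction-congˡ e u zero          = refl
  oddAction-congˡ e u (suc zero)    = e 0 _
  oddAction-congˡ e u (suc (suc n)) = ⊕-cong (e 0 _) (oddAction-congˡ (λ k → e (suc k)) u n)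

  oddAction-zero : ∀ A u n → (∀ m → m < n → u m ≈ con K.0#) → oddAction A u n ≈ con K.0#
  oddAction-zero A u zero          e = refl
  oddAction-zero A u (suc zero)    e = trans (Operator.⟦⟧-cong (A 0) (e 0 (s≤s z≤n))) (Operator.0ᴹ-homo (A 0))
  oddAction-zero A u (suc (suc n)) e = trans
    (⊕-cong (trans (Operator.⟦⟧-cong (A 0) (e (suc n) ℕ.≤-refl)) (Operator.0ᴹ-homo (A 0)))
      (oddAction-zero (λ k → A (suc k)) u n λ m m<n → e m (ℕ.m<n⇒m<1+n (ℕ.m<n⇒m<1+n m<n))))
    (⊕-identityʳ _)

  oddAction-+ : ∀ A u v n → oddAction A (λ m → u m ⊕ v m) n ≈ oddAction A u n ⊕ oddAction A v n
  oddAction-+ A u v zero          = sym (⊕-identityʳ _)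
  oddAction-+ A u v (suc zero)    = Operator.+ᴹ-homo (A 0) _ _
  oddAction-+ A u v (suc (suc n)) = trans
    (⊕-cong (Operator.+ᴹ-homo (A 0) _ _) (oddAction-+ (λ k → A (suc k)) u v n)) (interchange _ _ _ _)
    where open CommutativeSemigroupProperties R.+-commutativeSemigroup using (interchange)

  oddAction-neg : ∀ A u n → oddAction A (λ m → R.- u m) n ≈ R.- oddAction A u n
  oddAction-neg A u zero          = sym (R.zeroʳ _)
  oddAction-neg A u (suc zero)    = Operator.*ₗ-homo (A 0) _ _
  oddAction-neg A u (suc (suc n)) = trans
    (⊕-cong (Operator.*ₗ-homo (A 0) _ _) (oddAction-neg (λ k → A (suc k)) u n)) (sym (⊗-distribˡ _ _ _))

  -- Multiplication by x.
  shift : (ℕ → Γ K.Carrier) → ℕ → Γ K.Carrier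
  shift u zero    = con K.0#
  shift u (suc n) = u n

  oddAction-shift : ∀ A u n → oddAction A (shift u) (suc n) ≈ oddAction A u n
  oddAction-shift A u zero          = Operator.0ᴹ-homo (A 0)
  oddAction-shift A u (suc zero)    = ⊕-identityʳ _
  oddAction-shift A u (suc (suc n)) = ⊕-cong refl (oddAction-shift (λ k → A (suc k)) u n)

  -- A Leibniz rule A_k g = g A_k + B_k, applied coefficientwise.
  oddAction-leibniz : ∀ A B g → (∀ k f → apply (A k) (g ⊗ f) ≈ g ⊗ apply (A k) f ⊕ apply (B k) f) →
                      ∀ u n → oddAction A (λ m → g ⊗ u m) n ≈ g ⊗ oddAction A u n ⊕ oddAction B u n
  oddAction-leibniz A B g e u zero       = sym (trans (⊕-identityʳ _) (R.zeroʳ g))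
  oddAction-leibniz A B g e u (suc zero) = e 0 (u 0)
  oddAction-leibniz A B g e u (suc (suc n)) = trans
    (⊕-cong (e 0 (u (suc n))) (oddAction-leibniz (λ k → A (suc k)) (λ k → B (suc k)) g (λ k → e (suc k)) u n))
    (solve 5 (λ g a b x y → (g :* a :+ b) :+ (g :* x :+ y) := g :* (a :+ x) :+ (b :+ y)) refl _ _ _ _ _)

  -- The derivation x d/dx + ∑_k L_k x^{odd k} of power series over Γ. It
  -- annihilates the translates ∑ x^n T_n f, where x = z⁻¹.
  ∇ : (ℕ → Γ K.Carrier) → ℕ → Γ K.Carrier
  ∇ u n = n × u n ⊕ oddAction L u n

  ∇-T : ∀ f n → ∇ (λ m → apply (T m) f) n ≈ con K.0#
  ∇-T f n = begin
    n × apply (T n) f ⊕ oddAction L (λ m → apply (T m) f) n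
      ≈⟨ ⊕-cong euler-T refl ⟩
    R.- oddAction L (λ m → apply (T m) f) n ⊕ oddAction L (λ m → apply (T m) f) n
      ≈⟨ R.-‿inverseˡ _ ⟩
    con K.0# ∎
    where
    open Mult O.+-commutativeMonoid using () renaming (_×_ to _×ₒ_)

    2·n·1≡1·[n·2] : ∀ n → 2 ℕ.* n ℕ.* 1 ≡ 1 ℕ.* (n ℕ.* 2)
    2·n·1≡1·[n·2] n = ≡.trans (ℕ.*-identityʳ _) (≡.trans (ℕ.*-comm 2 n) (≡.sym (ℕ.*-identityˡ _)))

    ×ₒ-apply : ∀ n S g → apply (n ×ₒ S) g ≈ n × apply S g
    ×ₒ-apply zero    S g = R.zeroˡ g
    ×ₒ-apply (suc n) S g = ⊕-cong refl (×ₒ-apply n S g)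

    term : ∀ k → odd k ×ₒ (O.- (scalar (β k) ∘ a₊ k)) ≐ O.- L k
    term k g = begin
      apply (odd k ×ₒ (O.- (scalar (β k) ∘ a₊ k))) g
        ≈⟨ ×ₒ-apply (odd k) (O.- (scalar (β k) ∘ a₊ k)) g ⟩
      odd k × (R.- (con (β k) ⊗ (con (ι (+ odd k / 2)) ⊗ apply (∂ k) g)))
        ≈⟨ ×-congʳ (odd k) (⊗-cong refl (trans (ι-scale {t = 1ℚ} (Rational./-* 2 (odd k) (odd k) 2 1 1 (2·n·1≡1·[n·2] (odd k))) _)
             (trans (⊗-cong (con-cong ι.1#-homo) refl) (⊗-identityˡ _)))) ⟩
      odd k × (R.- apply (∂ k) g)
        ≈⟨ ι-× (odd k) _ ⟨
      con (ι (+ odd k / 1)) ⊗ (R.- apply (∂ k) g)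
        ≈⟨ x∙yz≈y∙xz _ _ _ ⟩
      R.- (con (ι (+ odd k / 1)) ⊗ apply (∂ k) g) ∎
      where open CommutativeSemigroupProperties R.*-commutativeSemigroup using (x∙yz≈y∙xz)

    oddAction-negˡ : ∀ A u n → oddAction (λ k → O.- A k) u n ≈ R.- oddAction A u n
    oddAction-negˡ A u zero          = sym (R.zeroʳ _)
    oddAction-negˡ A u (suc zero)    = refl
    oddAction-negˡ A u (suc (suc n)) = trans (⊕-cong refl (oddAction-negˡ (λ k → A (suc k)) u n))
      (sym (⊗-distribˡ _ _ _))

    euler-T : n × apply (T n) f ≈ R.- oddAction L (λ m → apply (T m) f) n
    euler-T = begin
      n × apply (T n) f
        ≈⟨ ×ₒ-apply n (T n) f ⟨
      apply (n ×ₒ T n) f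
        ≈⟨ EO.euler-exp scalar-isRingHomomorphism ι-centralO exponent (λ i j → at (exponents-commute i j))
             (λ _ → refl) n f ⟩
      apply (((λ m → m ×ₒ exponent m) EO.⊛ T) n) f
        ≈⟨ EO.⊛-cong {λ m → m ×ₒ exponent m} {EO.oddSeries λ k → O.- L k} {T} {T} (λ m g → trans
             (EO.euler-oddSeries scalar-isRingHomomorphism ι-centralO 0 (λ k → O.- (scalar (β k) ∘ a₊ k)) m g)
             (EO.oddSeries-cong {h = λ k → O.- L k} term m g)) (λ _ _ → refl) n f ⟩
      apply ((EO.oddSeries (λ k → O.- L k) EO.⊛ T) n) f
        ≈⟨ oddAction-⊛ (λ k → O.- L k) T f n ⟩
      oddAction (λ k → O.- L k) (λ m → apply (T m) f) n
        ≈⟨ oddAction-negˡ L (λ m → apply (T m) f) n ⟩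
      R.- oddAction L (λ m → apply (T m) f) n ∎

  -- The sequence q extended by zero to negative indices.
  qℤ : ℤ → Γ K.Carrier
  qℤ (+ n)    = q n
  qℤ -[1+ n ] = con K.0#

  -- ∂Q(z)/∂p_n = (2/n) z^n Q(z) for n = odd j.
  ∂-q : ∀ j n → derivative j (q n) ≈ con (β j) ⊗ qℤ (n ℤ.⊖ odd j)
  ∂-q j n = trans
    (EΓ.GradedDerivation.d-exp ∂Γ exponentΓ (λ _ _ → ⊗-comm _ _) refl n)
    (trans (EΓ.⊛-cong {EΓ.GradedDerivation.⟪_⟫ ∂Γ exponentΓ} {EΓ.oddSeries λ k → con (β k) ⊗ δ j k} {q} {q}
             (λ m → trans (∂-oddSeries m (λ k → con (β k) ⊗ p k)) (EΓ.oddSeries-cong {h = λ k → con (β k) ⊗ δ j k} ∂-term m))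
             (λ _ → refl) n)
      (trans (select j n (λ k → con (β k) ⊗ δ j k) off-diagonal) (⊗-cong diagonal refl)))
    where
    exponentΓ : ℕ → Γ K.Carrier
    exponentΓ = EΓ.oddSeries λ k → con (β k) ⊗ p k

    δ : ℕ → ℕ → Γ K.Carrier
    δ j k = derivative j (p k)

    ∂Γ : EΓ.GradedDerivation con-isRingHomomorphism ι-centralΓ
    ∂Γ = record
      { d       = λ _ → derivative j
      ; d-cong  = λ _ → Operator.⟦⟧-cong (∂ j)
      ; d-0     = λ _ → refl
      ; d-+     = λ _ _ _ → refl
      ; d-ι     = λ _ r f → Operator.*ₗ-homo (∂ j) (ι r) f
      ; d-1     = refl
      ; leibniz = λ _ _ _ _ → refl
      }

    ∂-oddSeries : ∀ m g → derivative j (EΓ.oddSeries g m) ≈ EΓ.oddSeries (λ k → derivative j (g k)) m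
    ∂-oddSeries zero          g = refl
    ∂-oddSeries (suc zero)    g = refl
    ∂-oddSeries (suc (suc m)) g = ∂-oddSeries m (λ k → g (suc k))

    ∂-term : ∀ k → derivative j (con (β k) ⊗ p k) ≈ con (β k) ⊗ δ j k
    ∂-term k = Operator.*ₗ-homo (∂ j) (β k) (p k)

    off-diagonal : ∀ k → k ≢ j → con (β k) ⊗ δ j k ≈ con K.0#
    off-diagonal k k≢j with j ℕ.≟ k
    ... | yes j≡k = contradiction (≡.sym j≡k) k≢j
    ... | no _    = R.zeroʳ _

    diagonal : con (β j) ⊗ δ j j ≈ con (β j)
    diagonal with j ℕ.≟ j
    ... | yes _  = R.*-identityʳ _
    ... | no j≢j = contradiction ≡.refl j≢j

    ⊖-shift : ∀ n i → n ℤ.⊖ odd i ≡ suc (suc n) ℤ.⊖ odd (suc i)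
    ⊖-shift n i = ≡.trans (≡.sym (≡.trans (ℤ.[1+m]⊖[1+n]≡m⊖n (suc n) (suc (odd i))) (ℤ.[1+m]⊖[1+n]≡m⊖n n (odd i))))
      (≡.cong (λ m → suc (suc n) ℤ.⊖ suc m) (≡.sym (ℕ.*-suc 2 i)))

    -- A convolution with a series of which only the term of degree odd i
    -- is nonzero.
    select : ∀ i n g → (∀ k → k ≢ i → g k ≈ con K.0#) → (EΓ.oddSeries g EΓ.⊛ q) n ≈ g i ⊗ qℤ (n ℤ.⊖ odd i)
    select i       zero          g e = trans (⊕-cong (R.zeroˡ _) refl) (trans (⊕-identityʳ _) (sym (R.zeroʳ _)))
    select zero    (suc zero)    g e = trans (⊕-cong (R.zeroˡ _) (⊕-identityʳ _)) (R.+-identityˡ _)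
    select (suc i) (suc zero)    g e = trans
      (⊕-cong (R.zeroˡ _) (trans (⊕-identityʳ _) (trans (⊗-cong (e 0 λ ()) refl) (R.zeroˡ _))))
      (trans (R.+-identityˡ _) (sym (R.zeroʳ _)))
    select zero    (suc (suc n)) g e = trans
      (⊕-cong (R.zeroˡ _) (⊕-cong refl (EΓ.∑-zero (suc n) (λ m → EΓ.oddSeries (λ k → g (suc k)) m ⊗ q (n ∸ m)) λ m → trans (⊗-cong
        (EΓ.oddSeries-elim (_≈ con K.0#) refl (λ k → e (suc k) λ ()) m) refl) (R.zeroˡ _))))
      (trans (R.+-identityˡ _) (⊕-identityʳ _))
    select (suc i) (suc (suc n)) g e = trans
      (⊕-cong (R.zeroˡ _) (⊕-cong (trans (⊗-cong (e 0 λ ()) refl) (R.zeroˡ _))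
        (select i n (λ k → g (suc k)) λ k k≢i → e (suc k) λ e′ → k≢i (ℕ.suc-injective e′))))
      (trans (R.+-identityˡ _) (trans (R.+-identityˡ _) (⊗-cong refl (R.reflexive (≡.cong qℤ (⊖-shift n i))))))

  -- The Leibniz rule for n ∂/∂p_n, n = odd k, on a multiple of q_s.
  L-q : ∀ s k f → apply (L k) (qℤ s ⊗ f) ≈ qℤ s ⊗ apply (L k) f ⊕ con (ι (+ 2 / 1)) ⊗ qℤ (s ℤ.- + odd k) ⊗ f
  L-q s k f = begin
    con (ι (+ odd k / 1)) ⊗ (derivative k (qℤ s) ⊗ f ⊕ qℤ s ⊗ derivative k f)
      ≈⟨ solve 5 (λ a d f q d′ → a :* (d :* f :+ q :* d′) := q :* (a :* d′) :+ (a :* d) :* f) refl _ _ _ _ _ ⟩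
    qℤ s ⊗ apply (L k) f ⊕ (con (ι (+ odd k / 1)) ⊗ derivative k (qℤ s)) ⊗ f
      ≈⟨ ⊕-cong refl (⊗-cong (go s) refl) ⟩
    qℤ s ⊗ apply (L k) f ⊕ con (ι (+ 2 / 1)) ⊗ qℤ (s ℤ.- + odd k) ⊗ f ∎
    where
    n·2·1≡2·[1·n] : ∀ n → n ℕ.* 2 ℕ.* 1 ≡ 2 ℕ.* (1 ℕ.* n)
    n·2·1≡2·[1·n] n = ≡.trans (ℕ.*-identityʳ _) (≡.trans (ℕ.*-comm n 2) (≡.cong (2 ℕ.*_) (≡.sym (ℕ.*-identityˡ n))))

    go : ∀ s → con (ι (+ odd k / 1)) ⊗ derivative k (qℤ s) ≈ con (ι (+ 2 / 1)) ⊗ qℤ (s ℤ.- + odd k)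
    go (+ n)    = trans (⊗-cong refl (∂-q k n)) (trans
      (ι-scale {+ odd k / 1} {+ 2 / odd k} (Rational./-* (odd k) 1 2 (odd k) 2 1 (n·2·1≡2·[1·n] (odd k))) _)
      (⊗-cong refl (R.reflexive (≡.cong qℤ (≡.sym (ℤ.m-n≡m⊖n n (odd k)))))))
    go -[1+ n ] = trans (R.zeroʳ _) (sym (R.zeroʳ _))

  -- The exchange relation T-q of T(z) with Q(w), applied to g, for operators T
  -- and elements q_s satisfying the differential equations above. With x = z⁻¹,
  -- let u and y be the series T(z) Q(w) g and Q(w) T(z) g in x and w. The series
  -- H = (1 + x w) u - (1 - x w) y has constant term zero in x and satisfies
  -- (1 + x w) ∇ H = x w H. Comparing coefficients of x successively, H = 0.
  module Translation
    (T : ℕ → Operator) (qℤ : ℤ → Γ K.Carrier)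
    (T₀ : ∀ f → apply (T 0) f ≈ f)
    (∇-T : ∀ f n → ∇ (λ m → apply (T m) f) n ≈ con K.0#)
    (L-q : ∀ s k f → apply (L k) (qℤ s ⊗ f) ≈ qℤ s ⊗ apply (L k) f ⊕ con (ι (+ 2 / 1)) ⊗ qℤ (s ℤ.- + odd k) ⊗ f)
    (g : Γ K.Carrier) where

    -- The commutator of n ∂/∂p_n with multiplication by q_s, for n = odd k.
    [L,q] : ℤ → ℕ → Operator
    [L,q] s k = multiplyBy (con (ι (+ 2 / 1)) ⊗ qℤ (s ℤ.- + odd k))

    [L,q]-shift : ∀ s k → [L,q] s (suc k) ≐ [L,q] (ℤ.pred (ℤ.pred s)) k
    [L,q]-shift s k f = ⊗-cong (⊗-cong refl (R.reflexive (≡.cong qℤ index))) refl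
      where
      index : s ℤ.- + odd (suc k) ≡ ℤ.pred (ℤ.pred s) ℤ.- + odd k
      index = ≡.trans (≡.cong (λ m → s ℤ.- + suc m) (ℕ.*-suc 2 k))
        (ℤS.solve 2 (λ s m → s ℤS.:- (ℤS.con (+ 2) ℤS.:+ m) ℤS.:= (ℤS.con ℤ.-1ℤ ℤS.:+ (ℤS.con ℤ.-1ℤ ℤS.:+ s)) ℤS.:- m)
          ≡.refl s (+ odd k))

    [L,q]-zero : ∀ s → [L,q] s 0 ≐ multiplyBy (con (ι (+ 2 / 1)) ⊗ qℤ (ℤ.pred s))
    [L,q]-zero s f = ⊗-cong (⊗-cong refl (R.reflexive (≡.cong qℤ (ℤ.+-comm s ℤ.-1ℤ)))) refl

    -- In u s k and the others, s is the exponent of w and k that of x.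
    u y a b : ℤ → ℕ → Γ K.Carrier
    u s k = apply (T k) (qℤ s ⊗ g)
    y s k = qℤ s ⊗ apply (T k) g
    a s k = u s k R.- y s k
    b s k = u s k ⊕ y s k

    H : ℤ → ℕ → Γ K.Carrier
    H s k = a s k ⊕ shift (b (ℤ.pred s)) k

    -- ∇ y, which is the commutator of ∇ with Q(w), applied to T(z) g.
    ω : ℤ → ℕ → Γ K.Carrier
    ω s = oddAction ([L,q] s) (λ m → apply (T m) g)

    ∇-+ : ∀ v v′ n → ∇ (λ m → v m ⊕ v′ m) n ≈ ∇ v n ⊕ ∇ v′ n
    ∇-+ v v′ n = trans (⊕-cong (×-distrib-+ (v n) (v′ n) n) (oddAction-+ L v v′ n))
      (CommutativeSemigroupProperties.interchange R.+-commutativeSemigroup _ _ _ _)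

    ∇-neg : ∀ v n → ∇ (λ m → R.- v m) n ≈ R.- ∇ v n
    ∇-neg v n = trans (⊕-cong (sym (×-comm-* n (con (K.- K.1#)) (v n))) (oddAction-neg L v n))
      (sym (⊗-distribˡ _ _ _))

    ∇-shift : ∀ v n → ∇ (shift v) (suc n) ≈ v n ⊕ ∇ v n
    ∇-shift v n = trans (⊕-cong refl (oddAction-shift L v n)) (⊕-assoc _ _ _)

    ∇-y : ∀ s n → ∇ (y s) n ≈ ω s n
    ∇-y s n = begin
      n × y s n ⊕ oddAction L (y s) n
        ≈⟨ ⊕-cong (sym (×-comm-* n (qℤ s) _)) (oddAction-leibniz L ([L,q] s) (qℤ s) (L-q s) (λ m → apply (T m) g) n) ⟩
      qℤ s ⊗ (n × apply (T n) g) ⊕ (qℤ s ⊗ oddAction L (λ m → apply (T m) g) n ⊕ ω s n)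
        ≈⟨ ⊕-assoc _ _ _ ⟨
      (qℤ s ⊗ (n × apply (T n) g) ⊕ qℤ s ⊗ oddAction L (λ m → apply (T m) g) n) ⊕ ω s n
        ≈⟨ ⊕-cong (⊗-distribˡ _ _ _) refl ⟨
      qℤ s ⊗ ∇ (λ m → apply (T m) g) n ⊕ ω s n
        ≈⟨ ⊕-cong (trans (⊗-cong refl (∇-T g n)) (R.zeroʳ _)) refl ⟩
      con K.0# ⊕ ω s n
        ≈⟨ R.+-identityˡ _ ⟩
      ω s n ∎

    ∇-a : ∀ s n → ∇ (a s) n ≈ R.- ω s n
    ∇-a s n = begin
      ∇ (a s) n                             ≈⟨ ∇-+ (u s) (λ m → R.- y s m) n ⟩
      ∇ (u s) n ⊕ ∇ (λ m → R.- y s m) n     ≈⟨ ⊕-cong (∇-T (qℤ s ⊗ g) n) (trans (∇-neg (y s) n) (⊗-cong refl (∇-y s n))) ⟩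
      con K.0# ⊕ (R.- ω s n)                ≈⟨ R.+-identityˡ _ ⟩
      R.- ω s n                             ∎

    ∇-b : ∀ s n → ∇ (b s) n ≈ ω s n
    ∇-b s n = trans (∇-+ (u s) (y s) n) (trans (⊕-cong (∇-T (qℤ s ⊗ g) n) (∇-y s n)) (R.+-identityˡ _))

    ∇-H₁ : ∀ s n → ∇ (H s) (suc n) ≈ R.- ω s (suc n) ⊕ (b (ℤ.pred s) n ⊕ ω (ℤ.pred s) n)
    ∇-H₁ s n = trans (∇-+ (a s) (shift (b (ℤ.pred s))) (suc n))
      (⊕-cong (∇-a s (suc n)) (trans (∇-shift (b (ℤ.pred s)) n) (⊕-cong refl (∇-b (ℤ.pred s) n))))

    ω₁ : ∀ s → ω s 1 ≈ con (ι (+ 2 / 1)) ⊗ y (ℤ.pred s) 0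
    ω₁ s = trans ([L,q]-zero s _) (⊗-assoc _ _ _)

    ω₂ : ∀ s n → ω s (suc (suc n)) ≈ con (ι (+ 2 / 1)) ⊗ y (ℤ.pred s) (suc n) ⊕ ω (ℤ.pred (ℤ.pred s)) n
    ω₂ s n = ⊕-cong (trans ([L,q]-zero s _) (⊗-assoc _ _ _)) (oddAction-congˡ ([L,q]-shift s) _ n)

    private
      combine₀ : ∀ y u → (R.- (con (ι (+ 2 / 1)) ⊗ y)) ⊕ ((u ⊕ y) ⊕ con K.0#)
                       ≈ ((u R.- y) ⊕ con K.0#) R.- (con K.0# ⊕ con K.0#)
      combine₀ y u = trans (⊕-cong refl (⊕-identityʳ _)) (trans
        (solve 2 (λ y u → (:- (:con (+ 2 / 1) :* y)) :+ (u :+ y) := u :- y) refl y u)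
        (sym (trans (⊕-cong (⊕-identityʳ _) (trans (⊗-cong refl (⊕-identityʳ _)) (R.zeroʳ _))) (⊕-identityʳ _))))

      combine : ∀ y u w″ ω b → (R.- (con (ι (+ 2 / 1)) ⊗ y ⊕ w″)) ⊕ ((u ⊕ y) ⊕ ω)
                             ≈ ((u R.- y) ⊕ b) R.- ((R.- ω) ⊕ (b ⊕ w″))
      combine = solve 5 (λ y u w″ ω b → (:- (:con (+ 2 / 1) :* y :+ w″)) :+ ((u :+ y) :+ ω)
        := ((u :- y) :+ b) :- ((:- ω) :+ (b :+ w″))) refl

    -- The coefficients of (1 + x w) ∇ H = x w H.
    ∇-H : ∀ s n → ∇ (H s) (suc n) ≈ H (ℤ.pred s) n R.- ∇ (H (ℤ.pred s)) n
    ∇-H s zero = begin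
      ∇ (H s) 1
        ≈⟨ trans (∇-H₁ s 0) (⊕-cong (⊗-cong refl (ω₁ s)) refl) ⟩
      (R.- (con (ι (+ 2 / 1)) ⊗ y s′ 0)) ⊕ ((u s′ 0 ⊕ y s′ 0) ⊕ con K.0#)
        ≈⟨ combine₀ (y s′ 0) (u s′ 0) ⟩
      ((u s′ 0 R.- y s′ 0) ⊕ con K.0#) R.- (con K.0# ⊕ con K.0#) ∎
      where s′ = ℤ.pred s
    ∇-H s (suc n) = begin
      ∇ (H s) (suc (suc n))
        ≈⟨ trans (∇-H₁ s (suc n)) (⊕-cong (⊗-cong refl (ω₂ s n)) refl) ⟩
      (R.- (con (ι (+ 2 / 1)) ⊗ y s′ (suc n) ⊕ ω s″ n)) ⊕ ((u s′ (suc n) ⊕ y s′ (suc n)) ⊕ ω s′ (suc n))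
        ≈⟨ combine (y s′ (suc n)) (u s′ (suc n)) (ω s″ n) (ω s′ (suc n)) (b s″ n) ⟩
      H s′ (suc n) R.- (R.- ω s′ (suc n) ⊕ (b s″ n ⊕ ω s″ n))
        ≈⟨ ⊕-cong refl (⊗-cong refl (∇-H₁ s′ n)) ⟨
      H s′ (suc n) R.- ∇ (H s′) (suc n) ∎
      where
      s′ = ℤ.pred s
      s″ = ℤ.pred s′

    H-vanishes : ∀ k → (∀ m → m ≤ k → ∀ s → H s m ≈ con K.0#) Product.× (∀ s → ∇ (H s) k ≈ con K.0#)
    H-vanishes zero = (λ { zero z≤n s → H₀ s }) , λ _ → ⊕-identityʳ _
      where
      H₀ : ∀ s → H s 0 ≈ con K.0#
      H₀ s = trans (⊕-identityʳ _) (trans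
        (⊕-cong (trans (T₀ _) (⊗-cong refl (sym (T₀ g)))) refl) (⊕-inverseʳ _))
    H-vanishes (suc k) with H-vanishes k
    ... | H≈0 , ∇H≈0 = below , ∇H≈0′
      where
      ∇H≈0′ : ∀ s → ∇ (H s) (suc k) ≈ con K.0#
      ∇H≈0′ s = trans (∇-H s k) (trans (⊕-cong (H≈0 k ℕ.≤-refl _) (⊗-cong refl (∇H≈0 _))) (⊕-inverseʳ _))

      top : ∀ s → H s (suc k) ≈ con K.0#
      top s = ×-cancel k _ (begin
        suc k × H s (suc k)
          ≈⟨ ⊕-identityʳ _ ⟨
        suc k × H s (suc k) ⊕ con K.0#
          ≈⟨ ⊕-cong refl (oddAction-zero L (H s) (suc k) λ { m (s≤s m≤k) → H≈0 m m≤k s }) ⟨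
        ∇ (H s) (suc k)
          ≈⟨ ∇H≈0′ s ⟩
        con K.0# ∎)

      below : ∀ m → m ≤ suc k → ∀ s → H s m ≈ con K.0#
      below m m≤1+k s with m ℕ.≟ suc k
      ... | yes ≡.refl = top s
      ... | no m≢1+k   = H≈0 m (ℕ.≤-pred (ℕ.≤∧≢⇒< m≤1+k m≢1+k)) s

    -- (1 + w/z) T(z) Q(w) = (1 - w/z) Q(w) T(z).
    T-q : ∀ s k → apply (T (suc k)) (qℤ s ⊗ g) ⊕ apply (T k) (qℤ (ℤ.pred s) ⊗ g)
                ≈ qℤ s ⊗ apply (T (suc k)) g R.- qℤ (ℤ.pred s) ⊗ apply (T k) g
    T-q s k = begin
      u s (suc k) ⊕ u s′ k
        ≈⟨ solve 4 (λ u y u′ y′ → u :+ u′ := ((u :- y) :+ (u′ :+ y′)) :+ (y :- y′)) refl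
             (u s (suc k)) (y s (suc k)) (u s′ k) (y s′ k) ⟩
      H s (suc k) ⊕ (y s (suc k) R.- y s′ k)
        ≈⟨ ⊕-cong (proj₁ (H-vanishes (suc k)) (suc k) ℕ.≤-refl s) refl ⟩
      con K.0# ⊕ (y s (suc k) R.- y s′ k)
        ≈⟨ R.+-identityˡ _ ⟩
      y s (suc k) R.- y s′ k ∎
      where s′ = ℤ.pred s

-- The exchange relations and the alternating expansions

-- P n holds for all sufficiently large n.
Eventually : ∀ {p} → (ℕ → Set p) → Set p
Eventually P = Product.∃ λ N → ∀ n → N ≤ n → P n

eventually-map : ∀ {p q} {P : ℕ → Set p} {Q : ℕ → Set q} → (∀ n → P n → Q n) → Eventually P → Eventually Q
eventually-map f (N , e) = N , λ n N≤n → f n (e n N≤n)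

eventually-zip : ∀ {p q} {P : ℕ → Set p} {Q : ℕ → Set q} →
                 Eventually P → Eventually Q → Eventually (λ n → P n Product.× Q n)
eventually-zip (M , e) (N , e′) = M ℕ.⊔ N , λ n M⊔N≤n →
  e n (ℕ.≤-trans (ℕ.m≤m⊔n M N) M⊔N≤n) , e′ n (ℕ.≤-trans (ℕ.m≤n⊔m M N) M⊔N≤n)

witness : ∀ {p} {P : ℕ → Set p} (e : Eventually P) → P (proj₁ e)
witness (N , e) = e N ℕ.≤-refl

module AlternatingSum (K : CommutativeRing c ℓ) where
  private module K = CommutativeRing K
  open Polynomials K
  open Operators K
  private module R = CommutativeRing ring
  open SetoidReasoning R.setoid
  open CommutativeSemigroupProperties R.+-commutativeSemigroup using (interchange; x∙yz≈y∙xz)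

  private
    variable
      a : Level
      A : Set a

  -- ∑_i (-1)^i h(x_i, l without x_i) for l = x_0, x_1, …
  alt : (A → List A → Γ K.Carrier) → List A → Γ K.Carrier
  alt h []      = con K.0#
  alt h (x ∷ l) = h x l R.- alt (λ y l′ → h y (x ∷ l′)) l

  alt-cong-length : ∀ {h h′ : A → List A → Γ K.Carrier} l →
                    (∀ y l′ → suc (length l′) ≡ length l → h y l′ ≈ h′ y l′) → alt h l ≈ alt h′ l
  alt-cong-length []      e = refl
  alt-cong-length (x ∷ l) e = ⊕-cong (e x l ≡.refl)
    (⊗-cong refl (alt-cong-length l λ y l′ eq → e y (x ∷ l′) (≡.cong suc eq)))

  alt-cong : ∀ {h h′ : A → List A → Γ K.Carrier} → (∀ y l′ → h y l′ ≈ h′ y l′) → ∀ l → alt h l ≈ alt h′ l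
  alt-cong e l = alt-cong-length l λ y l′ _ → e y l′

  alt-zero : ∀ (l : List A) → alt (λ _ _ → con K.0#) l ≈ con K.0#
  alt-zero []      = refl
  alt-zero (x ∷ l) = trans (⊕-cong refl (trans (⊗-cong refl (alt-zero l)) (R.zeroʳ _))) (⊕-identityʳ _)

  alt-+ : ∀ (h h′ : A → List A → Γ K.Carrier) l → alt (λ y l′ → h y l′ ⊕ h′ y l′) l ≈ alt h l ⊕ alt h′ l
  alt-+ h h′ []      = sym (⊕-identityʳ _)
  alt-+ h h′ (x ∷ l) = trans
    (⊕-cong refl (trans (⊗-cong refl (alt-+ (λ y l′ → h y (x ∷ l′)) (λ y l′ → h′ y (x ∷ l′)) l)) (⊗-distribˡ _ _ _)))
    (interchange _ _ _ _)

  alt-operator : ∀ S (h : A → List A → Γ K.Carrier) l → apply S (alt h l) ≈ alt (λ y l′ → apply S (h y l′)) l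
  alt-operator S h []      = Operator.0ᴹ-homo S
  alt-operator S h (x ∷ l) = trans (Operator.+ᴹ-homo S _ _) (⊕-cong refl (trans (Operator.*ₗ-homo S _ _)
    (⊗-cong refl (alt-operator S (λ y l′ → h y (x ∷ l′)) l))))

  -- Removing x and y in either order leaves the same sequence, with opposite
  -- signs.
  alt-antisymmetric : ∀ (h : A → A → List A → Γ K.Carrier) l →
    alt (λ x l′ → alt (λ y l″ → h x y l″) l′) l ≈ R.- alt (λ x l′ → alt (λ y l″ → h y x l″) l′) l
  alt-antisymmetric h []      = sym (R.zeroʳ _)
  alt-antisymmetric {A = A} h (z ∷ l) = begin
    alt (h z) l R.- alt (λ x l′ → h x z l′ R.- alt (λ y l″ → h x y (z ∷ l″)) l′) l
      ≈⟨ expand h ⟩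
    (alt (h z) l R.- alt (λ x l′ → h x z l′) l) ⊕ alt (λ x l′ → alt (λ y l″ → h x y (z ∷ l″)) l′) l
      ≈⟨ ⊕-cong (trans (⊕-comm _ _) (⊕-cong refl (sym (neg-neg _)))) (alt-antisymmetric (λ x y l″ → h x y (z ∷ l″)) l) ⟩
    (R.- alt (λ x l′ → h x z l′) l R.- (R.- alt (h z) l)) ⊕ (R.- alt (λ x l′ → alt (λ y l″ → h y x (z ∷ l″)) l′) l)
      ≈⟨ ⊕-cong (⊗-distribˡ _ _ _) refl ⟨
    R.- (alt (λ x l′ → h x z l′) l R.- alt (h z) l) R.- alt (λ x l′ → alt (λ y l″ → h y x (z ∷ l″)) l′) l
      ≈⟨ ⊗-distribˡ _ _ _ ⟨
    R.- ((alt (λ x l′ → h x z l′) l R.- alt (h z) l) ⊕ alt (λ x l′ → alt (λ y l″ → h y x (z ∷ l″)) l′) l)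
      ≈⟨ ⊗-cong refl (expand (λ x y → h y x)) ⟨
    R.- alt (λ x l′ → alt (λ y l″ → h y x l″) l′) (z ∷ l) ∎
    where
    neg-neg : ∀ f → R.- (R.- f) ≈ f
    neg-neg = AbelianGroupProperties.⁻¹-involutive R.+-abelianGroup

    expand : ∀ (h : A → A → List A → Γ K.Carrier) →
      alt (λ x l′ → alt (λ y l″ → h x y l″) l′) (z ∷ l)
        ≈ (alt (h z) l R.- alt (λ x l′ → h x z l′) l) ⊕ alt (λ x l′ → alt (λ y l″ → h x y (z ∷ l″)) l′) l
    expand h = begin
      alt (h z) l R.- alt (λ x l′ → h x z l′ R.- g x l′) l
        ≈⟨ ⊕-cong refl (⊗-cong refl (trans (alt-+ (λ x l′ → h x z l′) (λ x l′ → R.- g x l′) l)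
             (⊕-cong refl (sym (alt-operator (multiplyBy (con (K.- K.1#))) g l))))) ⟩
      alt (h z) l R.- (alt (λ x l′ → h x z l′) l R.- alt g l)
        ≈⟨ ⊕-cong refl (⊗-distribˡ _ _ _) ⟩
      alt (h z) l ⊕ (R.- alt (λ x l′ → h x z l′) l R.- (R.- alt g l))
        ≈⟨ ⊕-assoc _ _ _ ⟨
      (alt (h z) l R.- alt (λ x l′ → h x z l′) l) R.- (R.- alt g l)
        ≈⟨ ⊕-cong refl (neg-neg _) ⟩
      (alt (h z) l R.- alt (λ x l′ → h x z l′) l) ⊕ alt g l ∎
      where
      g : A → List A → Γ K.Carrier
      g x l′ = alt (λ y l″ → h x y (z ∷ l″)) l′

  alt-eventually : ∀ {h : A → List A → Γ K.Carrier} {h′ : ℕ → A → List A → Γ K.Carrier} →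
    (∀ y l′ → Eventually λ n → h y l′ ≈ h′ n y l′) → ∀ l → Eventually λ n → alt h l ≈ alt (h′ n) l
  alt-eventually e []      = 0 , λ _ _ → refl
  alt-eventually e (x ∷ l) = eventually-map (λ n (e₁ , e₂) → ⊕-cong e₁ (⊗-cong refl e₂))
    (eventually-zip (e x l) (alt-eventually (λ y l′ → e y (x ∷ l′)) l))

  alt-map : ∀ {b} {B : Set b} (f : B → A) (h : A → List A → Γ K.Carrier) l →
            alt h (map f l) ≈ alt (λ y l′ → h (f y) (map f l′)) l
  alt-map f h []      = refl
  alt-map f h (x ∷ l) = ⊕-cong refl (⊗-cong refl (alt-map f (λ y l′ → h y (f x ∷ l′)) l))

module Wick (K : CommutativeRing c ℓ) (ι : ℚ → CommutativeRing.Carrier K)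
            (ι-isRingHomomorphism : Morphisms.RingMorphisms.IsRingHomomorphism
               ℚ.+-*-rawRing (CommutativeRing.rawRing K) ι) where
  private module K = CommutativeRing K
  open Operators K
  open Polynomials K
  open Vertex K ι ι-isRingHomomorphism using (module Solver; module R)
  open Solver using (solve; _:+_; _:*_; _:-_; :-_; _:=_) renaming (con to :con)
  open AlternatingSum K
  open SetoidReasoning R.setoid

  -- The sum of u 0, …, u (n - 1).
  ∑< : ℕ → (ℕ → Γ K.Carrier) → Γ K.Carrier
  ∑< zero    u = con K.0#
  ∑< (suc n) u = u 0 ⊕ ∑< n (λ k → u (suc k))

  ∑-cong : ∀ n {u v : ℕ → Γ K.Carrier} → (∀ k → u k ≈ v k) → ∑< n u ≈ ∑< n v
  ∑-cong zero    e = refl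
  ∑-cong (suc n) e = ⊕-cong (e 0) (∑-cong n λ k → e (suc k))

  ∑-operator : ∀ V n (u : ℕ → Γ K.Carrier) → apply V (∑< n u) ≈ ∑< n (λ k → apply V (u k))
  ∑-operator V zero    u = Operator.0ᴹ-homo V
  ∑-operator V (suc n) u = trans (Operator.+ᴹ-homo V _ _) (⊕-cong refl (∑-operator V n λ k → u (suc k)))

  ∑-+ : ∀ n (u v : ℕ → Γ K.Carrier) → ∑< n (λ k → u k ⊕ v k) ≈ ∑< n u ⊕ ∑< n v
  ∑-+ zero    u v = sym (⊕-identityʳ _)
  ∑-+ (suc n) u v = trans (⊕-cong refl (∑-+ n (λ k → u (suc k)) (λ k → v (suc k))))
    (CommutativeSemigroupProperties.interchange R.+-commutativeSemigroup _ _ _ _)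

  ∑-extend : ∀ {m n} (u : ℕ → Γ K.Carrier) → m ≤ n → (∀ k → m ≤ k → u k ≈ con K.0#) → ∑< m u ≈ ∑< n u
  ∑-extend {n = zero}  u z≤n e = refl
  ∑-extend {n = suc n} u z≤n e = sym (trans (⊕-cong (e 0 z≤n) (sym (∑-extend (λ k → u (suc k)) z≤n λ k _ → e (suc k) z≤n))) (⊕-identityʳ _))
  ∑-extend u (s≤s m≤n) e = ⊕-cong refl (∑-extend (λ k → u (suc k)) m≤n λ k m≤k → e (suc k) (s≤s m≤k))

  -- The expansions for operators Φ_r = ∑_k q_{r+k} T_k on Γ, of which only the
  -- exchange relation of T with q, the commutation of the T_k, T_0 = 1 and the
  -- values T_k 1 are used.
  module Expansion
    (T : ℕ → Operator) (q : ℤ → Γ K.Carrier) (Φ : ℤ → Operator)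
    (T₀ : ∀ f → apply (T 0) f ≈ f)
    (T₁ : ∀ k → apply (T (suc k)) (con K.1#) ≈ con K.0#)
    (T-comm : ∀ j k f → apply (T j) (apply (T k) f) ≈ apply (T k) (apply (T j) f))
    (T-q : ∀ s k g → apply (T (suc k)) (q s ⊗ g) ⊕ apply (T k) (q (ℤ.pred s) ⊗ g)
                   ≈ q s ⊗ apply (T (suc k)) g R.- q (ℤ.pred s) ⊗ apply (T k) g)
    (Φ-sum : ∀ r f → Eventually λ n → apply (Φ r) f ≈ ∑< n (λ k → q (r ℤ.+ + k) ⊗ apply (T k) f))
    where

    module Φ r = Operator (Φ r)
    module T k = Operator (T k)

    -- The sum ∑ q_{r+k} u_k over k < n.
    S : ℤ → ℕ → (ℕ → Γ K.Carrier) → Γ K.Carrier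
    S r n u = ∑< n (λ k → q (r ℤ.+ + k) ⊗ u k)

    S-cong : ∀ r n {u v} → (∀ k → u k ≈ v k) → S r n u ≈ S r n v
    S-cong r n e = ∑-cong n λ k → ⊗-cong refl (e k)

    S-+ : ∀ r n u v → S r n (λ k → u k ⊕ v k) ≈ S r n u ⊕ S r n v
    S-+ r n u v = trans (∑-cong n λ k → ⊗-distribˡ _ _ _) (∑-+ n _ _)

    S-⊗ : ∀ r n g u → S r n (λ k → g ⊗ u k) ≈ g ⊗ S r n u
    S-⊗ r n g u = trans (∑-cong n λ k → x∙yz≈y∙xz _ _ _) (sym (∑-operator (multiplyBy g) n _))
      where open CommutativeSemigroupProperties R.*-commutativeSemigroup using (x∙yz≈y∙xz)

    pred-+ : ∀ r k → ℤ.pred r ℤ.+ k ≡ ℤ.pred (r ℤ.+ k)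
    pred-+ r k = ℤ.+-assoc ℤ.-1ℤ r k

    S-shift : ∀ r n u → S (ℤ.pred r) (suc n) (λ { zero → con K.0# ; (suc k) → u k }) ≈ S r n u
    S-shift r n u = trans (⊕-cong (R.zeroʳ _) refl) (trans (R.+-identityˡ _)
      (∑-cong n λ k → ⊗-cong (R.reflexive (≡.cong q (index k))) refl))
      where
      index : ∀ k → ℤ.pred r ℤ.+ + suc k ≡ r ℤ.+ + k
      index k = ℤS.solve 2 (λ r k → (ℤS.con ℤ.-1ℤ ℤS.:+ r) ℤS.:+ (ℤS.con (+ 1) ℤS.:+ k) ℤS.:= r ℤS.:+ k) ≡.refl r (+ k)

    -- The sequence T_0 f, T_1 f, ….
    T• : Γ K.Carrier → ℕ → Γ K.Carrier
    T• f k = apply (T k) f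

    -- (z + w) Φ(z) Q(w) = (z - w) Q(w) Φ(z).
    Φ-q : ∀ r s g → apply (Φ (ℤ.pred r)) (q s ⊗ g) ⊕ apply (Φ r) (q (ℤ.pred s) ⊗ g)
                  ≈ q s ⊗ apply (Φ (ℤ.pred r)) g R.- q (ℤ.pred s) ⊗ apply (Φ r) g
    Φ-q r s g = go (witness (eventually-zip
        (eventually-zip (Φ-sum′ (q s ⊗ g)) (Φ-sum r (q s′ ⊗ g)))
        (eventually-zip (Φ-sum′ g) (Φ-sum r g))))
      where
      r′ = ℤ.pred r
      s′ = ℤ.pred s

      Φ-sum′ : ∀ f → Eventually λ n → apply (Φ r′) f ≈ S r′ (suc n) (T• f)
      Φ-sum′ f with Φ-sum r′ f
      ... | N , e = N , λ n N≤n → e (suc n) (ℕ.m≤n⇒m≤1+n N≤n)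

      shift : (ℕ → Γ K.Carrier) → ℕ → Γ K.Carrier
      shift u = λ { zero → con K.0# ; (suc k) → u k }

      coefficient : ∀ k → T• (q s ⊗ g) k ⊕ shift (T• (q s′ ⊗ g)) k
                        ≈ q s ⊗ T• g k ⊕ (R.- q s′) ⊗ shift (T• g) k
      coefficient zero    = ⊕-cong (trans (T₀ _) (⊗-cong refl (sym (T₀ g)))) (sym (R.zeroʳ _))
      coefficient (suc k) = trans (T-q s k g) (⊕-cong refl (sym (⊗-assoc _ _ _)))

      go : ∀ {n} → (apply (Φ r′) (q s ⊗ g) ≈ S r′ (suc n) (T• (q s ⊗ g)) Product.×
                    apply (Φ r) (q s′ ⊗ g) ≈ S r n (T• (q s′ ⊗ g))) Product.×
                   (apply (Φ r′) g ≈ S r′ (suc n) (T• g) Product.× apply (Φ r) g ≈ S r n (T• g)) →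
           apply (Φ r′) (q s ⊗ g) ⊕ apply (Φ r) (q s′ ⊗ g) ≈ q s ⊗ apply (Φ r′) g R.- q s′ ⊗ apply (Φ r) g
      go {n} ((e₁ , e₂) , (e₃ , e₄)) = begin
        apply (Φ r′) (q s ⊗ g) ⊕ apply (Φ r) (q s′ ⊗ g)
          ≈⟨ ⊕-cong e₁ (trans e₂ (sym (S-shift r n _))) ⟩
        S r′ (suc n) (T• (q s ⊗ g)) ⊕ S r′ (suc n) (shift (T• (q s′ ⊗ g)))
          ≈⟨ S-+ r′ (suc n) (T• (q s ⊗ g)) (shift (T• (q s′ ⊗ g))) ⟨
        S r′ (suc n) (λ k → T• (q s ⊗ g) k ⊕ shift (T• (q s′ ⊗ g)) k)
          ≈⟨ S-cong r′ (suc n) coefficient ⟩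
        S r′ (suc n) (λ k → q s ⊗ T• g k ⊕ (R.- q s′) ⊗ shift (T• g) k)
          ≈⟨ S-+ r′ (suc n) (λ k → q s ⊗ T• g k) (λ k → (R.- q s′) ⊗ shift (T• g) k) ⟩
        S r′ (suc n) (λ k → q s ⊗ T• g k) ⊕ S r′ (suc n) (λ k → (R.- q s′) ⊗ shift (T• g) k)
          ≈⟨ ⊕-cong (S-⊗ r′ (suc n) (q s) (T• g)) (S-⊗ r′ (suc n) (R.- q s′) (shift (T• g))) ⟩
        q s ⊗ S r′ (suc n) (T• g) ⊕ (R.- q s′) ⊗ S r′ (suc n) (shift (T• g))
          ≈⟨ ⊕-cong (⊗-cong refl (sym e₃)) (trans (⊗-cong refl (trans (S-shift r n _) (sym e₄))) (⊗-assoc _ _ _)) ⟩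
        q s ⊗ apply (Φ r′) g R.- q s′ ⊗ apply (Φ r) g ∎

    -- (z + w) T(z) Φ(w) = (z - w) Φ(w) T(z).
    T-Φ : ∀ k r g → apply (T (suc k)) (apply (Φ r) g) ⊕ apply (T k) (apply (Φ (ℤ.pred r)) g)
                  ≈ apply (Φ r) (apply (T (suc k)) g) R.- apply (Φ (ℤ.pred r)) (apply (T k) g)
    T-Φ k r g = go (witness (eventually-zip
        (eventually-zip (Φ-sum r g) (Φ-sum r′ g))
        (eventually-zip (Φ-sum r (T• g (suc k))) (Φ-sum r′ (T• g k)))))
      where
      r′ = ℤ.pred r

      coefficient : ∀ j → apply (T (suc k)) (q (r ℤ.+ + j) ⊗ T• g j) ⊕ apply (T k) (q (r′ ℤ.+ + j) ⊗ T• g j)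
                        ≈ q (r ℤ.+ + j) ⊗ T• (T• g (suc k)) j R.- q (r′ ℤ.+ + j) ⊗ T• (T• g k) j
      coefficient j = begin
        apply (T (suc k)) (q m ⊗ T• g j) ⊕ apply (T k) (q (r′ ℤ.+ + j) ⊗ T• g j)
          ≡⟨ ≡.cong (λ i → apply (T (suc k)) (q m ⊗ T• g j) ⊕ apply (T k) (q i ⊗ T• g j)) (pred-+ r (+ j)) ⟩
        apply (T (suc k)) (q m ⊗ T• g j) ⊕ apply (T k) (q (ℤ.pred m) ⊗ T• g j)
          ≈⟨ T-q m k (T• g j) ⟩
        q m ⊗ T• (T• g j) (suc k) R.- q (ℤ.pred m) ⊗ T• (T• g j) k
          ≈⟨ ⊕-cong (⊗-cong refl (T-comm (suc k) j g)) (⊗-cong refl (⊗-cong refl (T-comm k j g))) ⟩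
        q m ⊗ T• (T• g (suc k)) j R.- q (ℤ.pred m) ⊗ T• (T• g k) j
          ≡⟨ ≡.cong (λ i → q m ⊗ T• (T• g (suc k)) j R.- q i ⊗ T• (T• g k) j) (pred-+ r (+ j)) ⟨
        q m ⊗ T• (T• g (suc k)) j R.- q (r′ ℤ.+ + j) ⊗ T• (T• g k) j ∎
        where m = r ℤ.+ + j

      go : ∀ {n} → (apply (Φ r) g ≈ S r n (T• g) Product.× apply (Φ r′) g ≈ S r′ n (T• g)) Product.×
                   (apply (Φ r) (T• g (suc k)) ≈ S r n (T• (T• g (suc k))) Product.×
                    apply (Φ r′) (T• g k) ≈ S r′ n (T• (T• g k))) →
           apply (T (suc k)) (apply (Φ r) g) ⊕ apply (T k) (apply (Φ r′) g)
             ≈ apply (Φ r) (T• g (suc k)) R.- apply (Φ r′) (T• g k)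
      go {n} ((e₁ , e₂) , (e₃ , e₄)) = begin
        apply (T (suc k)) (apply (Φ r) g) ⊕ apply (T k) (apply (Φ r′) g)
          ≈⟨ ⊕-cong (trans (T.⟦⟧-cong (suc k) e₁) (∑-operator (T (suc k)) n (λ j → q (r ℤ.+ + j) ⊗ T• g j)))
                    (trans (T.⟦⟧-cong k e₂) (∑-operator (T k) n (λ j → q (r′ ℤ.+ + j) ⊗ T• g j))) ⟩
        ∑< n (λ j → apply (T (suc k)) (q (r ℤ.+ + j) ⊗ T• g j))
          ⊕ ∑< n (λ j → apply (T k) (q (r′ ℤ.+ + j) ⊗ T• g j))
          ≈⟨ ∑-+ n (λ j → apply (T (suc k)) (q (r ℤ.+ + j) ⊗ T• g j))
                   (λ j → apply (T k) (q (r′ ℤ.+ + j) ⊗ T• g j)) ⟨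
        ∑< n (λ j → apply (T (suc k)) (q (r ℤ.+ + j) ⊗ T• g j)
                     ⊕ apply (T k) (q (r′ ℤ.+ + j) ⊗ T• g j))
          ≈⟨ ∑-cong n coefficient ⟩
        ∑< n (λ j → q (r ℤ.+ + j) ⊗ T• (T• g (suc k)) j R.- q (r′ ℤ.+ + j) ⊗ T• (T• g k) j)
          ≈⟨ ∑-+ n (λ j → q (r ℤ.+ + j) ⊗ T• (T• g (suc k)) j) (λ j → R.- (q (r′ ℤ.+ + j) ⊗ T• (T• g k) j)) ⟩
        S r n (T• (T• g (suc k))) ⊕ ∑< n (λ j → R.- (q (r′ ℤ.+ + j) ⊗ T• (T• g k) j))
          ≈⟨ ⊕-cong (sym e₃) (trans (sym (∑-operator (multiplyBy (con (K.- K.1#))) n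
               (λ j → q (r′ ℤ.+ + j) ⊗ T• (T• g k) j))) (⊗-cong refl (sym e₄))) ⟩
        apply (Φ r) (T• g (suc k)) R.- apply (Φ r′) (T• g k) ∎

    -- The coefficient of z^(-k) w^s in (z - w)/(z + w) Q(w), expanded in w/z.
    κ : ℕ → ℤ → Γ K.Carrier
    κ zero          s = q s
    κ (suc zero)    s = R.- (con (ι (+ 2 / 1)) ⊗ q (ℤ.pred s))
    κ (suc (suc k)) s = R.- κ (suc k) (ℤ.pred s)

    private
      2Γ : Γ K.Carrier
      2Γ = con (ι (+ 2 / 1))

    -- With F = (z - w)/(z + w) Q(w), the exchange relation Φ-q implies
    --   (z - u) Φ(u) F + (z + u) F Φ(u) = (z + u) Φ(u) Q(w) + (z - u) Q(w) Φ(u).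
    -- The lemmas Φ-κ₀ and Φ-κ compare the coefficients of z^0 and z^(-k-1).
    Φ-κ₀ : ∀ r s g → apply (Φ r) (κ 1 s ⊗ g) ⊕ κ 1 s ⊗ apply (Φ r) g
                   ≈ 2Γ ⊗ (apply (Φ (ℤ.pred r)) (q s ⊗ g) R.- q s ⊗ apply (Φ (ℤ.pred r)) g)
    Φ-κ₀ r s g = begin
      apply (Φ r) (κ 1 s ⊗ g) ⊕ κ 1 s ⊗ x
        ≈⟨ ⊕-cong pull refl ⟩
      (R.- (2Γ ⊗ b)) ⊕ (R.- (2Γ ⊗ q′)) ⊗ x
        ≈⟨ solve 5 (λ a b q′ x y → (:- (:con (+ 2 / 1) :* b)) :+ (:- (:con (+ 2 / 1) :* q′)) :* x
             := :con (+ 2 / 1) :* (a :- (a :+ b) :- q′ :* x)) refl a b q′ x x ⟩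
      2Γ ⊗ (a R.- (a ⊕ b) R.- q′ ⊗ x)
        ≈⟨ ⊗-cong refl (⊕-cong (⊕-cong refl (⊗-cong refl (Φ-q r s g))) refl) ⟩
      2Γ ⊗ (a R.- (y R.- q′ ⊗ x) R.- q′ ⊗ x)
        ≈⟨ ⊗-cong refl (solve 4 (λ a y q′ x → a :- (y :- q′ :* x) :- q′ :* x := a :- y) refl a y q′ x) ⟩
      2Γ ⊗ (a R.- y) ∎
      where
      q′ = q (ℤ.pred s)
      a = apply (Φ (ℤ.pred r)) (q s ⊗ g)
      b = apply (Φ r) (q′ ⊗ g)
      x = apply (Φ r) g
      y = q s ⊗ apply (Φ (ℤ.pred r)) g

      pull : apply (Φ r) (κ 1 s ⊗ g) ≈ R.- (2Γ ⊗ b)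
      pull = begin
        apply (Φ r) ((R.- (2Γ ⊗ q′)) ⊗ g)   ≈⟨ Φ.⟦⟧-cong r (trans (⊗-assoc _ _ _) (⊗-cong refl (⊗-assoc _ _ _))) ⟩
        apply (Φ r) (R.- (2Γ ⊗ (q′ ⊗ g)))   ≈⟨ Φ.*ₗ-homo r _ _ ⟩
        R.- apply (Φ r) (2Γ ⊗ (q′ ⊗ g))     ≈⟨ ⊗-cong refl (Φ.*ₗ-homo r _ _) ⟩
        R.- (2Γ ⊗ b)                        ∎

    private
      Φ-neg : ∀ r f g → apply (Φ r) ((R.- f) ⊗ g) ≈ R.- apply (Φ r) (f ⊗ g)
      Φ-neg r f g = trans (Φ.⟦⟧-cong r (⊗-assoc _ _ _)) (Φ.*ₗ-homo r _ _)

      negate : ∀ r f g → apply (Φ r) ((R.- f) ⊗ g) ⊕ (R.- f) ⊗ apply (Φ r) g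
                       ≈ R.- (apply (Φ r) (f ⊗ g) ⊕ f ⊗ apply (Φ r) g)
      negate r f g = trans (⊕-cong (Φ-neg r f g) (⊗-assoc _ _ _)) (sym (⊗-distribˡ _ _ _))

    Φ-κ : ∀ k r s g → apply (Φ r) (κ (2 ℕ.+ k) s ⊗ g) ⊕ κ (2 ℕ.+ k) s ⊗ apply (Φ r) g
                    ≈ apply (Φ (ℤ.pred r)) (κ (suc k) s ⊗ g) R.- κ (suc k) s ⊗ apply (Φ (ℤ.pred r)) g
    Φ-κ zero r s g = begin
      apply (Φ r) (κ 2 s ⊗ g) ⊕ κ 2 s ⊗ apply (Φ r) g
        ≈⟨ trans (negate r (κ 1 s′) g) (⊗-cong refl (Φ-κ₀ r s′ g)) ⟩
      R.- (2Γ ⊗ (apply (Φ r′) (q s′ ⊗ g) R.- q s′ ⊗ apply (Φ r′) g))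
        ≈⟨ solve 3 (λ a y x → :- (:con (+ 2 / 1) :* (a :- y :* x))
             := (:- (:con (+ 2 / 1) :* a)) :- (:- (:con (+ 2 / 1) :* y)) :* x) refl _ _ _ ⟩
      R.- (2Γ ⊗ apply (Φ r′) (q s′ ⊗ g)) R.- κ 1 s ⊗ apply (Φ r′) g
        ≈⟨ ⊕-cong (trans (⊗-cong refl (sym (trans (Φ.⟦⟧-cong r′ (⊗-assoc _ _ _)) (Φ.*ₗ-homo r′ _ _))))
             (sym (Φ-neg r′ _ g))) refl ⟩
      apply (Φ r′) (κ 1 s ⊗ g) R.- κ 1 s ⊗ apply (Φ r′) g ∎
      where
      r′ = ℤ.pred r
      s′ = ℤ.pred s
    Φ-κ (suc k) r s g = begin
      apply (Φ r) (κ (3 ℕ.+ k) s ⊗ g) ⊕ κ (3 ℕ.+ k) s ⊗ apply (Φ r) g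
        ≈⟨ trans (negate r (κ (2 ℕ.+ k) s′) g) (⊗-cong refl (Φ-κ k r s′ g)) ⟩
      R.- (apply (Φ r′) (κ (suc k) s′ ⊗ g) R.- κ (suc k) s′ ⊗ apply (Φ r′) g)
        ≈⟨ solve 3 (λ a y x → :- (a :- y :* x) := (:- a) :- (:- y) :* x) refl _ _ _ ⟩
      R.- apply (Φ r′) (κ (suc k) s′ ⊗ g) R.- κ (2 ℕ.+ k) s ⊗ apply (Φ r′) g
        ≈⟨ ⊕-cong (sym (Φ-neg r′ _ g)) refl ⟩
      apply (Φ r′) (κ (2 ℕ.+ k) s ⊗ g) R.- κ (2 ℕ.+ k) s ⊗ apply (Φ r′) g ∎
      where
      r′ = ℤ.pred r
      s′ = ℤ.pred s

    -- X(r₁, …, r_n) = Φ_{r₁} ⋯ Φ_{r_n} 1.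
    X : List ℤ → Γ K.Carrier
    X = foldr (λ r → apply (Φ r)) (con K.1#)

    -- Indicators of even and odd numbers, and of zero.
    e o d : ℕ → K.Carrier
    e zero    = K.1#
    e (suc n) = o n
    o zero    = K.0#
    o (suc n) = e n
    d zero    = K.1#
    d (suc n) = K.0#

    e+o : ∀ n → con (e n) ⊕ con (o n) ≈ con K.1#
    e+o zero    = ⊕-identityʳ _
    e+o (suc n) = trans (⊕-comm _ _) (e+o n)

    e²-o² : ∀ n → (con (e n) ⊗ con (e n) ≈ con (e n)) Product.× (con (o n) ⊗ con (o n) ≈ con (o n))
    e²-o² zero    = ⊗-identityˡ _ , R.zeroˡ _
    e²-o² (suc n) = Product.swap (e²-o² n)

    -- alt(q_s X(l′)) is X(l) or 0 as the length n of l is odd or even.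
    QExpansion : ℕ → Set _
    QExpansion n = ∀ l → length l ≡ n → alt (λ s l′ → q s ⊗ X l′) l ≈ con (o n) ⊗ X l

    -- T_k X(l) = alt(κ_k(s) X(l′)), plus X(l) if k = 0 and the length n of l is
    -- even.
    TExpansion : ℕ → Set _
    TExpansion n = ∀ l → length l ≡ n → ∀ k →
      apply (T k) (X l) ≈ con (e n) ⊗ (con (d k) ⊗ X l) ⊕ alt (λ s l′ → κ k s ⊗ X l′) l

    alt-⊗ : ∀ f (h : ℤ → List ℤ → Γ K.Carrier) l → alt (λ s l′ → f ⊗ h s l′) l ≈ f ⊗ alt h l
    alt-⊗ f h l = sym (alt-operator (multiplyBy f) h l)

    alt-minus : ∀ (h h′ : ℤ → List ℤ → Γ K.Carrier) l → alt (λ s l′ → h s l′ R.- h′ s l′) l ≈ alt h l R.- alt h′ l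
    alt-minus h h′ l = trans (alt-+ h (λ s l′ → R.- h′ s l′) l) (⊕-cong refl (alt-⊗ _ h′ l))

    alt-S : ∀ r n (u : ℤ → List ℤ → ℕ → Γ K.Carrier) l →
            alt (λ s l′ → S r n (u s l′)) l ≈ S r n (λ k → alt (λ s l′ → u s l′ k) l)
    alt-S r n u l = trans (go n (λ k s l′ → q (r ℤ.+ + k) ⊗ u s l′ k))
      (∑-cong n λ k → alt-⊗ (q (r ℤ.+ + k)) (λ s l′ → u s l′ k) l)
      where
      go : ∀ n (v : ℕ → ℤ → List ℤ → Γ K.Carrier) →
           alt (λ s l′ → ∑< n (λ k → v k s l′)) l ≈ ∑< n (λ k → alt (v k) l)
      go zero    v = alt-zero l
      go (suc n) v = trans (alt-+ (v 0) (λ s l′ → ∑< n (λ k → v (suc k) s l′)) l)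
        (⊕-cong refl (go n λ k → v (suc k)))

    S-zero : ∀ r n → S r n (λ _ → con K.0#) ≈ con K.0#
    S-zero r n = trans (S-cong r n {v = λ _ → con K.0# ⊗ con K.0#} λ _ → sym (R.zeroˡ _))
      (trans (S-⊗ r n (con K.0#) (λ _ → con K.0#)) (R.zeroˡ _))

    S-d : ∀ r n f → S r (suc n) (λ k → con (d k) ⊗ f) ≈ q r ⊗ f
    S-d r n f = trans (⊕-cong (⊗-cong (R.reflexive (≡.cong q (ℤ.+-identityʳ r))) (⊗-identityˡ f))
      (trans (∑-cong n {v = λ _ → con K.0#} λ k → trans (⊗-cong refl (R.zeroˡ f)) (R.zeroʳ _)) (∑-zero n))) (⊕-identityʳ _)
      where
      ∑-zero : ∀ n → ∑< n (λ _ → con K.0#) ≈ con K.0#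
      ∑-zero zero    = refl
      ∑-zero (suc n) = trans (R.+-identityˡ _) (∑-zero n)

    -- The expansions in length n + 1, from those in lengths n and n - 1.
    module Step (n : ℕ) (q-expansion : QExpansion n) (T-expansion : TExpansion n)
                (q-expansion⁻ : ∀ m → suc m ≡ n → QExpansion m) (T-expansion⁻ : ∀ m → suc m ≡ n → TExpansion m) where

      -- The identity to be proved for the sequence r, l is
      --   q_r X(l) - alt(q_s Φ_r X(l′)) - e_n Φ_r X(l) = 0.
      -- Its left side is the coefficient of z^r in Q(z) ∑ B_k z^(-k).
      B : List ℤ → ℕ → Γ K.Carrier
      B l k = con (d k) ⊗ X l R.- alt (λ s l′ → q s ⊗ apply (T k) (X l′)) l R.- con (e n) ⊗ apply (T k) (X l)

      B≈0 : ∀ l → length l ≡ n → ∀ k → B l k ≈ con K.0#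
      B≈0 l |l|≡n k = begin
        d′ ⊗ x R.- alt (λ s l′ → q s ⊗ apply (T k) (X l′)) l R.- e′ ⊗ apply (T k) (X l)
          ≈⟨ ⊕-cong (⊕-cong refl (⊗-cong refl middle)) (⊗-cong refl (⊗-cong refl (T-expansion l |l|≡n k))) ⟩
        d′ ⊗ x R.- (o′ ⊗ (d′ ⊗ (o′ ⊗ x)) R.- e′ ⊗ a) R.- e′ ⊗ (e′ ⊗ (d′ ⊗ x) ⊕ a)
          ≈⟨ solve 5 (λ d x o e a → d :* x :- (o :* (d :* (o :* x)) :- e :* a) :- e :* (e :* (d :* x) :+ a)
               := d :* x :- (e :* e :+ o :* o) :* (d :* x)) refl d′ x o′ e′ a ⟩
        d′ ⊗ x R.- (e′ ⊗ e′ ⊕ o′ ⊗ o′) ⊗ (d′ ⊗ x)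
          ≈⟨ ⊕-cong refl (⊗-cong refl (trans (⊗-cong (trans (⊕-cong (proj₁ (e²-o² n)) (proj₂ (e²-o² n))) (e+o n)) refl)
               (⊗-identityˡ _))) ⟩
        d′ ⊗ x R.- d′ ⊗ x
          ≈⟨ ⊕-inverseʳ _ ⟩
        con K.0# ∎
        where
        d′ = con (d k)
        e′ = con (e n)
        o′ = con (o n)
        x = X l
        a = alt (λ s l′ → κ k s ⊗ X l′) l

        -- Here e (n - 1) = o n.
        translate : ∀ s l′ → suc (length l′) ≡ length l →
          q s ⊗ apply (T k) (X l′)
            ≈ o′ ⊗ (d′ ⊗ (q s ⊗ X l′)) ⊕ alt (λ s′ l″ → q s ⊗ (κ k s′ ⊗ X l″)) l′
        translate s l′ eq = begin
          q s ⊗ apply (T k) (X l′)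
            ≈⟨ ⊗-cong refl (T-expansion⁻ (length l′) |l′| l′ ≡.refl k) ⟩
          q s ⊗ (con (e (length l′)) ⊗ (d′ ⊗ X l′) ⊕ alt (λ s′ l″ → κ k s′ ⊗ X l″) l′)
            ≡⟨ ≡.cong (λ m → q s ⊗ (con (o m) ⊗ (d′ ⊗ X l′) ⊕ alt (λ s′ l″ → κ k s′ ⊗ X l″) l′)) |l′| ⟩
          q s ⊗ (o′ ⊗ (d′ ⊗ X l′) ⊕ alt (λ s′ l″ → κ k s′ ⊗ X l″) l′)
            ≈⟨ solve 5 (λ q o d x a → q :* (o :* (d :* x) :+ a) := o :* (d :* (q :* x)) :+ q :* a) refl
                 (q s) o′ d′ (X l′) _ ⟩
          o′ ⊗ (d′ ⊗ (q s ⊗ X l′)) ⊕ q s ⊗ alt (λ s′ l″ → κ k s′ ⊗ X l″) l′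
            ≈⟨ ⊕-cong refl (alt-⊗ (q s) (λ s′ l″ → κ k s′ ⊗ X l″) l′) ⟨
          o′ ⊗ (d′ ⊗ (q s ⊗ X l′)) ⊕ alt (λ s′ l″ → q s ⊗ (κ k s′ ⊗ X l″)) l′ ∎
          where |l′| = ≡.trans eq |l|≡n

        -- Here o (n - 1) = e n.
        collapse : ∀ s l′ → suc (length l′) ≡ length l →
          alt (λ s′ l″ → q s′ ⊗ (κ k s ⊗ X l″)) l′ ≈ e′ ⊗ (κ k s ⊗ X l′)
        collapse s l′ eq = begin
          alt (λ s′ l″ → q s′ ⊗ (κ k s ⊗ X l″)) l′
            ≈⟨ alt-cong (λ s′ l″ → x∙yz≈y∙xz _ _ _) l′ ⟩
          alt (λ s′ l″ → κ k s ⊗ (q s′ ⊗ X l″)) l′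
            ≈⟨ alt-⊗ (κ k s) (λ s′ l″ → q s′ ⊗ X l″) l′ ⟩
          κ k s ⊗ alt (λ s′ l″ → q s′ ⊗ X l″) l′
            ≈⟨ ⊗-cong refl (q-expansion⁻ (length l′) |l′| l′ ≡.refl) ⟩
          κ k s ⊗ (con (o (length l′)) ⊗ X l′)
            ≡⟨ ≡.cong (λ m → κ k s ⊗ (con (e m) ⊗ X l′)) |l′| ⟩
          κ k s ⊗ (e′ ⊗ X l′)
            ≈⟨ x∙yz≈y∙xz _ _ _ ⟩
          e′ ⊗ (κ k s ⊗ X l′) ∎
          where
          |l′| = ≡.trans eq |l|≡n
          open CommutativeSemigroupProperties R.*-commutativeSemigroup using (x∙yz≈y∙xz)

        middle : alt (λ s l′ → q s ⊗ apply (T k) (X l′)) l ≈ o′ ⊗ (d′ ⊗ (o′ ⊗ x)) R.- e′ ⊗ a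
        middle = begin
          alt (λ s l′ → q s ⊗ apply (T k) (X l′)) l
            ≈⟨ alt-cong-length l translate ⟩
          alt (λ s l′ → o′ ⊗ (d′ ⊗ (q s ⊗ X l′)) ⊕ alt (λ s′ l″ → q s ⊗ (κ k s′ ⊗ X l″)) l′) l
            ≈⟨ alt-+ (λ s l′ → o′ ⊗ (d′ ⊗ (q s ⊗ X l′))) (λ s l′ → alt (λ s′ l″ → q s ⊗ (κ k s′ ⊗ X l″)) l′) l ⟩
          alt (λ s l′ → o′ ⊗ (d′ ⊗ (q s ⊗ X l′))) l ⊕ alt (λ s l′ → alt (λ s′ l″ → q s ⊗ (κ k s′ ⊗ X l″)) l′) l
            ≈⟨ ⊕-cong (trans (alt-⊗ o′ (λ s l′ → d′ ⊗ (q s ⊗ X l′)) l)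
                         (⊗-cong refl (trans (alt-⊗ d′ (λ s l′ → q s ⊗ X l′) l) (⊗-cong refl (q-expansion l |l|≡n)))))
                 (alt-antisymmetric (λ s s′ l″ → q s ⊗ (κ k s′ ⊗ X l″)) l) ⟩
          o′ ⊗ (d′ ⊗ (o′ ⊗ x)) R.- alt (λ s l′ → alt (λ s′ l″ → q s′ ⊗ (κ k s ⊗ X l″)) l′) l
            ≈⟨ ⊕-cong refl (⊗-cong refl (trans (alt-cong-length l collapse) (alt-⊗ e′ (λ s l′ → κ k s ⊗ X l′) l))) ⟩
          o′ ⊗ (d′ ⊗ (o′ ⊗ x)) R.- e′ ⊗ a ∎

      -- The sum of q_{r+k} B_k over k.
      q-expansion⁺ : QExpansion (suc n)
      q-expansion⁺ (r ∷ l) |l| = x∙y⁻¹≈ε⇒x≈y _ _ (go (eventually-zip (Φ-sum r (X l))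
          (alt-eventually (λ s l′ → eventually-map (λ _ → ⊗-cong refl) (Φ-sum r (X l′))) l)))
        where
        open GroupProperties R.+-group using (x∙y⁻¹≈ε⇒x≈y)
        e′ = con (e n)

        go : Eventually (λ m → apply (Φ r) (X l) ≈ S r m (T• (X l)) Product.×
               alt (λ s l′ → q s ⊗ apply (Φ r) (X l′)) l ≈ alt (λ s l′ → q s ⊗ S r m (T• (X l′))) l) →
             (q r ⊗ X l R.- alt (λ s l′ → q s ⊗ apply (Φ r) (X l′)) l) R.- e′ ⊗ apply (Φ r) (X l) ≈ con K.0#
        go (N , eventually) with eventually (suc N) (ℕ.n≤1+n N)
        ... | e₁ , e₂ = begin
          (q r ⊗ X l R.- alt (λ s l′ → q s ⊗ apply (Φ r) (X l′)) l) R.- e′ ⊗ apply (Φ r) (X l)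
            ≈⟨ ⊕-cong (⊕-cong (sym (S-d r N (X l))) (⊗-cong refl second)) (⊗-cong refl third) ⟩
          (S r (suc N) u₁ R.- S r (suc N) u₂) R.- S r (suc N) u₃
            ≈⟨ ⊕-cong (⊕-cong refl (sym (S-⊗ r (suc N) _ u₂))) (sym (S-⊗ r (suc N) _ u₃)) ⟩
          (S r (suc N) u₁ ⊕ S r (suc N) (λ k → R.- u₂ k)) ⊕ S r (suc N) (λ k → R.- u₃ k)
            ≈⟨ trans (⊕-cong (sym (S-+ r (suc N) u₁ (λ k → R.- u₂ k))) refl)
                 (sym (S-+ r (suc N) (λ k → u₁ k R.- u₂ k) (λ k → R.- u₃ k))) ⟩
          S r (suc N) (B l)
            ≈⟨ S-cong r (suc N) (B≈0 l (ℕ.suc-injective |l|)) ⟩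
          S r (suc N) (λ _ → con K.0#)
            ≈⟨ S-zero r (suc N) ⟩
          con K.0# ∎
          where
          u₁ u₂ u₃ : ℕ → Γ K.Carrier
          u₁ k = con (d k) ⊗ X l
          u₂ k = alt (λ s l′ → q s ⊗ apply (T k) (X l′)) l
          u₃ k = e′ ⊗ apply (T k) (X l)

          second : alt (λ s l′ → q s ⊗ apply (Φ r) (X l′)) l ≈ S r (suc N) u₂
          second = trans e₂ (trans (alt-cong (λ s l′ → sym (S-⊗ r (suc N) (q s) (T• (X l′)))) l)
            (alt-S r (suc N) (λ s l′ k → q s ⊗ T• (X l′) k) l))

          third : e′ ⊗ apply (Φ r) (X l) ≈ S r (suc N) u₃
          third = trans (⊗-cong refl e₁) (sym (S-⊗ r (suc N) e′ (T• (X l))))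

      Φ-T : ∀ r k l → length l ≡ n →
            apply (Φ r) (apply (T (suc k)) (X l)) ≈ alt (λ s l′ → apply (Φ r) (κ (suc k) s ⊗ X l′)) l
      Φ-T r k l |l| = trans (Φ.⟦⟧-cong r (begin
        apply (T (suc k)) (X l)
          ≈⟨ T-expansion l |l| (suc k) ⟩
        con (e n) ⊗ (con K.0# ⊗ X l) ⊕ alt (λ s l′ → κ (suc k) s ⊗ X l′) l
          ≈⟨ ⊕-cong (trans (⊗-cong refl (R.zeroˡ _)) (R.zeroʳ _)) refl ⟩
        con K.0# ⊕ alt (λ s l′ → κ (suc k) s ⊗ X l′) l
          ≈⟨ R.+-identityˡ _ ⟩
        alt (λ s l′ → κ (suc k) s ⊗ X l′) l ∎))
        (alt-operator (Φ r) (λ s l′ → κ (suc k) s ⊗ X l′) l)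

      -- Induction on k, with r decreasing: T-Φ expresses T_{k+1} Φ_r in terms of
      -- T_k Φ_{r-1} and of known terms.
      T-expansion⁺ : TExpansion (suc n)
      T-expansion⁺ (r ∷ l) |l|+1 k = go k r
        where
        |l| = ℕ.suc-injective |l|+1

        go : ∀ k r → apply (T k) (apply (Φ r) (X l)) ≈ con (o n) ⊗ (con (d k) ⊗ apply (Φ r) (X l))
               ⊕ (κ k r ⊗ X l R.- alt (λ s l′ → κ k s ⊗ apply (Φ r) (X l′)) l)
        go zero r = begin
          apply (T 0) (apply (Φ r) (X l))
            ≈⟨ T₀ _ ⟩
          apply (Φ r) (X l)
            ≈⟨ trans (⊗-cong (trans (⊕-comm _ _) (e+o n)) refl) (⊗-identityˡ _) ⟨
          (con (o n) ⊕ con (e n)) ⊗ apply (Φ r) (X l)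
            ≈⟨ R.distribʳ _ _ _ ⟩
          con (o n) ⊗ apply (Φ r) (X l) ⊕ con (e n) ⊗ apply (Φ r) (X l)
            ≈⟨ ⊕-cong (⊗-cong refl (sym (⊗-identityˡ _))) (sym (q-expansion⁺ (r ∷ l) |l|+1)) ⟩
          con (o n) ⊗ (con K.1# ⊗ apply (Φ r) (X l)) ⊕ (q r ⊗ X l R.- alt (λ s l′ → q s ⊗ apply (Φ r) (X l′)) l) ∎
        go (suc zero) r = begin
          apply (T 1) x
            ≈⟨ solve 2 (λ a b → a := (a :+ b) :- b) refl _ _ ⟩
          (apply (T 1) x ⊕ apply (T 0) x′) R.- apply (T 0) x′
            ≈⟨ ⊕-cong (T-Φ 0 r (X l)) (⊗-cong refl (T₀ _)) ⟩
          (apply (Φ r) (apply (T 1) (X l)) R.- apply (Φ r′) (apply (T 0) (X l))) R.- x′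
            ≈⟨ ⊕-cong (⊕-cong (Φ-T r 0 l |l|) (⊗-cong refl (Φ.⟦⟧-cong r′ (T₀ _)))) refl ⟩
          (A₁ R.- x′) R.- x′
            ≈⟨ solve 7 (λ a₁ a₂ x q y o e → (a₁ :- x) :- x
                 := ((a₁ :+ a₂) :- 2̂ :* (o :* x :- (q :* y :- e :* x)))
                    :+ (2̂ :* ((e :+ o) :* x :- x) :+ ((:- (2̂ :* q)) :* y :- a₂)))
                 refl A₁ A₂ x′ (q r′) (X l) o′ e′ ⟩
          ((A₁ ⊕ A₂) R.- 2Γ ⊗ (o′ ⊗ x′ R.- (q r′ ⊗ X l R.- e′ ⊗ x′)))
            ⊕ (2Γ ⊗ ((e′ ⊕ o′) ⊗ x′ R.- x′) ⊕ (κ 1 r ⊗ X l R.- A₂))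
            ≈⟨ ⊕-cong (trans (⊕-cong balance refl) (⊕-inverseʳ _)) (⊕-cong (trans (⊗-cong refl
                 (trans (⊕-cong (trans (⊗-cong (e+o n) refl) (⊗-identityˡ _)) refl) (⊕-inverseʳ _))) (R.zeroʳ _)) refl) ⟩
          con K.0# ⊕ (con K.0# ⊕ (κ 1 r ⊗ X l R.- A₂))
            ≈⟨ trans (R.+-identityˡ _) (⊕-cong (sym (trans (⊗-cong refl (R.zeroˡ _)) (R.zeroʳ _))) refl) ⟩
          o′ ⊗ (con K.0# ⊗ x) ⊕ (κ 1 r ⊗ X l R.- A₂) ∎
          where
          2̂ : ∀ {m} → Solver.Polynomial m
          2̂ = :con (+ 2 / 1)
          r′ = ℤ.pred r
          o′ = con (o n)
          e′ = con (e n)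
          x  = apply (Φ r) (X l)
          x′ = apply (Φ r′) (X l)
          A₁ = alt (λ s l′ → apply (Φ r) (κ 1 s ⊗ X l′)) l
          A₂ = alt (λ s l′ → κ 1 s ⊗ apply (Φ r) (X l′)) l
          A₃ = alt (λ s l′ → apply (Φ r′) (q s ⊗ X l′)) l
          A₄ = alt (λ s l′ → q s ⊗ apply (Φ r′) (X l′)) l

          A₃≈ : A₃ ≈ o′ ⊗ x′
          A₃≈ = trans (sym (alt-operator (Φ r′) (λ s l′ → q s ⊗ X l′) l))
            (trans (Φ.⟦⟧-cong r′ (q-expansion l |l|)) (Φ.*ₗ-homo r′ _ _))

          A₄≈ : A₄ ≈ q r′ ⊗ X l R.- e′ ⊗ x′
          A₄≈ = begin
            A₄                                        ≈⟨ solve 2 (λ a b → a := b :- (b :- a)) refl _ _ ⟩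
            q r′ ⊗ X l R.- (q r′ ⊗ X l R.- A₄)        ≈⟨ ⊕-cong refl (⊗-cong refl (q-expansion⁺ (r′ ∷ l) |l|+1)) ⟩
            q r′ ⊗ X l R.- e′ ⊗ x′                    ∎

          balance : A₁ ⊕ A₂ ≈ 2Γ ⊗ (o′ ⊗ x′ R.- (q r′ ⊗ X l R.- e′ ⊗ x′))
          balance = begin
            A₁ ⊕ A₂
              ≈⟨ alt-+ (λ s l′ → apply (Φ r) (κ 1 s ⊗ X l′)) (λ s l′ → κ 1 s ⊗ apply (Φ r) (X l′)) l ⟨
            alt (λ s l′ → apply (Φ r) (κ 1 s ⊗ X l′) ⊕ κ 1 s ⊗ apply (Φ r) (X l′)) l
              ≈⟨ alt-cong (λ s l′ → Φ-κ₀ r s (X l′)) l ⟩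
            alt (λ s l′ → 2Γ ⊗ (apply (Φ r′) (q s ⊗ X l′) R.- q s ⊗ apply (Φ r′) (X l′))) l
              ≈⟨ alt-⊗ 2Γ (λ s l′ → apply (Φ r′) (q s ⊗ X l′) R.- q s ⊗ apply (Φ r′) (X l′)) l ⟩
            2Γ ⊗ alt (λ s l′ → apply (Φ r′) (q s ⊗ X l′) R.- q s ⊗ apply (Φ r′) (X l′)) l
              ≈⟨ ⊗-cong refl (alt-minus (λ s l′ → apply (Φ r′) (q s ⊗ X l′)) (λ s l′ → q s ⊗ apply (Φ r′) (X l′)) l) ⟩
            2Γ ⊗ (A₃ R.- A₄)
              ≈⟨ ⊗-cong refl (⊕-cong A₃≈ (⊗-cong refl A₄≈)) ⟩
            2Γ ⊗ (o′ ⊗ x′ R.- (q r′ ⊗ X l R.- e′ ⊗ x′)) ∎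
        go (suc (suc k)) r = begin
          apply (T (2 ℕ.+ k)) x
            ≈⟨ solve 2 (λ a b → a := (a :+ b) :- b) refl _ _ ⟩
          (apply (T (2 ℕ.+ k)) x ⊕ apply (T (suc k)) x′) R.- apply (T (suc k)) x′
            ≈⟨ ⊕-cong (T-Φ (suc k) r (X l)) (⊗-cong refl (go (suc k) r′)) ⟩
          (apply (Φ r) (apply (T (2 ℕ.+ k)) (X l)) R.- apply (Φ r′) (apply (T (suc k)) (X l)))
            R.- (o′ ⊗ (con K.0# ⊗ x′) ⊕ (κ (suc k) r′ ⊗ X l R.- A₄))
            ≈⟨ ⊕-cong (⊕-cong (Φ-T r (suc k) l |l|) (⊗-cong refl (Φ-T r′ k l |l|)))
                 (⊗-cong refl (⊕-cong (trans (⊗-cong refl (R.zeroˡ _)) (R.zeroʳ _)) refl)) ⟩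
          (A₁ R.- A₃) R.- (con K.0# ⊕ (κ (suc k) r′ ⊗ X l R.- A₄))
            ≈⟨ ⊕-cong refl (⊗-cong refl (R.+-identityˡ _)) ⟩
          (A₁ R.- A₃) R.- (κ (suc k) r′ ⊗ X l R.- A₄)
            ≈⟨ solve 6 (λ a₁ a₂ a₃ a₄ κ x → (a₁ :- a₃) :- (κ :* x :- a₄)
                 := ((a₁ :+ a₂) :- (a₃ :- a₄)) :+ ((:- κ) :* x :- a₂)) refl A₁ A₂ A₃ A₄ (κ (suc k) r′) (X l) ⟩
          ((A₁ ⊕ A₂) R.- (A₃ R.- A₄)) ⊕ (κ (2 ℕ.+ k) r ⊗ X l R.- A₂)
            ≈⟨ ⊕-cong (trans (⊕-cong balance refl) (⊕-inverseʳ _)) refl ⟩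
          con K.0# ⊕ (κ (2 ℕ.+ k) r ⊗ X l R.- A₂)
            ≈⟨ ⊕-cong (sym (trans (⊗-cong refl (R.zeroˡ _)) (R.zeroʳ _))) refl ⟩
          o′ ⊗ (con K.0# ⊗ x) ⊕ (κ (2 ℕ.+ k) r ⊗ X l R.- A₂) ∎
          where
          r′ = ℤ.pred r
          o′ = con (o n)
          x  = apply (Φ r) (X l)
          x′ = apply (Φ r′) (X l)
          A₁ = alt (λ s l′ → apply (Φ r) (κ (2 ℕ.+ k) s ⊗ X l′)) l
          A₂ = alt (λ s l′ → κ (2 ℕ.+ k) s ⊗ apply (Φ r) (X l′)) l
          A₃ = alt (λ s l′ → apply (Φ r′) (κ (suc k) s ⊗ X l′)) l
          A₄ = alt (λ s l′ → κ (suc k) s ⊗ apply (Φ r′) (X l′)) l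

          balance : A₁ ⊕ A₂ ≈ A₃ R.- A₄
          balance = begin
            A₁ ⊕ A₂
              ≈⟨ alt-+ (λ s l′ → apply (Φ r) (κ (2 ℕ.+ k) s ⊗ X l′)) (λ s l′ → κ (2 ℕ.+ k) s ⊗ apply (Φ r) (X l′)) l ⟨
            alt (λ s l′ → apply (Φ r) (κ (2 ℕ.+ k) s ⊗ X l′) ⊕ κ (2 ℕ.+ k) s ⊗ apply (Φ r) (X l′)) l
              ≈⟨ alt-cong (λ s l′ → Φ-κ k r s (X l′)) l ⟩
            alt (λ s l′ → apply (Φ r′) (κ (suc k) s ⊗ X l′) R.- κ (suc k) s ⊗ apply (Φ r′) (X l′)) l
              ≈⟨ alt-minus (λ s l′ → apply (Φ r′) (κ (suc k) s ⊗ X l′)) (λ s l′ → κ (suc k) s ⊗ apply (Φ r′) (X l′)) l ⟩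
            A₃ R.- A₄ ∎

    expansions : ∀ n → (QExpansion n Product.× TExpansion n) Product.×
                     (∀ m → suc m ≡ n → QExpansion m Product.× TExpansion m)
    expansions zero    = (initial₀ , initial) , λ _ ()
      where
      initial₀ : QExpansion 0
      initial₀ [] _ = sym (R.zeroˡ _)

      initial : TExpansion 0
      initial [] _ zero    = trans (T₀ _) (sym (trans (⊕-identityʳ _) (trans (⊗-identityˡ _) (⊗-identityˡ _))))
      initial [] _ (suc k) = trans (T₁ k) (sym (trans (⊕-identityʳ _) (trans (⊗-cong refl (R.zeroˡ _)) (R.zeroʳ _))))
    expansions (suc n) with expansions n
    ... | (q-expansion , T-expansion) , below = (St.q-expansion⁺ , St.T-expansion⁺) , λ { _ ≡.refl → q-expansion , T-expansion }
      where module St = Step n q-expansion T-expansion (λ m e → proj₁ (below m e)) (λ m e → proj₂ (below m e))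

    T-expansion : ∀ l k → apply (T k) (X l) ≈ con (e (length l)) ⊗ (con (d k) ⊗ X l) ⊕ alt (λ s l′ → κ k s ⊗ X l′) l
    T-expansion l = proj₂ (proj₁ (expansions (length l))) l ≡.refl

    T-expansion-odd : ∀ n l → length l ≡ suc (n ℕ.* 2) → ∀ k → apply (T k) (X l) ≈ alt (λ s l′ → κ k s ⊗ X l′) l
    T-expansion-odd n l |l| k = trans (T-expansion l k)
      (trans (⊕-cong (trans (⊗-cong (con-cong (K.reflexive (≡.trans (≡.cong e |l|) (o-even n)))) refl) (R.zeroˡ _)) refl)
        (R.+-identityˡ _))
      where
      o-even : ∀ n → o (n ℕ.* 2) ≡ K.0#
      o-even zero    = ≡.refl
      o-even (suc n) = o-even n

    T-single : ∀ s k → apply (T k) (X (s ∷ [])) ≈ κ k s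
    T-single s k = trans (T-expansion-odd 0 (s ∷ []) ≡.refl k)
      (trans (⊕-cong (R.*-identityʳ _) (R.zeroʳ _)) (⊕-identityʳ _))

    pair-S : ∀ r s → Eventually λ n → X (r ∷ s ∷ []) ≈ S r n (λ k → κ k s)
    pair-S r s = eventually-map (λ n e → trans e (S-cong r n (T-single s))) (Φ-sum r (X (s ∷ [])))

    -- X satisfies the expansion of a Pfaffian along its first row.
    X-expansion : ∀ n r l → length l ≡ suc (n ℕ.* 2) → X (r ∷ l) ≈ alt (λ s l′ → X (r ∷ s ∷ []) ⊗ X l′) l
    X-expansion n r l |l| with witness (eventually-zip (Φ-sum r (X l))
        (alt-eventually {h = λ s l′ → X (r ∷ s ∷ []) ⊗ X l′}
          (λ s l′ → eventually-map (λ _ e → ⊗-cong e refl) (pair-S r s)) l))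
    ... | e₁ , e₂ = go e₁ e₂
      where
      go : ∀ {n} → X (r ∷ l) ≈ S r n (T• (X l)) →
           alt (λ s l′ → X (r ∷ s ∷ []) ⊗ X l′) l ≈ alt (λ s l′ → S r n (λ k → κ k s) ⊗ X l′) l →
           X (r ∷ l) ≈ alt (λ s l′ → X (r ∷ s ∷ []) ⊗ X l′) l
      go {m} e₁ e₂ = begin
        X (r ∷ l)
          ≈⟨ trans e₁ (S-cong r m (T-expansion-odd n l |l|)) ⟩
        S r m (λ k → alt (λ s l′ → κ k s ⊗ X l′) l)
          ≈⟨ alt-S r m (λ s l′ k → κ k s ⊗ X l′) l ⟨
        alt (λ s l′ → S r m (λ k → κ k s ⊗ X l′)) l
          ≈⟨ alt-cong (λ s l′ → trans (S-cong r m λ k → ⊗-comm _ _)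
               (trans (S-⊗ r m (X l′) (λ k → κ k s)) (⊗-comm _ _))) l ⟩
        alt (λ s l′ → S r m (λ k → κ k s) ⊗ X l′) l
          ≈⟨ e₂ ⟨
        alt (λ s l′ → X (r ∷ s ∷ []) ⊗ X l′) l ∎

    X-single : ∀ r → X (r ∷ []) ≈ q r
    X-single r = go (Φ-sum r (con K.1#))
      where
      T-unit : ∀ k → apply (T k) (con K.1#) ≈ con (d k) ⊗ con K.1#
      T-unit zero    = trans (T₀ _) (sym (⊗-identityˡ _))
      T-unit (suc k) = trans (T₁ k) (sym (R.zeroˡ _))

      go : Eventually (λ n → apply (Φ r) (con K.1#) ≈ S r n (T• (con K.1#))) → X (r ∷ []) ≈ q r
      go (N , eventually) = trans (eventually (suc N) (ℕ.n≤1+n N))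
        (trans (S-cong r (suc N) T-unit) (trans (S-d r N (con K.1#)) (R.*-identityʳ _)))

    -- The zero appended in odd length does not change X.
    X-padded : q (+ 0) ≈ con K.1# → ∀ l →
      X (tabulate {n = ℕ.⌈ length l /2⌉ ℕ.* 2} (λ i → + SchurQ.part l (toℕ i))) ≈ X (map +_ l)
    X-padded q₀ []          = refl
    X-padded q₀ (r ∷ [])    = Φ.⟦⟧-cong (+ r) (trans (X-single (+ 0)) q₀)
    X-padded q₀ (r ∷ s ∷ l) = Φ.⟦⟧-cong (+ r) (Φ.⟦⟧-cong (+ s) (X-padded q₀ l))

    module _ (q-negative : ∀ n → q -[1+ n ] ≈ con K.0#) where
      open Exponentiation R.semiring using (_^_)

      κ-suc : ∀ k s → κ (suc k) s ≈ 2Γ ⊗ ((R.- R.1#) ^ suc k ⊗ q (s ℤ.- + suc k))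
      κ-suc zero s = begin
        R.- (2Γ ⊗ q (ℤ.pred s))
          ≈⟨ solve 2 (λ a b → :- (a :* b) := a :* (((:- :con 1ℚ) :* :con 1ℚ) :* b)) refl _ _ ⟩
        2Γ ⊗ ((R.- con (ι 1ℚ)) ⊗ con (ι 1ℚ) ⊗ q (ℤ.pred s))
          ≈⟨ ⊗-cong refl (⊗-cong (⊗-cong (⊗-cong refl 1≈) 1≈) (R.reflexive (≡.cong q (ℤ.+-comm ℤ.-1ℤ s)))) ⟩
        2Γ ⊗ ((R.- R.1#) ^ 1 ⊗ q (s ℤ.- + 1)) ∎
        where
        1≈ : con (ι 1ℚ) ≈ con K.1#
        1≈ = con-cong (Morphisms.RingMorphisms.IsRingHomomorphism.1#-homo ι-isRingHomomorphism)
      κ-suc (suc k) s = begin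
        R.- κ (suc k) (ℤ.pred s)
          ≈⟨ ⊗-cong refl (κ-suc k (ℤ.pred s)) ⟩
        R.- (2Γ ⊗ ((R.- R.1#) ^ suc k ⊗ q (ℤ.pred s ℤ.- + suc k)))
          ≈⟨ solve 3 (λ a b c → :- (a :* (b :* c)) := a :* ((:- b) :* c)) refl _ _ _ ⟩
        2Γ ⊗ ((R.- (R.- R.1#) ^ suc k) ⊗ q (ℤ.pred s ℤ.- + suc k))
          ≈⟨ ⊗-cong refl (⊗-cong (⊗-cong (sym (R.*-identityʳ _)) refl) (R.reflexive (≡.cong q index))) ⟩
        2Γ ⊗ ((R.- R.1#) ^ (2 ℕ.+ k) ⊗ q (s ℤ.- + (2 ℕ.+ k))) ∎
        where
        index : ℤ.pred s ℤ.- + suc k ≡ s ℤ.- + (2 ℕ.+ k)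
        index = ℤS.solve 2 (λ s k → (ℤS.con ℤ.-1ℤ ℤS.:+ s) ℤS.:- k ℤS.:= s ℤS.:- (ℤS.con (+ 1) ℤS.:+ k)) ≡.refl s (+ suc k)

      -- X(r, s) = q_r q_s + 2 ∑_k (-1)^k q_{r+k} q_{s-k}.
      pair : ∀ r s → X (+ r ∷ + s ∷ []) ≈ q (+ r) ⊗ q (+ s) ⊕ 2Γ ⊗ ∑< s (λ i →
               (R.- R.1#) ^ suc i ⊗ q (+ (r ℕ.+ suc i)) ⊗ q (+ (s ∸ suc i)))
      pair r s = go (pair-S (+ r) (+ s))
        where
        term : ℕ → Γ K.Carrier
        term i = (R.- R.1#) ^ suc i ⊗ q (+ (r ℕ.+ suc i)) ⊗ q (+ s ℤ.- + suc i)

        negative : ∀ i → s ≤ i → term i ≈ con K.0#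
        negative i s≤i with ℕ.m≤n⇒∃[o]m+o≡n s≤i
        ... | j , ≡.refl = trans (⊗-cong refl (trans (R.reflexive (≡.cong q index)) (q-negative j))) (R.zeroʳ _)
          where
          index : + s ℤ.- + suc (s ℕ.+ j) ≡ -[1+ j ]
          index = ℤS.solve 2 (λ s j → s ℤS.:- (ℤS.con (+ 1) ℤS.:+ (s ℤS.:+ j)) ℤS.:= ℤS.:- (ℤS.con (+ 1) ℤS.:+ j)) ≡.refl (+ s) (+ j)

        go : Eventually (λ n → X (+ r ∷ + s ∷ []) ≈ S (+ r) n (λ k → κ k (+ s))) → _
        go (N , eventually) = begin
          X (+ r ∷ + s ∷ [])
            ≈⟨ eventually (suc (N ℕ.+ s)) (ℕ.m≤n⇒m≤1+n (ℕ.m≤m+n N s)) ⟩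
          q (+ (r ℕ.+ 0)) ⊗ q (+ s) ⊕ ∑< (N ℕ.+ s) (λ i → q (+ (r ℕ.+ suc i)) ⊗ κ (suc i) (+ s))
            ≈⟨ ⊕-cong (R.reflexive (≡.cong (λ m → q (+ m) ⊗ q (+ s)) (ℕ.+-identityʳ r)))
                 (∑-cong (N ℕ.+ s) λ i → trans (⊗-cong refl (κ-suc i (+ s)))
                   (solve 4 (λ a b c d → a :* (b :* (c :* d)) := b :* (c :* a :* d)) refl _ _ _ _)) ⟩
          q (+ r) ⊗ q (+ s) ⊕ ∑< (N ℕ.+ s) (λ i → 2Γ ⊗ term i)
            ≈⟨ ⊕-cong refl (∑-operator (multiplyBy 2Γ) (N ℕ.+ s) term) ⟨
          q (+ r) ⊗ q (+ s) ⊕ 2Γ ⊗ ∑< (N ℕ.+ s) term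
            ≈⟨ ⊕-cong refl (⊗-cong refl (∑-extend term (ℕ.m≤n+m s N) negative)) ⟨
          q (+ r) ⊗ q (+ s) ⊕ 2Γ ⊗ ∑< s term
            ≈⟨ ⊕-cong refl (⊗-cong refl (∑-cong< s λ i i<s → ⊗-cong refl (R.reflexive (≡.cong q
                 (≡.trans (ℤ.m-n≡m⊖n s (suc i)) (ℤ.⊖-≥ i<s)))))) ⟩
          q (+ r) ⊗ q (+ s) ⊕ 2Γ ⊗ ∑< s (λ i → (R.- R.1#) ^ suc i ⊗ q (+ (r ℕ.+ suc i)) ⊗ q (+ (s ∸ suc i))) ∎
          where
          ∑-cong< : ∀ n {u v : ℕ → Γ K.Carrier} → (∀ k → k < n → u k ≈ v k) → ∑< n u ≈ ∑< n v
          ∑-cong< zero    e = refl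
          ∑-cong< (suc n) e = ⊕-cong (e 0 (s≤s z≤n)) (∑-cong< n λ k k<n → e (suc k) (s≤s k<n))

-- Pfaffians

module PfaffianExpansion (R : CommutativeRing c ℓ) where
  open CommutativeRing R
  open Pfaffian R
  open Exponentiation semiring using (_^_; ^-homo-*)

  -- The pairs of a matching, written one after the other.
  entries : ∀ {m} → List (Fin m Product.× Fin m) → List (Fin m)
  entries = concatMap (λ (i , j) → i ∷ j ∷ [])

  -- The term of a matching in the Pfaffian, with its sign.
  weight : ∀ {m} → Matrix m → List (Fin m Product.× Fin m) → Carrier
  weight a l = (- 1#) ^ inversions (entries l) * foldr _*_ 1# (map (λ (i , j) → a i j) l)

  sumOver : ∀ {b} {B : Set b} → (B → Carrier) → List B → Carrier
  sumOver w l = foldr _+_ 0# (map w l)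

  -- The Pfaffian of the submatrix whose rows and columns are the entries of v,
  -- for increasing v.
  subPf : ∀ {m} → Matrix m → ∀ n → Vec (Fin m) (n ℕ.* 2) → Carrier
  subPf a n v = sumOver (weight a) (matchings n v)

  sumOver-++ : ∀ {b} {B : Set b} (w : B → Carrier) l l′ → sumOver w (l ++ l′) ≈ sumOver w l + sumOver w l′
  sumOver-++ w []      l′ = sym (+-identityˡ _)
  sumOver-++ w (x ∷ l) l′ = trans (+-congˡ (sumOver-++ w l l′)) (sym (+-assoc _ _ _))

  sumOver-concatMap : ∀ {b b′} {B : Set b} {B′ : Set b′} (w : B → Carrier) (f : B′ → List B) l →
                      sumOver w (concatMap f l) ≈ sumOver (λ x → sumOver w (f x)) l
  sumOver-concatMap w f []      = refl
  sumOver-concatMap w f (x ∷ l) = trans (sumOver-++ w (f x) (concatMap f l)) (+-congˡ (sumOver-concatMap w f l))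

  sumOver-cong : ∀ {b} {B : Set b} {w w′ : B → Carrier} → (∀ x → w x ≈ w′ x) → ∀ l → sumOver w l ≈ sumOver w′ l
  sumOver-cong e []      = refl
  sumOver-cong e (x ∷ l) = +-cong (e x) (sumOver-cong e l)

  sumOver-map-scale : ∀ {b b′} {B : Set b} {B′ : Set b′} (w : B → Carrier) (w′ : B′ → Carrier) (f : B′ → B) r l →
                      All (λ x → w (f x) ≈ r * w′ x) l → sumOver w (map f l) ≈ r * sumOver w′ l
  sumOver-map-scale w w′ f r []      []      = sym (zeroʳ r)
  sumOver-map-scale w w′ f r (x ∷ l) (e ∷ es) =
    trans (+-cong e (sumOver-map-scale w w′ f r l es)) (sym (distribˡ r _ _))

  -- The number of entries less than y.
  smaller : ∀ {m} → Fin m → List (Fin m) → ℕ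
  smaller y l = length (filter (Fin._<? y) l)

  smaller-∷ : ∀ {m} (y x : Fin m) l → smaller y (x ∷ l) ≡ smaller y (x ∷ []) ℕ.+ smaller y l
  smaller-∷ y x l with toℕ x ℕ.<ᵇ toℕ y
  ... | true  = ≡.refl
  ... | false = ≡.refl

  smaller-↭ : ∀ {m} (y : Fin m) {l l′} → l ↭ l′ → smaller y l ≡ smaller y l′
  smaller-↭ y Permutation.refl = ≡.refl
  smaller-↭ y (prep {l} {l′} x e) = begin
    smaller y (x ∷ l)                     ≡⟨ smaller-∷ y x l ⟩
    smaller y (x ∷ []) ℕ.+ smaller y l    ≡⟨ ≡.cong (smaller y (x ∷ []) ℕ.+_) (smaller-↭ y e) ⟩
    smaller y (x ∷ []) ℕ.+ smaller y l′   ≡⟨ smaller-∷ y x l′ ⟨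
    smaller y (x ∷ l′)                    ∎
    where open ≡.≡-Reasoning
  smaller-↭ y (swap {l} {l′} x x′ e) = begin
    smaller y (x ∷ x′ ∷ l)
      ≡⟨ ≡.trans (smaller-∷ y x (x′ ∷ l)) (≡.cong (smaller y (x ∷ []) ℕ.+_) (smaller-∷ y x′ l)) ⟩
    smaller y (x ∷ []) ℕ.+ (smaller y (x′ ∷ []) ℕ.+ smaller y l)
      ≡⟨ ≡.cong (λ k → smaller y (x ∷ []) ℕ.+ (smaller y (x′ ∷ []) ℕ.+ k)) (smaller-↭ y e) ⟩
    smaller y (x ∷ []) ℕ.+ (smaller y (x′ ∷ []) ℕ.+ smaller y l′)
      ≡⟨ x∙yz≈y∙xz (smaller y (x ∷ [])) (smaller y (x′ ∷ [])) (smaller y l′) ⟩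
    smaller y (x′ ∷ []) ℕ.+ (smaller y (x ∷ []) ℕ.+ smaller y l′)
      ≡⟨ ≡.trans (smaller-∷ y x′ (x ∷ l′)) (≡.cong (smaller y (x′ ∷ []) ℕ.+_) (smaller-∷ y x l′)) ⟨
    smaller y (x′ ∷ x ∷ l′) ∎
    where
    open ≡.≡-Reasoning
    open CommutativeSemigroupProperties ℕ.+-commutativeSemigroup using (x∙yz≈y∙xz)
  smaller-↭ y (Permutation.trans e e′) = ≡.trans (smaller-↭ y e) (smaller-↭ y e′)

  removeAt-↭ : ∀ {b} {B : Set b} {n} (v : Vec B (suc n)) i → toList v ↭ lookup v i ∷ toList (removeAt v i)
  removeAt-↭ (x Vec.∷ v)           Fin.zero    = ↭-refl
  removeAt-↭ (x Vec.∷ v@(_ Vec.∷ _)) (Fin.suc i) = ↭-trans (prep x (removeAt-↭ v i)) (swap x (lookup v i) ↭-refl)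

  matchings-↭ : ∀ {m} n (v : Vec (Fin m) (n ℕ.* 2)) → All (λ l → entries l ↭ toList v) (matchings n v)
  matchings-↭ zero    Vec.[]      = ↭-refl ∷ []
  matchings-↭ (suc n) (x Vec.∷ v) = All.concat⁺ (All.map⁺ (All.universal each (allFin (suc (n ℕ.* 2)))))
    where
    each : ∀ i → All (λ l → entries l ↭ x ∷ toList v) (map ((x , lookup v i) ∷_) (matchings n (removeAt v i)))
    each i = All.map⁺ (All.map (λ {l} → extend l) (matchings-↭ n (removeAt v i)))
      where
      extend : ∀ l → entries l ↭ toList (removeAt v i) → entries ((x , lookup v i) ∷ l) ↭ x ∷ toList v
      extend l e = prep x (↭-trans (prep (lookup v i) e) (↭-sym (removeAt-↭ v i)))

  Increasing : ∀ {m n} → Vec (Fin m) n → Set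
  Increasing v = AllPairs Fin._<_ (toList v)

  All-removeAt : ∀ {b} {B : Set b} {P : B → Set} {n} (v : Vec B (suc n)) i → All P (toList v) →
                 P (lookup v i) Product.× All P (toList (removeAt v i))
  All-removeAt v i ps with All-resp-↭ (removeAt-↭ v i) ps
  ... | px ∷ pxs = px , pxs

  increasing-removeAt : ∀ {m n} (v : Vec (Fin m) (suc n)) i → Increasing v → Increasing (removeAt v i)
  increasing-removeAt (x Vec.∷ v)             Fin.zero    (_ ∷ v↑)   = v↑
  increasing-removeAt (x Vec.∷ v@(_ Vec.∷ _)) (Fin.suc i) (x<v ∷ v↑) =
    proj₂ (All-removeAt v i x<v) ∷ increasing-removeAt v i v↑

  smaller-none : ∀ {m} {x : Fin m} {l} → All (x Fin.<_) l → smaller x l ≡ 0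
  smaller-none {x = x} x<l = ≡.cong length (List.filter-none (Fin._<? x) (All.map (λ x<y y<x → ℕ.<-asym x<y y<x) x<l))

  smaller-removeAt : ∀ {m n} (v : Vec (Fin m) (suc n)) i → Increasing v →
                     smaller (lookup v i) (toList (removeAt v i)) ≡ toℕ i
  smaller-removeAt (x Vec.∷ v)             Fin.zero    (x<v ∷ _)  = smaller-none x<v
  smaller-removeAt (x Vec.∷ v@(_ Vec.∷ _)) (Fin.suc i) (x<v ∷ v↑) = ≡.trans
    (≡.cong length (List.filter-accept (Fin._<? lookup v i) (proj₁ (All-removeAt v i x<v))))
    (≡.cong suc (smaller-removeAt v i v↑))

  -- The first row index x precedes all others, and its partner forms an
  -- inversion with the i entries of v before it.
  inversions-cons : ∀ {m n} (x : Fin m) (v : Vec (Fin m) (suc n)) i → Increasing (x Vec.∷ v) →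
    ∀ l → l ↭ toList (removeAt v i) → inversions (x ∷ lookup v i ∷ l) ≡ toℕ i ℕ.+ inversions l
  inversions-cons x v i (x<v ∷ v↑) l e = ≡.cong₂ ℕ._+_
    (smaller-none (All-resp-↭ (↭-sym (↭-trans (prep (lookup v i) e) (↭-sym (removeAt-↭ v i)))) x<v))
    (≡.cong (ℕ._+ inversions l) (≡.trans (smaller-↭ (lookup v i) e) (smaller-removeAt v i v↑)))

  -- Expansion of a Pfaffian along its first row.
  subPf-expansion : ∀ {m} (a : Matrix m) n x (v : Vec (Fin m) (suc (n ℕ.* 2))) → Increasing (x Vec.∷ v) →
    subPf a (suc n) (x Vec.∷ v)
      ≈ sumOver (λ i → (- 1#) ^ toℕ i * (a x (lookup v i) * subPf a n (removeAt v i))) (allFin (suc (n ℕ.* 2)))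
  subPf-expansion a n x v v↑ = trans
    (sumOver-concatMap (weight a) (λ i → map ((x , lookup v i) ∷_) (matchings n (removeAt v i))) (allFin (suc (n ℕ.* 2))))
    (sumOver-cong (λ i → trans
      (sumOver-map-scale (weight a) (weight a) ((x , lookup v i) ∷_) ((- 1#) ^ toℕ i * a x (lookup v i))
        (matchings n (removeAt v i)) (All.map (λ {l} → term i l) (matchings-↭ n (removeAt v i))))
      (*-assoc _ _ _)) (allFin (suc (n ℕ.* 2))))
    where
    term : ∀ i l → entries l ↭ toList (removeAt v i) →
           weight a ((x , lookup v i) ∷ l) ≈ (- 1#) ^ toℕ i * a x (lookup v i) * weight a l
    term i l e = begin
      (- 1#) ^ inversions (x ∷ lookup v i ∷ entries l) * (a x (lookup v i) * product)
        ≡⟨ ≡.cong (λ k → (- 1#) ^ k * (a x (lookup v i) * product)) (inversions-cons x v i v↑ (entries l) e) ⟩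
      (- 1#) ^ (toℕ i ℕ.+ inversions (entries l)) * (a x (lookup v i) * product)
        ≈⟨ *-congʳ (^-homo-* (- 1#) (toℕ i) (inversions (entries l))) ⟩
      (- 1#) ^ toℕ i * (- 1#) ^ inversions (entries l) * (a x (lookup v i) * product)
        ≈⟨ interchange _ _ _ _ ⟩
      (- 1#) ^ toℕ i * a x (lookup v i) * ((- 1#) ^ inversions (entries l) * product) ∎
      where
      product = foldr _*_ 1# (map (λ (i , j) → a i j) l)
      open SetoidReasoning setoid
      open CommutativeSemigroupProperties *-commutativeSemigroup using (interchange)

  skew-< : ∀ {m} (a : Matrix m) {i j} → i Fin.< j → skew a i j ≡ a i j
  skew-< a {i} {j} i<j with Fin.<-cmp i j
  ... | tri< _ _ _   = ≡.refl
  ... | tri≈ i≮j _ _ = contradiction i<j i≮j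
  ... | tri> i≮j _ _ = contradiction i<j i≮j

  toList-tabulate : ∀ {b} {B : Set b} {n} (f : Fin n → B) → toList (Vec.tabulate f) ≡ tabulate f
  toList-tabulate {n = zero}  f = ≡.refl
  toList-tabulate {n = suc n} f = ≡.cong (f Fin.zero ∷_) (toList-tabulate (λ i → f (Fin.suc i)))

  allFin-increasing : ∀ m → Increasing (Vec.allFin m)
  allFin-increasing m = subst (AllPairs Fin._<_) (≡.sym (toList-tabulate id)) (AllPairs.tabulate⁺-< id)

-- A function X of sequences of integers that satisfies the expansion of a
-- Pfaffian along its first row, and is 1 on the empty sequence, is the Pfaffian
-- of its values on pairs.
module PfaffianRealization (K : CommutativeRing c ℓ) (ι : ℚ → CommutativeRing.Carrier K)
                           (ι-isRingHomomorphism : Morphisms.RingMorphisms.IsRingHomomorphism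
                              ℚ.+-*-rawRing (CommutativeRing.rawRing K) ι) where
  private
    module K = CommutativeRing K
    module ι = Morphisms.RingMorphisms.IsRingHomomorphism ι-isRingHomomorphism
  open Polynomials K
  open Vertex K ι ι-isRingHomomorphism using (module R; module Γℚ; extendScalars; extendScalars-cong)
  open AlternatingSum K
  open SetoidReasoning R.setoid

  module Γℚ^ = Exponentiation Γℚ.semiring
  open Exponentiation R.semiring using (_^_)

  extendScalars-sign : ∀ k → extendScalars ((Γℚ.- Γℚ.1#) Γℚ^.^ k) ≈ (R.- R.1#) ^ k
  extendScalars-sign zero    = con-cong ι.1#-homo
  extendScalars-sign (suc k) = ⊗-cong (extendScalars-neg Γℚ.1# (con-cong ι.1#-homo)) (extendScalars-sign k)
    where
    extendScalars-neg : ∀ f {g} → extendScalars f ≈ g → extendScalars (Γℚ.- f) ≈ R.- g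
    extendScalars-neg f e = ⊗-cong (con-cong (K.trans (ι.-‿homo 1ℚ) (K.-‿cong ι.1#-homo))) e

  module Pfℚ = PfaffianExpansion Γℚ
  module PfK = PfaffianExpansion ring
  open PfK using (sumOver; sumOver-cong)

  alt-sumOver : ∀ {a} {A : Set a} (h : A → List A → Γ K.Carrier) {n} (v : Vec A (suc n)) →
    alt h (toList v)
      ≈ sumOver (λ i → (R.- R.1#) ^ toℕ i ⊗ h (lookup v i) (toList (removeAt v i))) (allFin (suc n))
  alt-sumOver h (x Vec.∷ Vec.[])        = ⊕-cong (sym (⊗-identityˡ _)) (R.zeroʳ _)
  alt-sumOver h {suc n} (x Vec.∷ v@(_ Vec.∷ _)) = ⊕-cong (sym (⊗-identityˡ _)) (begin
    R.- alt (λ y l → h y (x ∷ l)) (toList v)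
      ≈⟨ ⊗-cong refl (alt-sumOver (λ y l → h y (x ∷ l)) v) ⟩
    R.- sumOver term (allFin (suc n))
      ≈⟨ neg-sumOver (allFin (suc n)) ⟨
    sumOver (λ i → R.- term i) (allFin (suc n))
      ≈⟨ sumOver-cong (λ i → trans (sym (⊗-assoc _ _ _)) (⊗-cong (⊗-cong (sym (R.*-identityʳ _)) refl) refl)) (allFin (suc n)) ⟩
    sumOver (λ i → term′ (Fin.suc i)) (allFin (suc n))
      ≡⟨ ≡.cong (foldr _⊕_ (con K.0#)) (≡.trans (List.map-tabulate id (λ i → term′ (Fin.suc i)))
           (≡.sym (List.map-tabulate Fin.suc term′))) ⟩
    sumOver term′ (tabulate Fin.suc) ∎)
    where
    term : Fin (suc n) → Γ K.Carrier
    term i = (R.- R.1#) ^ toℕ i ⊗ h (lookup v i) (x ∷ toList (removeAt v i))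

    term′ : Fin (suc (suc n)) → Γ K.Carrier
    term′ i = (R.- R.1#) ^ toℕ i ⊗ h (lookup (x Vec.∷ v) i) (toList (removeAt (x Vec.∷ v) i))

    neg-sumOver : ∀ l → sumOver (λ i → R.- term i) l ≈ R.- sumOver term l
    neg-sumOver []      = sym (R.zeroʳ _)
    neg-sumOver (i ∷ l) = trans (⊕-cong refl (neg-sumOver l)) (sym (⊗-distribˡ _ _ _))

  module _ (Q₂ : ℕ → ℕ → Γ ℚ) (X : List ℤ → Γ K.Carrier) (X-[] : X [] ≈ con K.1#)
           (X-expansion : ∀ n r l → length l ≡ suc (n ℕ.* 2) → X (r ∷ l) ≈ alt (λ s l′ → X (r ∷ s ∷ []) ⊗ X l′) l)
           (extendScalars-Q₂ : ∀ r s → extendScalars (Q₂ r s) ≈ X (+ r ∷ + s ∷ []))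
           {m} (g : Fin m → ℕ) where
    private
      matrix : Fin m → Fin m → Γ ℚ
      matrix i j = Q₂ (g i) (g j)

      X′ : List (Fin m) → Γ K.Carrier
      X′ l = X (map (λ i → + g i) l)

    extendScalars-subPf : ∀ n (v : Vec (Fin m) (n ℕ.* 2)) → Pfℚ.Increasing v →
      extendScalars (Pfℚ.subPf (Pfaffian.skew Γℚ matrix) n v) ≈ X′ (toList v)
    extendScalars-subPf zero    Vec.[]      _  = trans (⊕-cong (⊗-cong (con-cong ι.1#-homo) (con-cong ι.1#-homo)) (con-cong ι.0#-homo))
      (trans (⊕-identityʳ _) (trans (⊗-identityˡ _) (sym X-[])))
    extendScalars-subPf (suc n) (x Vec.∷ v) v↑@(x<v ∷ v′↑) = begin
      extendScalars (Pfℚ.subPf a (suc n) (x Vec.∷ v))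
        ≈⟨ extendScalars-cong (Pfℚ.subPf-expansion a n x v v↑) ⟩
      extendScalars (Pfℚ.sumOver term (allFin (suc (n ℕ.* 2))))
        ≈⟨ extendScalars-sumOver (allFin (suc (n ℕ.* 2))) ⟩
      sumOver (λ i → extendScalars (term i)) (allFin (suc (n ℕ.* 2)))
        ≈⟨ sumOver-cong extendScalars-term (allFin (suc (n ℕ.* 2))) ⟩
      sumOver (λ i → (R.- R.1#) ^ toℕ i ⊗ h (lookup v i) (toList (removeAt v i))) (allFin (suc (n ℕ.* 2)))
        ≈⟨ alt-sumOver h v ⟨
      alt h (toList v)
        ≈⟨ alt-map (λ i → + g i) (λ s l → X (+ g x ∷ s ∷ []) ⊗ X l) (toList v) ⟨
      alt (λ s l → X (+ g x ∷ s ∷ []) ⊗ X l) (map (λ i → + g i) (toList v))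
        ≈⟨ X-expansion n (+ g x) (map (λ i → + g i) (toList v))
             (≡.trans (List.length-map _ (toList v)) (Vec.length-toList v)) ⟨
      X (map (λ i → + g i) (x ∷ toList v)) ∎
      where
      a = Pfaffian.skew Γℚ matrix

      term : Fin (suc (n ℕ.* 2)) → Γ ℚ
      term i = (Γℚ.- Γℚ.1#) Γℚ^.^ toℕ i ⊗ (a x (lookup v i) ⊗ Pfℚ.subPf a n (removeAt v i))

      h : Fin m → List (Fin m) → Γ K.Carrier
      h j l = X (+ g x ∷ + g j ∷ []) ⊗ X′ l

      extendScalars-sumOver : ∀ l → extendScalars (Pfℚ.sumOver term l) ≈ sumOver (λ i → extendScalars (term i)) l
      extendScalars-sumOver []      = con-cong ι.0#-homo
      extendScalars-sumOver (i ∷ l) = ⊕-cong refl (extendScalars-sumOver l)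

      extendScalars-term : ∀ i → extendScalars (term i)
        ≈ (R.- R.1#) ^ toℕ i ⊗ h (lookup v i) (toList (removeAt v i))
      extendScalars-term i = ⊗-cong (extendScalars-sign (toℕ i)) (⊗-cong
        (trans (R.reflexive (≡.cong extendScalars (Pfℚ.skew-< matrix (proj₁ (Pfℚ.All-removeAt v i x<v)))))
          (extendScalars-Q₂ (g x) (g (lookup v i))))
        (extendScalars-subPf n (removeAt v i) (Pfℚ.increasing-removeAt v i v′↑)))

-- The coefficients of the vertex operator Φ, applied to the unit, give the
-- Schur Q-functions.
module Realization (K : CommutativeRing c ℓ) (ι : ℚ → CommutativeRing.Carrier K)
                   (ι-isRingHomomorphism : Morphisms.RingMorphisms.IsRingHomomorphism
                      ℚ.+-*-rawRing (CommutativeRing.rawRing K) ι) where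
  private
    module K = CommutativeRing K
    module ι = Morphisms.RingMorphisms.IsRingHomomorphism ι-isRingHomomorphism
  open Operators K
  open Polynomials K
  open VertexOperators K ι
  open Vertex K ι ι-isRingHomomorphism
  open Wick K ι ι-isRingHomomorphism
  open AlternatingSum K
  open PfaffianRealization K ι ι-isRingHomomorphism
  open SetoidReasoning R.setoid
  open Summation R.+-commutativeMonoid using (sum-syntax)

  Φ : FormalSeries
  Φ = vertexOperator β β

  creation-qℤ : ∀ s f → apply (creation β ⟨ s ⟩) f ≈ qℤ s ⊗ f
  creation-qℤ (+ n)    f = creation≐q n f
  creation-qℤ -[1+ n ] f = refl

  1/0!≈1 : con (ι (EΓ.1/ 0 !)) ≈ con K.1#
  1/0!≈1 = con-cong ι.1#-homo

  T₀ : ∀ f → apply (T 0) f ≈ f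
  T₀ f = trans (⊕-cong (trans (⊗-cong 1/0!≈1 (⊗-identityˡ f)) (⊗-identityˡ f)) (R.zeroˡ f)) (⊕-identityʳ f)

  q₀ : q 0 ≈ con K.1#
  q₀ = trans (⊕-identityʳ _) (trans (⊗-cong 1/0!≈1 refl) (⊗-identityˡ _))

  T-vanishes : ∀ f k → deg f < k → apply (T k) f ≈ con K.0#
  T-vanishes = annihilation-locallyFinite β

  Φ-sum : ∀ r f → Eventually λ n → apply (Φ r) f ≈ ∑< n (λ k → qℤ (r ℤ.+ + k) ⊗ apply (T k) f)
  Φ-sum r f = suc (deg f) , λ n deg<n → trans (go (suc (deg f)) (productTerm (creation β) T r f))
    (trans (∑-cong (suc (deg f)) λ k → creation-qℤ (r ℤ.+ + k) (apply (T k) f))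
      (∑-extend (λ k → qℤ (r ℤ.+ + k) ⊗ apply (T k) f) deg<n λ k deg<k →
        trans (⊗-cong refl (T-vanishes f k deg<k)) (R.zeroʳ _)))
    where
    go : ∀ n (u : ℕ → Γ K.Carrier) → ∑[ k < n ] u (toℕ k) ≈ ∑< n u
    go zero    u = refl
    go (suc n) u = ⊕-cong refl (go n λ k → u (suc k))

  T-q : ∀ s k g → apply (T (suc k)) (qℤ s ⊗ g) ⊕ apply (T k) (qℤ (ℤ.pred s) ⊗ g)
                ≈ qℤ s ⊗ apply (T (suc k)) g R.- qℤ (ℤ.pred s) ⊗ apply (T k) g
  T-q s k g = Translation.T-q T qℤ T₀ ∇-T L-q g s k

  open Expansion T qℤ Φ T₀ (λ k → T-vanishes (con K.1#) (suc k) (s≤s z≤n)) T-comm T-q Φ-sum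
    public using (X; X-expansion; X-padded; pair)

  extendScalars-Q₂ : ∀ r s → extendScalars (SchurQ.Q₂ r s) ≈ X (+ r ∷ + s ∷ [])
  extendScalars-Q₂ r s = trans
    (⊕-cong (⊗-cong (extendScalars-q r) (extendScalars-q s)) (⊗-cong refl (go s
      (λ i → (Γℚ.- Γℚ.1#) Γℚ^.^ suc i ⊗ SchurQ.q (r ℕ.+ suc i) ⊗ SchurQ.q (s ∸ suc i)) _ λ i →
      ⊗-cong (⊗-cong (extendScalars-sign (suc i)) (extendScalars-q (r ℕ.+ suc i))) (extendScalars-q (s ∸ suc i)))))
    (sym (pair (λ _ → refl) r s))
    where
    go : ∀ n (u : ℕ → Γ ℚ) (v : ℕ → Γ K.Carrier) → (∀ k → extendScalars (u k) ≈ v k) →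
         extendScalars (Summation.sum Γℚ.+-commutativeMonoid {n} λ k → u (toℕ k)) ≈ ∑< n v
    go zero    u v e = con-cong ι.0#-homo
    go (suc n) u v e = ⊕-cong (e 0) (go n (λ k → u (suc k)) (λ k → v (suc k)) λ k → e (suc k))

  extendScalars-Q : ∀ μ → extendScalars (SchurQ.Q μ) ≈ X (map +_ (parts μ))
  extendScalars-Q μ = trans
    (extendScalars-subPf SchurQ.Q₂ X refl X-expansion extendScalars-Q₂ g N (Vec.allFin (N ℕ.* 2)) (Pfℚ.allFin-increasing (N ℕ.* 2)))
    (trans (R.reflexive (≡.cong X (≡.trans (≡.cong (map (λ i → + g i)) (Pfℚ.toList-tabulate id))
        (List.map-tabulate id (λ i → + g i)))))
      (X-padded q₀ (parts μ)))
    where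
    N = ℕ.⌈ length (parts μ) /2⌉
    g : Fin (N ℕ.* 2) → ℕ
    g i = SchurQ.part (parts μ) (toℕ i)

-- Conjugation and the theorem

-- Conjugation of vertex operators by p_n ↦ u_n p_n.
module Conjugation (K : CommutativeRing c ℓ) (ι : ℚ → CommutativeRing.Carrier K)
                   (ι-isRingHomomorphism : Morphisms.RingMorphisms.IsRingHomomorphism
                      ℚ.+-*-rawRing (CommutativeRing.rawRing K) ι) where
  private module K = CommutativeRing K
  open Operators K
  open Polynomials K
  open VertexOperators K ι
  open Vertex K ι ι-isRingHomomorphism using (β; module EO; module R; module O)
  open SetoidReasoning R.setoid
  open Summation R.+-commutativeMonoid using (sum-syntax)

  -- The algebra endomorphism p_n ↦ u_n p_n.
  rescale : (ℕ → K.Carrier) → Γ K.Carrier → Γ K.Carrier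
  rescale u = substitute id (λ k → con (u k) ⊗ p k)

  deg-rescale : ∀ u f → deg (rescale u f) ≡ deg f
  deg-rescale u (con a) = ≡.refl
  deg-rescale u (p k)   = ≡.refl
  deg-rescale u (f ⊕ g) = ≡.cong₂ ℕ._⊔_ (deg-rescale u f) (deg-rescale u g)
  deg-rescale u (f ⊗ g) = ≡.cong₂ ℕ._+_ (deg-rescale u f) (deg-rescale u g)

  -- The chain rule.
  ∂-rescale : ∀ u k f → derivative k (rescale u f) ≈ con (u k) ⊗ rescale u (derivative k f)
  ∂-rescale u k (con a) = sym (R.zeroʳ _)
  ∂-rescale u k (p j) with k ℕ.≟ j
  ... | yes ≡.refl = trans (⊕-cong (R.zeroˡ _) refl) (R.+-identityˡ _)
  ... | no _       = trans (⊕-cong (R.zeroˡ _) (R.zeroʳ _)) (trans (⊕-identityʳ _) (sym (R.zeroʳ _)))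
  ∂-rescale u k (f ⊕ g) = trans (⊕-cong (∂-rescale u k f) (∂-rescale u k g)) (sym (⊗-distribˡ _ _ _))
  ∂-rescale u k (f ⊗ g) = trans
    (⊕-cong (trans (⊗-cong (∂-rescale u k f) refl) (⊗-assoc _ _ _)) (trans (⊗-cong refl (∂-rescale u k g)) (x∙yz≈y∙xz _ _ _)))
    (sym (⊗-distribˡ _ _ _))
    where open CommutativeSemigroupProperties R.*-commutativeSemigroup using (x∙yz≈y∙xz)

  -- ρ is given by the properties of rescale u that are needed, so that it stays
  -- opaque.
  module ByRescaling (u v : ℕ → K.Carrier) (uv≈1 : ∀ k → u k K.* v k K.≈ K.1#) (ρ ρ⁻¹ : Operator)
           (ρ-⊗ : ∀ f g → apply ρ (f ⊗ g) ≈ apply ρ f ⊗ apply ρ g)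
           (ρ-p : ∀ k → apply ρ (p k) ≈ con (u k) ⊗ p k)
           (ρ-∂ : ∀ k f → derivative k (apply ρ f) ≈ con (u k) ⊗ apply ρ (derivative k f))
           (deg-ρ⁻¹ : ∀ f → deg (apply ρ⁻¹ f) ≡ deg f)
           (ρ-ρ⁻¹ : ∀ f → apply ρ (apply ρ⁻¹ f) ≈ f)
           (ρ⁻¹-ρ : ∀ f → apply ρ⁻¹ (apply ρ f) ≈ f) where
    private
      module ρ = Operator ρ

    conjugate : Operator → Operator
    conjugate S = ρ ∘ S ∘ ρ⁻¹

    conjugate-scalar : ∀ a → conjugate (scalar a) ≐ scalar a
    conjugate-scalar a f = trans (ρ.*ₗ-homo a _) (⊗-cong refl (ρ-ρ⁻¹ f))

    conjugate-∘ : ∀ S U → conjugate (S ∘ U) ≐ conjugate S ∘ conjugate U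
    conjugate-∘ S U f = ρ.⟦⟧-cong (Operator.⟦⟧-cong S (sym (ρ⁻¹-ρ _)))

    conjugate-exp : ∀ {A B} → (∀ k → conjugate (A k) ≐ B k) → ∀ n →
                    conjugate (EO.exp (EO.oddSeries A) n) ≐ EO.exp (EO.oddSeries B) n
    conjugate-exp {A} {B} e n f = trans
      (EO.hom-exp operatorRing (λ r → scalar (ι r)) conjugate (λ S U f → ρ.+ᴹ-homo _ _) conjugate-∘
        (conjugate-scalar K.0#) (conjugate-scalar K.1#) (λ r → conjugate-scalar (ι r)) (EO.oddSeries A) n f)
      (EO.exp-cong {λ m → conjugate (EO.oddSeries A m)} {EO.oddSeries B} (λ m g → trans
        (EO.hom-oddSeries operatorRing (λ r → scalar (ι r)) conjugate (λ S U f → ρ.+ᴹ-homo _ _) conjugate-∘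
          (conjugate-scalar K.0#) (conjugate-scalar K.1#) (λ r → conjugate-scalar (ι r)) A m g)
        (EO.oddSeries-cong {λ k → conjugate (A k)} {B} e m g)) n f)

    conjugate-creation : ∀ n → conjugate (creation β n) ≐ creation (λ k → β k K.* u k) n
    conjugate-creation = conjugate-exp {λ k → scalar (β k) ∘ a₋ k} {λ k → scalar (β k K.* u k) ∘ a₋ k} λ k f → begin
      apply ρ (con (β k) ⊗ (p k ⊗ apply ρ⁻¹ f))     ≈⟨ ρ.*ₗ-homo (β k) _ ⟩
      con (β k) ⊗ apply ρ (p k ⊗ apply ρ⁻¹ f)       ≈⟨ ⊗-cong refl (trans (ρ-⊗ _ _) (⊗-cong (ρ-p k) (ρ-ρ⁻¹ f))) ⟩
      con (β k) ⊗ (con (u k) ⊗ p k ⊗ f)             ≈⟨ ⊗-cong refl (⊗-assoc _ _ _) ⟩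
      con (β k) ⊗ (con (u k) ⊗ (p k ⊗ f))           ≈⟨ ⊗-assoc _ _ _ ⟨
      con (β k) ⊗ con (u k) ⊗ (p k ⊗ f)             ≈⟨ ⊗-cong (con-* _ _) refl ⟨
      con (β k K.* u k) ⊗ (p k ⊗ f)                 ∎

    conjugate-∂ : ∀ k → conjugate (∂ k) ≐ scalar (v k) ∘ ∂ k
    conjugate-∂ k f = begin
      apply ρ (derivative k (apply ρ⁻¹ f))
        ≈⟨ trans (⊗-cong (con-cong (K.trans (K.*-comm (v k) (u k)) (uv≈1 k))) refl) (⊗-identityˡ _) ⟨
      con (v k K.* u k) ⊗ apply ρ (derivative k (apply ρ⁻¹ f))
        ≈⟨ trans (⊗-cong (con-* _ _) refl) (⊗-assoc _ _ _) ⟩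
      con (v k) ⊗ (con (u k) ⊗ apply ρ (derivative k (apply ρ⁻¹ f)))
        ≈⟨ ⊗-cong refl (ρ-∂ k (apply ρ⁻¹ f)) ⟨
      con (v k) ⊗ derivative k (apply ρ (apply ρ⁻¹ f))
        ≈⟨ ⊗-cong refl (Operator.⟦⟧-cong (∂ k) (ρ-ρ⁻¹ f)) ⟩
      con (v k) ⊗ derivative k f ∎

    conjugate-annihilation : ∀ n → conjugate (annihilation β n) ≐ annihilation (λ k → β k K.* v k) n
    conjugate-annihilation = conjugate-exp {λ k → O.- (scalar (β k) ∘ a₊ k)} {λ k → O.- (scalar (β k K.* v k) ∘ a₊ k)}
      λ k f → begin
        apply ρ (con (K.- K.1#) ⊗ (con (β k) ⊗ (con (ι (+ odd k / 2)) ⊗ derivative k (apply ρ⁻¹ f))))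
          ≈⟨ trans (ρ.*ₗ-homo _ _) (⊗-cong refl (trans (ρ.*ₗ-homo _ _) (⊗-cong refl (ρ.*ₗ-homo _ _)))) ⟩
        con (K.- K.1#) ⊗ (con (β k) ⊗ (con (ι (+ odd k / 2)) ⊗ apply ρ (derivative k (apply ρ⁻¹ f))))
          ≈⟨ ⊗-cong refl (⊗-cong refl (trans (⊗-cong refl (conjugate-∂ k f)) (x∙yz≈y∙xz _ _ _))) ⟩
        con (K.- K.1#) ⊗ (con (β k) ⊗ (con (v k) ⊗ (con (ι (+ odd k / 2)) ⊗ derivative k f)))
          ≈⟨ ⊗-cong refl (trans (⊗-cong (con-* _ _) refl) (⊗-assoc _ _ _)) ⟨
        con (K.- K.1#) ⊗ (con (β k K.* v k) ⊗ (con (ι (+ odd k / 2)) ⊗ derivative k f)) ∎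
      where open CommutativeSemigroupProperties R.*-commutativeSemigroup using (x∙yz≈y∙xz)

    conjugate-vertexOperator : vertexOperator (λ k → β k K.* u k) (λ k → β k K.* v k)
                             ≋ λ m → conjugate (vertexOperator β β m)
    conjugate-vertexOperator m f = begin
      ∑[ j < suc (deg f) ] productTerm E′ D′ m f (toℕ j)
        ≈⟨ go (suc (deg f)) (productTerm E′ D′ m f) (productTerm E D m (apply ρ⁻¹ f)) term ⟩
      apply ρ (∑[ j < suc (deg f) ] productTerm E D m (apply ρ⁻¹ f) (toℕ j))
        ≡⟨ ≡.cong (λ N → apply ρ (∑[ j < suc N ] productTerm E D m (apply ρ⁻¹ f) (toℕ j))) (deg-ρ⁻¹ f) ⟨
      apply ρ (∑[ j < suc (deg (apply ρ⁻¹ f)) ] productTerm E D m (apply ρ⁻¹ f) (toℕ j)) ∎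
      where
      E D E′ D′ : ℕ → Operator
      E  = creation β
      D  = annihilation β
      E′ = creation (λ k → β k K.* u k)
      D′ = annihilation (λ k → β k K.* v k)

      conjugate-⟨⟩ : ∀ s → conjugate (E ⟨ s ⟩) ≐ E′ ⟨ s ⟩
      conjugate-⟨⟩ (+ n)    = conjugate-creation n
      conjugate-⟨⟩ -[1+ n ] = conjugate-scalar K.0#

      term : ∀ j → productTerm E′ D′ m f j ≈ apply ρ (productTerm E D m (apply ρ⁻¹ f) j)
      term j = sym (trans (conjugate-∘ (E ⟨ m ℤ.+ + j ⟩) (D j) f)
        (trans (conjugate-⟨⟩ (m ℤ.+ + j) (apply (conjugate (D j)) f))
          (Operator.⟦⟧-cong (E′ ⟨ m ℤ.+ + j ⟩) (conjugate-annihilation j f))))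

      go : ∀ n (x y : ℕ → Γ K.Carrier) → (∀ j → x j ≈ apply ρ (y j)) →
           ∑[ j < n ] x (toℕ j) ≈ apply ρ (∑[ j < n ] y (toℕ j))
      go zero    x y e = sym ρ.0ᴹ-homo
      go (suc n) x y e = trans (⊕-cong (e 0) (go n (λ j → x (suc j)) (λ j → y (suc j)) (λ j → e (suc j))))
        (sym (ρ.+ᴹ-homo _ _))

    -- Conjugate operators applied in succession to the unit.
    conjugate-iterate : (Y F : FormalSeries) → (∀ m → Y m ≐ conjugate (F m)) → apply ρ (con K.1#) ≈ con K.1# → ∀ l →
      foldr (λ r → apply (mode Y (ℤ.- (+ r)))) (con K.1#) l
        ≈ apply ρ (foldr (λ m → apply (F m)) (con K.1#) (map +_ l))
    conjugate-iterate Y F e ρ1 []      = sym ρ1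
    conjugate-iterate Y F e ρ1 (r ∷ l) = begin
      apply (Y (ℤ.- (ℤ.- (+ r)))) g
        ≡⟨ ≡.cong (λ m → apply (Y m) g) (ℤ.neg-involutive (+ r)) ⟩
      apply (Y (+ r)) g
        ≈⟨ e (+ r) g ⟩
      apply ρ (apply (F (+ r)) (apply ρ⁻¹ g))
        ≈⟨ ρ.⟦⟧-cong (Operator.⟦⟧-cong (F (+ r)) (trans (Operator.⟦⟧-cong ρ⁻¹ (conjugate-iterate Y F e ρ1 l))
             (ρ⁻¹-ρ _))) ⟩
      apply ρ (apply (F (+ r)) (foldr (λ m → apply (F m)) (con K.1#) (map +_ l))) ∎
      where
      g : Γ K.Carrier
      g = foldr (λ r → apply (mode Y (ℤ.- (+ r)))) (con K.1#) l

open Defs using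
  ( Operator; apply; FormalSeries; _≋_; _∘_; mode; vertexOperator
  ; ι; ι-isRingHomomorphism; 1-t^_; extendScalars; Φ; ρ; ρ⁻¹)
open import Data.Product.Base using (_×_)

private
  module Rescaling = Conjugation ℚ⟨t⟩ ι ι-isRingHomomorphism
  module ByRho = Rescaling.ByRescaling (λ k → 1-t^ odd k) (λ k → [1-t^ odd k ]⁻¹) (λ k → 1-t^-inverse (odd k))
    ρ ρ⁻¹ (λ _ _ → Polynomials.refl) (λ _ → Polynomials.refl) (Rescaling.∂-rescale (λ k → 1-t^ odd k))
    (Rescaling.deg-rescale (λ k → [1-t^ odd k ]⁻¹)) ρ-ρ⁻¹ ρ⁻¹-ρ
  module Schur = Realization ℚ⟨t⟩ ι ι-isRingHomomorphism

  open Polynomials ℚ⟨t⟩ using (refl; sym; trans)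

𝒴≋ρΦρ⁻¹ : 𝒴 ≋ λ m → ρ ∘ Φ m ∘ ρ⁻¹
𝒴≋ρΦρ⁻¹ = ByRho.conjugate-vertexOperator

𝒬≈ρX : ∀ μ → 𝒬 μ Γℚ⟨t⟩.≈ apply ρ (Schur.X (map +_ (parts μ)))
𝒬≈ρX μ = ByRho.conjugate-iterate 𝒴 Φ 𝒴≋ρΦρ⁻¹ refl (parts μ)

ρ-extendScalars : ∀ f → apply ρ (extendScalars f) ≡ f [X-tX]
ρ-extendScalars (con a) = ≡.refl
ρ-extendScalars (p k)   = ≡.refl
ρ-extendScalars (f ⊕ g) = ≡.cong₂ _⊕_ (ρ-extendScalars f) (ρ-extendScalars g)
ρ-extendScalars (f ⊗ g) = ≡.cong₂ _⊗_ (ρ-extendScalars f) (ρ-extendScalars g)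

proposition2p1 : (𝒴 ≋ λ m → ρ ∘ Φ m ∘ ρ⁻¹) ×
    ((μ : StrictPartition) →
    (𝒬 μ Γℚ⟨t⟩.≈ apply ρ (extendScalars (SchurQ.Q μ))) ×
    (apply ρ (extendScalars (SchurQ.Q μ)) Γℚ⟨t⟩.≈ SchurQ.Q μ [X-tX]))
proposition2p1 = 𝒴≋ρΦρ⁻¹ , λ μ →
  trans (𝒬≈ρX μ) (Operator.⟦⟧-cong ρ (sym (Schur.extendScalars-Q μ))) ,
  Γℚ⟨t⟩.reflexive (ρ-extendScalars (SchurQ.Q μ))
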